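{- Let $q$ be a prime power and $n\ge1$, $r>2$ integers. Suppose that for every divisor $k$ of $n$ with $k<n$, the pair $(q^k,n/k)$ is not a Dickson number pair and is not one of the pairs $(5,2),(7,2),(11,2),(23,2),(29,2),(59,2)$. If an $(n-1)$-spread $\mathcal{S}$ of $\mathrm{PG}(rn-1,q)$ contains $r$ normal elements in general position, then $\mathcal{S}$ is a Desarguesian spread.
   Context: An $(n-1)$-spread of $\mathrm{PG}(N-1,q)$ is a set of $(n-1)$-dimensional subspaces partitioning the point set. An element $E$ of an $(n-1)$-spread $\mathcal{S}$ of $\mathrm{PG}(rn-1,q)$ is normal if for every $F\in\mathcal{S}\setminus\{E\}$ the $(2n-1)$-space $\langle E,F\rangle$ is partitioned by elements of $\mathcal{S}$. A set of $(n-1)$-spaces of $\mathrm{PG}(rn-1,q)$ is in general position if any $r$ of them span the whole space. A Desarguesian spread of $\mathrm{PG}(rn-1,q)$ is (any spread projectively equivalent to) the spread obtained by field reduction: regard $V(r,q^n)=\mathbb{F}_{q^n}^r$ as an $rn$-dimensional $\mathbb{F}_q$-vector space; each $1$-dimensional $\mathbb{F}_{q^n}$-subspace becomes an $n$-dimensional $\mathbb{F}_q$-subspace, i.e. an $(n-1)$-space of $\mathrm{PG}(rn-1,q)$, and these form the spread. A pair of positive integers $(Q,m)$ is a Dickson number pair if (i) $Q=p^h$ for a prime $p$; (ii) each prime divisor of $m$ divides $Q-1$; (iii) if $Q\equiv 3\pmod 4$ then $m\not\equiv 0\pmod 4$. -}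

module Defs where

open import Level using (0ℓ)
open import Data.Nat as ℕ using (ℕ; zero; suc; _∸_; _^_; _%_; _≤_)
open import Data.Nat.Divisibility using (_∣_)
open import Data.Nat.Primality using (Prime)
open import Data.Fin using (Fin)
open import Data.Product using (Σ; ∃; _×_; _,_)
open import Data.Sum using (_⊎_)
open import Data.Vec.Functional as VF using (Vector)
open import Algebra.Core using (Op₁; Op₂)
open import Algebra.Structures using (IsCommutativeRing)
open import Relation.Binary.PropositionalEquality using (_≡_; _≢_)
open import Relation.Nullary using (¬_)
open import Function.Bundles using (_↔_; _⇔_)

IsPrimePower : ℕ → Set
IsPrimePower Q = Σ ℕ λ p → Σ ℕ λ h → Prime p × Q ≡ p ^ suc h

DicksonPair : ℕ → ℕ → Set
DicksonPair Q m =
  1 ≤ m ×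
  IsPrimePower Q ×
  (∀ ℓ → Prime ℓ → ℓ ∣ m → ℓ ∣ (Q ∸ 1)) ×
  (Q % 4 ≡ 3 → ¬ (4 ∣ m))

ExceptionalPair : ℕ → ℕ → Set
ExceptionalPair Q m =
  m ≡ 2 × (Q ≡ 5 ⊎ Q ≡ 7 ⊎ Q ≡ 11 ⊎ Q ≡ 23 ⊎ Q ≡ 29 ⊎ Q ≡ 59)

record Field : Set₁ where
  infixl 7 _*_
  infixl 6 _+_
  field
    Carrier : Set
    _+_ _*_ : Op₂ Carrier
    -_      : Op₁ Carrier
    0# 1#   : Carrier
    isCommutativeRing : IsCommutativeRing _≡_ _+_ _*_ -_ 0# 1#
    0≢1     : 0# ≢ 1#
    inverse : ∀ x → x ≢ 0# → ∃ λ y → x * y ≡ 1#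

HasOrder : Field → ℕ → Set
HasOrder F q = Fin q ↔ Field.Carrier F

record FieldHom (F K : Field) : Set where
  private
    module F = Field F
    module K = Field K
  field
    ι     : F.Carrier → K.Carrier
    ι-+   : ∀ a b → ι (a F.+ b) ≡ ι a K.+ ι b
    ι-*   : ∀ a b → ι (a F.* b) ≡ ι a K.* ι b
    ι-1   : ι F.1# ≡ K.1#

module LinAlg (F : Field) where
  open Field F

  V : ℕ → Set
  V N = Vector Carrier N

  _≈_ : ∀ {N} → V N → V N → Set
  u ≈ v = ∀ i → u i ≡ v i

  0v : ∀ {N} → V N
  0v _ = 0#

  _⊕_ : ∀ {N} → V N → V N → V N
  (u ⊕ v) i = u i + v i

  _·_ : ∀ {N} → Carrier → V N → V N
  (a · v) i = a * v i

  NonZeroV : ∀ {N} → V N → Set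
  NonZeroV v = ¬ (v ≈ 0v)

  ∑ : ∀ {N k} → (Fin k → V N) → V N
  ∑ {k = zero}  f = 0v
  ∑ {k = suc k} f = f Fin.zero ⊕ ∑ (λ j → f (Fin.suc j))

  lincomb : ∀ {N k} → (Fin k → Carrier) → (Fin k → V N) → V N
  lincomb c b = ∑ (λ j → c j · b j)

  _∈span_ : ∀ {N k} → V N → (Fin k → V N) → Set
  v ∈span b = ∃ λ c → v ≈ lincomb c b

  _⊆span_ : ∀ {N k l} → (Fin k → V N) → (Fin l → V N) → Set
  a ⊆span b = ∀ v → v ∈span a → v ∈span b

  LinIndep : ∀ {N k} → (Fin k → V N) → Set
  LinIndep b = ∀ c → lincomb c b ≈ 0v → ∀ j → c j ≡ 0#

  -- An (n-1)-spread of PG(N-1,F): a family of n-dimensional subspaces of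
  -- F^N (each given by a basis) such that every nonzero vector (point)
  -- lies in exactly one of them.
  record Spread (N n : ℕ) : Set₁ where
    field
      Idx      : Set
      basis    : Idx → Fin n → V N
      indep    : ∀ i → LinIndep (basis i)
      cover    : ∀ v → NonZeroV v → ∃ λ i → v ∈span basis i
      disjoint : ∀ v → NonZeroV v → ∀ i j →
                 v ∈span basis i → v ∈span basis j → i ≡ j

  module _ {N n : ℕ} (S : Spread N n) where
    open Spread S

    PartitionedBy : ∀ {k} → (Fin k → V N) → Set
    PartitionedBy w = ∀ v → NonZeroV v → v ∈span w →
      ∃ λ i → v ∈span basis i × basis i ⊆span w

    IsNormal : Idx → Set
    IsNormal e = ∀ f → f ≢ e → PartitionedBy (basis e VF.++ basis f)

    SpanWhole : ∀ {r} → (Fin r → Idx) → Set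
    SpanWhole e = ∀ v → v ∈span VF.concat (λ j → basis (e j))

  -- Desarguesian spread of PG(rn-1,q) (F of order q): there is a field K
  -- of order q^n, an embedding ι : F → K, and a bijection φ : K^r → F^(rn)
  -- which is F-linear (F acting on K^r via ι), such that the elements of S
  -- are exactly the images of the 1-dimensional K-subspaces of K^r.
  -- (Letting ι vary also covers semilinear maps, i.e. all collineations.)
  Desarguesian : (q n r : ℕ) → Spread (r ℕ.* n) n → Set₁
  Desarguesian q n r S =
    Σ Field λ K → HasOrder K (q ^ n) × Σ (FieldHom F K) λ h →
    let module K = Field K
        open FieldHom h
        _≈K_ : (Fin r → K.Carrier) → (Fin r → K.Carrier) → Set
        u ≈K w = ∀ j → u j ≡ w j
        NonZeroK : (Fin r → K.Carrier) → Set
        NonZeroK w = ¬ (w ≈K (λ _ → K.0#))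
        _⊞_ : (Fin r → K.Carrier) → (Fin r → K.Carrier) → Fin r → K.Carrier
        (u ⊞ w) j = u j K.+ w j
        _⊙_ : K.Carrier → (Fin r → K.Carrier) → Fin r → K.Carrier
        (λ' ⊙ w) j = λ' K.* w j
        open Spread S
    in Σ ((Fin r → K.Carrier) → V (r ℕ.* n)) λ φ →
         (∀ u w → u ≈K w → φ u ≈ φ w) ×
         (∀ u w → φ (u ⊞ w) ≈ (φ u ⊕ φ w)) ×
         (∀ a u → φ (ι a ⊙ u) ≈ (a · φ u)) ×
         (∀ u w → φ u ≈ φ w → u ≈K w) ×
         (∀ v → ∃ λ u → φ u ≈ v) ×
         (∀ i → ∃ λ w → NonZeroK w ×
            (∀ v → (v ∈span basis i) ⇔ (∃ λ λ' → v ≈ φ (λ' ⊙ w)))) ×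
         (∀ w → NonZeroK w → ∃ λ i →
            (∀ v → (v ∈span basis i) ⇔ (∃ λ λ' → v ≈ φ (λ' ⊙ w))))

{-# OPTIONS --safe #-}

-- In coordinates (x₁, …, xᵣ) with the normal elements as axes and one further spread element as the diagonal,
-- normality shows that setting coordinates to zero maps spread elements to spread elements. For r > 2 it follows that
-- the spread induced on the line spanned by two axes is { y = A x ∣ A ∈ G } for one and the same group G of linear maps, regular
-- on nonzero vectors, so that the spread comes from a nearfield with multiplicative group G. It is Desarguesian
-- as soon as G is commutative. By Fermat's little theorem the absence of Dickson pairs (q ^ (n / ℓ), ℓ) for the primes ℓ
-- dividing n means that n is prime to ∣ G ∣ = q ^ n - 1. Thus Zassenhaus's classification of the finite nearfields
-- is not needed: every absolutely irreducible constituent of G has a degree dividing both n and ∣ G ∣, hence degree 1. The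
-- proof replaces this representation theory by a count in a minimal nonabelian subgroup.
module Submission where

open import Defs
open import Data.Nat
open import Data.Nat.Properties
open import Data.Nat.Divisibility
open import Data.Nat.DivMod
open import Data.Nat.Induction using (<-rec)
open import Data.Nat.Primality using (Prime; euclidsLemma; prime⇒nonZero; prime⇒nonTrivial; prime⇒irreducible)
open import Data.Nat.Primality.Factorisation using (factorise)
open import Data.Nat.Coprimality using (prime⇒coprime; coprime-Bézout)
open import Data.Nat.GCD using (module Bézout)
open import Data.Fin as Fin using (Fin; toℕ; fromℕ<; _↑ˡ_; _↑ʳ_; combine)
import Data.Fin.Properties as Fin
open import Data.Bool using (Bool; true; false; if_then_else_; _∨_)
open import Data.Empty using (⊥)
open import Data.Unit using (⊤; tt)
open import Data.Product using (∃; _×_; _,_; proj₁; proj₂; uncurry)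
import Data.Product as Product
open import Data.Sum using (_⊎_; inj₁; inj₂; [_,_]′)
open import Data.List using ([]; _∷_)
open import Data.List.Relation.Unary.All using ([]; _∷_)
open import Data.Vec as Vec using (Vec; []; _∷_; zipWith; map; replicate; lookup; tabulate)
import Data.Vec.Properties as Vec
import Data.Vec.Functional as VF
open import Function using (_∘_; _↔_; Inverse; mk↔ₛ′; mk↣; _⇔_; mk⇔)
open import Relation.Nullary
open import Relation.Nullary.Decidable
  using (map′; via-injection; _→-dec_; _×-dec_; _⊎-dec_; ¬?; dec-true; dec-false; decidable-stable; recompute)
open import Relation.Unary using (Decidable)
open import Relation.Binary.Definitions using (DecidableEquality; tri<; tri≈; tri>)
open import Relation.Binary.PropositionalEquality hiding ([_]; J)
open import Algebra.Structures using (IsCommutativeMonoid; IsGroup; IsAbelianGroup; IsCommutativeRing)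
open import Algebra.Bundles using (CommutativeMonoid; Group)
import Algebra.Properties.CommutativeMonoid.Sum as Sum
import Algebra.Properties.Group as GroupProperties
import Algebra.Properties.Ring as RingProperties

-- Finite types and sums

-- The field F need not contain the eigenvalues of an element a of G, so eigenspaces are defined
-- with a itself in place of a root of unity: an operator commuting with a is decomposed according
-- to the power of a as which it acts. Freeness supplies what this needs: a ^ j - 1 is injective for
-- 0 < j < d, where d is the order of a, so the orthogonality relations hold; and d is invertible in
-- F because it divides q ^ n - 1. Decomposing the action on W shows that an element which commutes
-- with a and has order dividing d is a power of a. On W, however, a gives only a trivial
-- decomposition of itself. The space End W carries two commuting copies of a, multiplication on the
-- left and on the right, and there the decomposition of one by the other carries information; this
-- is why the dimension that gets counted is n². Both decompositions serve one property, the only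
-- one that the group theory uses: an element that commutes with its conjugate by b commutes with b.

module _ {A : Set} {N : ℕ} (I : Fin N ↔ A) where
  open Inverse I

  from-injective : ∀ {x y} → from x ≡ from y → x ≡ y
  from-injective {x} {y} eq =
    trans (sym (strictlyInverseˡ x)) (trans (cong to eq) (strictlyInverseˡ y))

  to-injective : ∀ {i j} → to i ≡ to j → i ≡ j
  to-injective {i} {j} eq =
    trans (sym (strictlyInverseʳ i)) (trans (cong from eq) (strictlyInverseʳ j))

  finite-≟ : DecidableEquality A
  finite-≟ = via-injection (mk↣ from-injective) Fin._≟_

  finite-any? : {P : A → Set} → Decidable P → Dec (∃ P)
  finite-any? {P} P? = map′ (λ (i , p) → to i , p)
    (λ (x , p) → from x , subst P (sym (strictlyInverseˡ x)) p) (Fin.any? (P? ∘ to))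

  finite-all? : {P : A → Set} → Decidable P → Dec (∀ x → P x)
  finite-all? {P} P? = map′ (λ p x → subst P (strictlyInverseˡ x) (p (from x)))
    (λ p i → p (to i)) (Fin.all? (P? ∘ to))

-- If `y` were missed, punching it out would inject `Fin (suc N)` into `Fin N`.
fin-injective⇒surjective : ∀ {N} (f : Fin N → Fin N) → (∀ {i j} → f i ≡ f j → i ≡ j) →
  ∀ y → ∃ λ x → f x ≡ y
fin-injective⇒surjective {suc N} f inj y with Fin.any? (λ x → f x Fin.≟ y)
... | yes p = p
... | no ¬p = contradiction
  (Fin.injective⇒≤ {f = λ i → Fin.punchOut (λ eq → ¬p (i , sym eq))}
    (λ {i} {j} eq → inj (Fin.punchOut-injective (λ e → ¬p (i , sym e)) (λ e → ¬p (j , sym e)) eq)))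
  1+n≰n

module _ {A : Set} {N : ℕ} (I : Fin N ↔ A) where
  open Inverse I

  injective⇒surjective : (f : A → A) → (∀ {x y} → f x ≡ f y → x ≡ y) → ∀ y → ∃ λ x → f x ≡ y
  injective⇒surjective f inj y =
    let i , eq = fin-injective⇒surjective (from ∘ f ∘ to)
                   (to-injective I ∘ inj ∘ from-injective I) (from y)
    in to i , from-injective I eq

  -- A section `g` of `f` is injective, hence bijective by finiteness, and `f` is its two-sided
  -- inverse.
  surjective⇒injective : (f : A → A) → (∀ y → ∃ λ x → f x ≡ y) → ∀ {x y} → f x ≡ f y → x ≡ y
  surjective⇒injective f surj {x} {y} eq =
    trans (sym (gf x)) (trans (cong g eq) (gf y))
    where
    g : A → A
    g = proj₁ ∘ surj
    g-inj : ∀ {x y} → g x ≡ g y → x ≡ y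
    g-inj {x} {y} e = trans (sym (proj₂ (surj x))) (trans (cong f e) (proj₂ (surj y)))
    gf : ∀ x → g (f x) ≡ x
    gf x with z , refl ← injective⇒surjective g g-inj x = cong g (proj₂ (surj z))

module SumLemmas {A : Set} {_+̇_ : A → A → A} {0̇ : A} (isCM : IsCommutativeMonoid _≡_ _+̇_ 0̇) where
  open IsCommutativeMonoid isCM using (identityˡ; identityʳ)
  commutativeMonoid : CommutativeMonoid _ _
  commutativeMonoid = record { isCommutativeMonoid = isCM }

  open Sum commutativeMonoid public
    using (sum; sum-cong-≗; ∑-distrib-+; ∑-comm; sum-replicate-zero; sum-init-last)

  sum-zero : ∀ {k} (h : Fin k → A) → (∀ i → h i ≡ 0̇) → sum h ≡ 0̇
  sum-zero {k} h h≈0 = trans (sum-cong-≗ h≈0) (sum-replicate-zero k)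

  sum-single : ∀ {k} (h : Fin k → A) i → (∀ j → j ≢ i → h j ≡ 0̇) → sum h ≡ h i
  sum-single {suc k} h Fin.zero z =
    trans (cong (h Fin.zero +̇_) (sum-zero (h ∘ Fin.suc) (λ j → z (Fin.suc j) λ ()))) (identityʳ _)
  sum-single {suc k} h (Fin.suc i) z =
    trans (cong₂ _+̇_ (z Fin.zero λ ()) (sum-single (h ∘ Fin.suc) i
      (λ j j≢i → z (Fin.suc j) (j≢i ∘ Fin.suc-injective)))) (identityˡ _)

  sum-last : (h : ℕ → A) → ∀ k → sum {suc k} (h ∘ toℕ) ≡ sum {k} (h ∘ toℕ) +̇ h k
  sum-last h k = trans (sum-init-last {k} (h ∘ toℕ))
    (cong₂ _+̇_ (sum-cong-≗ {k} (λ i → cong h (Fin.toℕ-inject₁ i))) (cong h (Fin.toℕ-fromℕ k)))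

open SumLemmas +-0-isCommutativeMonoid public

sum-const : ∀ k c → sum {k} (λ _ → c) ≡ k * c
sum-const zero c = refl
sum-const (suc k) c = cong (c +_) (sum-const k c)

sum-*ˡ : ∀ {k} c (h : Fin k → ℕ) → sum (λ i → c * h i) ≡ c * sum h
sum-*ˡ {zero} c h = sym (*-zeroʳ c)
sum-*ˡ {suc k} c h = trans (cong (c * h Fin.zero +_) (sum-*ˡ c (h ∘ Fin.suc)))
  (sym (*-distribˡ-+ c (h Fin.zero) _))

sum-mono : ∀ {k} {f g : Fin k → ℕ} → (∀ i → f i ≤ g i) → sum f ≤ sum g
sum-mono {zero} le = z≤n
sum-mono {suc k} le = +-mono-≤ (le Fin.zero) (sum-mono (le ∘ Fin.suc))


𝟙 : {P : Set} → Dec P → ℕ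
𝟙 P? = if does P? then 1 else 0

𝟙-yes : {P : Set} (P? : Dec P) → P → 𝟙 P? ≡ 1
𝟙-yes P? p rewrite dec-true P? p = refl

𝟙-no : {P : Set} (P? : Dec P) → ¬ P → 𝟙 P? ≡ 0
𝟙-no P? ¬p rewrite dec-false P? ¬p = refl

𝟙-mono : {P Q : Set} (P? : Dec P) (Q? : Dec Q) → (P → Q) → 𝟙 P? ≤ 𝟙 Q?
𝟙-mono (yes p) Q? f rewrite 𝟙-yes Q? (f p) = ≤-refl
𝟙-mono (no ¬p) Q? f = z≤n

𝟙-cong : {P Q : Set} (P? : Dec P) (Q? : Dec Q) → (P → Q) → (Q → P) → 𝟙 P? ≡ 𝟙 Q?
𝟙-cong P? Q? f g = ≤-antisym (𝟙-mono P? Q? f) (𝟙-mono Q? P? g)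

-- Orbits

iter : {A : Set} → (A → A) → ℕ → A → A
iter f zero x = x
iter f (suc k) x = f (iter f k x)

iter-+ : {A : Set} (f : A → A) → ∀ i j x → iter f (i + j) x ≡ iter f i (iter f j x)
iter-+ f zero j x = refl
iter-+ f (suc i) j x = cong f (iter-+ f i j x)

iter-fixed : {A : Set} (f : A → A) → ∀ i x → f x ≡ x → iter f i x ≡ x
iter-fixed f zero x e = refl
iter-fixed f (suc i) x e = trans (cong f (iter-fixed f i x e)) e

iter-* : {A : Set} (f : A → A) → ∀ i j x → iter f (i * j) x ≡ iter (iter f j) i x
iter-* f zero j x = refl
iter-* f (suc i) j x = trans (iter-+ f j (i * j) x) (cong (iter f j) (iter-* f i j x))

iter-commute : {A : Set} (f g : A → A) → (∀ x → f (g x) ≡ g (f x)) → ∀ i j x →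
  iter f i (iter g j x) ≡ iter g j (iter f i x)
iter-commute f g c zero j x = refl
iter-commute f g c (suc i) j x = trans (cong f (iter-commute f g c i j x)) (one j (iter f i x))
  where
  one : ∀ j x → f (iter g j x) ≡ iter g j (f x)
  one zero x = refl
  one (suc j) x = trans (c (iter g j x)) (cong g (one j x))

module _ {N ℓ : ℕ} (0<ℓ : 0 < ℓ) (τ : Fin N → Fin N) where

  -- Only points of nonzero weight are constrained, so that the condition survives when an orbit is
  -- deleted by giving its points weight 0.
  FreeOrbits : (Fin N → ℕ) → Set
  FreeOrbits f = ∀ x → f x ≢ 0 → iter τ ℓ x ≡ x × (∀ i → 0 < i → i < ℓ → iter τ i x ≢ x)

  private
    InOrbit : Fin N → Fin N → Set
    InOrbit x y = ∃ λ (i : Fin ℓ) → iter τ (toℕ i) x ≡ y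

    inOrbit? : ∀ x y → Dec (InOrbit x y)
    inOrbit? x y = Fin.any? (λ i → iter τ (toℕ i) x Fin.≟ y)

    module _ {x : Fin N} (per : iter τ ℓ x ≡ x) where

      step : ∀ {y} → InOrbit x y → InOrbit x (τ y)
      step (i , eq) with m≤n⇒m<n∨m≡n (Fin.toℕ<n i)
      ... | inj₁ lt = fromℕ< lt , trans (cong (λ k → iter τ k x) (Fin.toℕ-fromℕ< lt)) (cong τ eq)
      ... | inj₂ e = fromℕ< 0<ℓ , trans (cong (λ k → iter τ k x) (Fin.toℕ-fromℕ< 0<ℓ))
                       (trans (sym per) (trans (cong (λ k → iter τ k x) (sym e)) (cong τ eq)))

      steps : ∀ k {y} → InOrbit x y → InOrbit x (iter τ k y)
      steps zero o = o
      steps (suc k) o = step (steps k o)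

      -- `τ` is not assumed injective. On a point of period `ℓ` it is undone by `ℓ - 1` further
      -- steps.
      unstep : ∀ {y} → iter τ ℓ y ≡ y → InOrbit x (τ y) → InOrbit x y
      unstep {y} pery o = subst (InOrbit x) eq (steps (pred ℓ) o)
        where
        eq : iter τ (pred ℓ) (τ y) ≡ y
        eq = trans (sym (iter-+ τ (pred ℓ) 1 y)) (trans (cong (λ k → iter τ k y)
          (trans (+-comm (pred ℓ) 1) (suc-pred ℓ {{>-nonZero 0<ℓ}}))) pery)

      -- Following a coincidence of the `i`-th and `j`-th points for `ℓ ∸ j` more steps gives a
      -- return to `x` after `ℓ ∸ j + i` steps, which is positive and less than `ℓ`.
      distinct : (∀ i → 0 < i → i < ℓ → iter τ i x ≢ x) →
        ∀ {i j} → i < j → j < ℓ → iter τ i x ≢ iter τ j x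
      distinct free {i} {j} i<j j<ℓ eq = free (ℓ ∸ j + i)
        (<-≤-trans (m<n⇒0<n∸m j<ℓ) (m≤m+n _ _))
        (subst (ℓ ∸ j + i <_) (m∸n+n≡m (<⇒≤ j<ℓ)) (+-monoʳ-< (ℓ ∸ j) i<j))
        (begin
          iter τ (ℓ ∸ j + i) x          ≡⟨ iter-+ τ (ℓ ∸ j) i x ⟩
          iter τ (ℓ ∸ j) (iter τ i x)   ≡⟨ cong (iter τ (ℓ ∸ j)) eq ⟩
          iter τ (ℓ ∸ j) (iter τ j x)   ≡⟨ iter-+ τ (ℓ ∸ j) j x ⟨
          iter τ (ℓ ∸ j + j) x          ≡⟨ cong (λ k → iter τ k x) (m∸n+n≡m (<⇒≤ j<ℓ)) ⟩
          iter τ ℓ x                    ≡⟨ per ⟩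
          x                             ∎)
        where open ≡-Reasoning

      orbit-injective : (∀ i → 0 < i → i < ℓ → iter τ i x ≢ x) →
        ∀ {i j : Fin ℓ} → iter τ (toℕ i) x ≡ iter τ (toℕ j) x → i ≡ j
      orbit-injective free {i} {j} eq with Fin.<-cmp i j
      ... | tri≈ _ e _ = e
      ... | tri< i<j _ _ = contradiction eq (distinct free i<j (Fin.toℕ<n j))
      ... | tri> _ _ j<i = contradiction (sym eq) (distinct free j<i (Fin.toℕ<n i))

    removeOrbit : Fin N → (Fin N → ℕ) → Fin N → ℕ
    removeOrbit x f y = if does (inOrbit? x y) then 0 else f y

    module _ (f : Fin N → ℕ) (inv : ∀ y → f (τ y) ≡ f y) (free : FreeOrbits f) (x : Fin N) (fx≢0 : f x ≢ 0) where

      f′ : Fin N → ℕ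
      f′ = removeOrbit x f

      f′-in : ∀ {y} → InOrbit x y → f′ y ≡ 0
      f′-in {y} o rewrite dec-true (inOrbit? x y) o = refl

      f′-out : ∀ {y} → ¬ InOrbit x y → f′ y ≡ f y
      f′-out {y} o rewrite dec-false (inOrbit? x y) o = refl

      f′≢0⇒f≢0 : ∀ {y} → f′ y ≢ 0 → f y ≢ 0
      f′≢0⇒f≢0 {y} ne with inOrbit? x y
      ... | yes o = contradiction refl ne
      ... | no ¬o = ne

      f′-inv : ∀ y → f′ (τ y) ≡ f′ y
      f′-inv y with f y ≟ 0
      ... | yes z = trans (vanish (trans (inv y) z)) (sym (vanish z))
        where
        vanish : ∀ {y} → f y ≡ 0 → f′ y ≡ 0
        vanish {y} z with inOrbit? x y
        ... | yes o = refl
        ... | no ¬o = z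
      ... | no nz with inOrbit? x y
      ...   | yes o = f′-in (step (proj₁ (free x fx≢0)) o)
      ...   | no ¬o = trans (f′-out (¬o ∘ unstep (proj₁ (free x fx≢0)) (proj₁ (free y nz)))) (inv y)

      f-iter : ∀ k → f (iter τ k x) ≡ f x
      f-iter zero = refl
      f-iter (suc k) = trans (inv _) (f-iter k)

      hit : Fin ℓ → Fin N → ℕ
      hit i y = 𝟙 (iter τ (toℕ i) x Fin.≟ y)

      split : ∀ y → f y ≡ f′ y + f x * sum (λ i → hit i y)
      split y = go (inOrbit? x y)
        where
        go : Dec (InOrbit x y) → f y ≡ f′ y + f x * sum (λ i → hit i y)
        go (yes o@(i , refl)) = begin
          f y                               ≡⟨ f-iter (toℕ i) ⟩
          f x                               ≡⟨ *-identityʳ (f x) ⟨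
          f x * 1                           ≡⟨ cong (f x *_) (𝟙-yes (y Fin.≟ y) refl) ⟨
          f x * hit i y                     ≡⟨ cong (f x *_) (sum-single (λ j → hit j y) i
                                                (λ j j≢i → 𝟙-no (_ Fin.≟ _) (j≢i ∘ orbit-injective
                                                  (proj₁ (free x fx≢0)) (proj₂ (free x fx≢0))))) ⟨
          f x * sum (λ i → hit i y)         ≡⟨ cong (_+ f x * sum (λ i → hit i y)) (f′-in o) ⟨
          f′ y + f x * sum (λ i → hit i y)  ∎
          where open ≡-Reasoning
        go (no ¬o) = begin
          f y                               ≡⟨ f′-out ¬o ⟨
          f′ y                              ≡⟨ +-identityʳ (f′ y) ⟨
          f′ y + 0                          ≡⟨ cong (f′ y +_) (*-zeroʳ (f x)) ⟨
          f′ y + f x * 0                    ≡⟨ cong (λ s → f′ y + f x * s) (sum-zero _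
                                                (λ i → 𝟙-no (_ Fin.≟ _) (λ e → ¬o (i , e)))) ⟨
          f′ y + f x * sum (λ i → hit i y)  ∎
          where open ≡-Reasoning

      sum-split : sum f ≡ sum f′ + f x * ℓ
      sum-split = begin
        sum f                                                   ≡⟨ sum-cong-≗ split ⟩
        sum (λ y → f′ y + f x * sum (λ i → hit i y))            ≡⟨ ∑-distrib-+ f′ _ ⟩
        sum f′ + sum (λ y → f x * sum (λ i → hit i y))          ≡⟨ cong (sum f′ +_) (sum-*ˡ (f x) (λ y → sum (λ i → hit i y))) ⟩
        sum f′ + f x * sum (λ y → sum (λ i → hit i y))          ≡⟨ cong (λ s → sum f′ + f x * s) (∑-comm (λ y i → hit i y)) ⟩
        sum f′ + f x * sum (λ i → sum (λ y → hit i y))          ≡⟨ cong (λ s → sum f′ + f x * s) (sum-cong-≗ one) ⟩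
        sum f′ + f x * sum {ℓ} (λ i → 1)                        ≡⟨ cong (λ s → sum f′ + f x * s) (trans (sum-const ℓ 1) (*-identityʳ ℓ)) ⟩
        sum f′ + f x * ℓ                                        ∎
        where
        open ≡-Reasoning
        one : ∀ i → sum (hit i) ≡ 1
        one i = trans (sum-single (hit i) (iter τ (toℕ i) x) (λ y ne → 𝟙-no (_ Fin.≟ _) (ne ∘ sym)))
                      (𝟙-yes (z Fin.≟ z) refl)
          where z = iter τ (toℕ i) x

  -- Strong induction on the total weight. By `sum-split`, deleting the orbit of a point `x` of
  -- nonzero weight lowers it by `f x * ℓ`.
  orbits-∣-sum : (f : Fin N → ℕ) → (∀ y → f (τ y) ≡ f y) → FreeOrbits f → ℓ ∣ sum f
  orbits-∣-sum f inv free = <-rec Goal go (sum f) f refl inv free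
    where
    Goal : ℕ → Set
    Goal s = ∀ f → sum f ≡ s → (∀ y → f (τ y) ≡ f y) → FreeOrbits f → ℓ ∣ s
    go : ∀ s → (∀ {s′} → s′ < s → Goal s′) → Goal s
    go s rec f refl inv free with Fin.any? (λ x → ¬? (f x ≟ 0))
    ... | no none = subst (ℓ ∣_) (sym (sum-zero f (λ y → decidable-stable (f y ≟ 0) (λ ne → none (y , ne))))) (ℓ ∣0)
    ... | yes (x , fx≢0) = subst (ℓ ∣_) (sym eq)
      (∣m∣n⇒∣m+n (rec lt (f′ f inv free x fx≢0) refl (f′-inv f inv free x fx≢0)
          (λ y → free y ∘ f′≢0⇒f≢0 f inv free x fx≢0))
        (n∣m*n (f x)))
      where
      eq = sum-split f inv free x fx≢0
      lt : sum (f′ f inv free x fx≢0) < sum f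
      lt = subst (sum (f′ f inv free x fx≢0) <_) (sym eq) (m<m+n _ (*-mono-≤ (n≢0⇒n>0 fx≢0) 0<ℓ))

-- Arithmetic

prime⇒pos : ∀ {p} → Prime p → 0 < p
prime⇒pos pr = >-nonZero⁻¹ _ {{prime⇒nonZero pr}}

prime⇒>1 : ∀ {p} → Prime p → 1 < p
prime⇒>1 pr = nonTrivial⇒n>1 _ {{prime⇒nonTrivial pr}}

-- The prime `ℓ` is coprime to `i`, so Bézout's identity writes 1 as a difference of a multiple of
-- `ℓ` and a multiple of `i`, in one order or the other; each multiple fixes `x`.
iter-gcd : {A : Set} (f : A → A) {x : A} {ℓ i : ℕ} → Prime ℓ → 0 < i → i < ℓ →
  iter f ℓ x ≡ x → iter f i x ≡ x → f x ≡ x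
iter-gcd f {x} {ℓ} {i} pr 0<i i<ℓ eℓ ei = go (coprime-Bézout (prime⇒coprime pr {{>-nonZero 0<i}} i<ℓ))
  where
  multiple : ∀ {j} k → iter f j x ≡ x → iter f (k * j) x ≡ x
  multiple {j} k e = trans (iter-* f k j x) (iter-fixed (iter f j) k x e)
  bezout : ∀ {j j′} a b → 1 + b * j′ ≡ a * j → iter f j x ≡ x → iter f j′ x ≡ x → f x ≡ x
  bezout a b eq e e′ = trans (cong f (sym (multiple b e′)))
    (trans (cong (λ k → iter f k x) eq) (multiple a e))
  go : Bézout.Identity 1 ℓ i → f x ≡ x
  go (Bézout.+- a b eq) = bezout a b eq eℓ ei
  go (Bézout.-+ a b eq) = bezout b a eq ei eℓ

prime-orbits-∣-sum : ∀ {N ℓ} → Prime ℓ → (τ : Fin N → Fin N) (f : Fin N → ℕ) →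
  (∀ y → f (τ y) ≡ f y) → (∀ y → f y ≢ 0 → iter τ ℓ y ≡ y) → (∀ y → f y ≢ 0 → τ y ≢ y) → ℓ ∣ sum f
prime-orbits-∣-sum pr τ f inv per moved = orbits-∣-sum (prime⇒pos pr) τ f inv
  (λ y ne → per y ne , λ i 0<i i<ℓ e → moved y ne (iter-gcd τ pr 0<i i<ℓ (per y ne) e))

-- Multiplication by y is a permutation of the nonzero residues mod ℓ of order dividing ℓ; without
-- fixed points, ℓ would divide ℓ - 1.
prime∣^∸1 : ∀ {ℓ y} → Prime ℓ → 1 ≤ y → ℓ ∣ y ^ ℓ ∸ 1 → ℓ ∣ y ∸ 1
prime∣^∸1 {ℓ@(suc ℓ-1)} {y@(suc y-1)} pr 1≤y (divides t eq) =
  decidable-stable (ℓ ∣? y-1) λ ℓ∤y-1 →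
    >⇒∤ ≤-refl (subst (ℓ ∣_) sum≡ (prime-orbits-∣-sum pr τ f f-inv (λ z _ → per z) (moved ℓ∤y-1)))
  where
  instance
    ℓ-1≢0 : NonZero ℓ-1
    ℓ-1≢0 = >-nonZero (s≤s⁻¹ (prime⇒>1 pr))
  τ : Fin ℓ → Fin ℓ
  τ z = (y * toℕ z) mod ℓ
  f : Fin ℓ → ℕ
  f Fin.zero = 0
  f (Fin.suc _) = 1
  sum≡ : sum f ≡ ℓ-1
  sum≡ = trans (sum-const ℓ-1 1) (*-identityʳ ℓ-1)
  toℕ-τ : ∀ z → toℕ (τ z) ≡ (y * toℕ z) % ℓ
  toℕ-τ z = Fin.toℕ-fromℕ< _
  toℕ-iter : ∀ k z → toℕ (iter τ k z) ≡ (y ^ k * toℕ z) % ℓ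
  toℕ-iter zero z = sym (trans (cong (_% ℓ) (+-identityʳ (toℕ z))) (m<n⇒m%n≡m (Fin.toℕ<n z)))
  toℕ-iter (suc k) z = begin
    toℕ (τ (iter τ k z))              ≡⟨ toℕ-τ (iter τ k z) ⟩
    (y * toℕ (iter τ k z)) % ℓ        ≡⟨ cong (λ w → (y * w) % ℓ) (toℕ-iter k z) ⟩
    (y * ((y ^ k * toℕ z) % ℓ)) % ℓ   ≡⟨ [m*n%d]%d≡ y (y ^ k * toℕ z) ⟩
    (y * (y ^ k * toℕ z)) % ℓ         ≡⟨ cong (_% ℓ) (*-assoc y (y ^ k) (toℕ z)) ⟨
    (y ^ suc k * toℕ z) % ℓ           ∎
    where
    open ≡-Reasoning
    [m*n%d]%d≡ : ∀ m n → (m * (n % ℓ)) % ℓ ≡ (m * n) % ℓ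
    [m*n%d]%d≡ m n = trans (%-distribˡ-* m (n % ℓ) ℓ)
      (trans (cong (λ w → (m % ℓ * w) % ℓ) (m%n%n≡m%n n ℓ)) (sym (%-distribˡ-* m n ℓ)))
  y^ℓ : y ^ ℓ ≡ 1 + t * ℓ
  y^ℓ = trans (sym (m+[n∸m]≡n (m^n>0 y ℓ))) (cong (1 +_) eq)
  per : ∀ z → iter τ ℓ z ≡ z
  per z = Fin.toℕ-injective (begin
    toℕ (iter τ ℓ z)                   ≡⟨ toℕ-iter ℓ z ⟩
    (y ^ ℓ * toℕ z) % ℓ                ≡⟨ cong (λ w → (w * toℕ z) % ℓ) y^ℓ ⟩
    (toℕ z + t * ℓ * toℕ z) % ℓ        ≡⟨ cong (λ w → (toℕ z + w) % ℓ) (trans (*-assoc t ℓ (toℕ z)) (trans (cong (t *_) (*-comm ℓ (toℕ z))) (sym (*-assoc t (toℕ z) ℓ)))) ⟩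
    (toℕ z + t * toℕ z * ℓ) % ℓ        ≡⟨ [m+kn]%n≡m%n (toℕ z) (t * toℕ z) ℓ ⟩
    toℕ z % ℓ                          ≡⟨ m<n⇒m%n≡m (Fin.toℕ<n z) ⟩
    toℕ z                              ∎)
    where open ≡-Reasoning
  τ0 : τ Fin.zero ≡ Fin.zero
  τ0 = Fin.toℕ-injective (trans (toℕ-τ Fin.zero) (trans (cong (_% ℓ) (*-zeroʳ y)) (m*n%n≡0 0 ℓ)))
  f-inv : ∀ z → f (τ z) ≡ f z
  f-inv Fin.zero = cong f τ0
  f-inv z@(Fin.suc _) with τ z in τz
  ... | Fin.suc _ = refl
  -- If `τ z` were 0, the remaining `ℓ-1` steps of the period would end at 0 and not at `z`.
  ... | Fin.zero = contradiction (trans (sym (per z)) (trans (trans (cong (λ k → iter τ k z) (+-comm 1 ℓ-1))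
          (trans (iter-+ τ ℓ-1 1 z) (cong (iter τ ℓ-1) τz))) (iter-fixed τ ℓ-1 Fin.zero τ0))) λ ()
  moved : ¬ (ℓ ∣ y-1) → ∀ z → f z ≢ 0 → τ z ≢ z
  moved ℓ∤ Fin.zero ne _ = ne refl
  -- A fixed `z` means that `ℓ` divides (y - 1) z, where 0 < z < ℓ.
  moved ℓ∤ z@(Fin.suc z′) _ e = [ ℓ∤ , >⇒∤ (Fin.toℕ<n z) ]′ (euclidsLemma y-1 (toℕ z) pr
    (divides ((y * toℕ z) / ℓ) (+-cancelˡ-≡ (toℕ z) _ _ (begin
      toℕ z + y-1 * toℕ z                                ≡⟨ m≡m%n+[m/n]*n (y * toℕ z) ℓ ⟩
      (y * toℕ z) % ℓ + (y * toℕ z) / ℓ * ℓ              ≡⟨ cong (_+ (y * toℕ z) / ℓ * ℓ) (trans (sym (toℕ-τ z)) (cong toℕ e)) ⟩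
      toℕ z + (y * toℕ z) / ℓ * ℓ                        ∎))))
    where open ≡-Reasoning

4∤prime : ∀ {ℓ} → Prime ℓ → ¬ 4 ∣ ℓ
4∤prime pr 4∣ℓ with prime⇒irreducible pr 4∣ℓ
... | inj₁ ()
... | inj₂ refl with prime⇒irreducible pr (divides {2} {4} 2 refl)
...   | inj₁ ()
...   | inj₂ ()

-- With k = n / ℓ the prime `ℓ` divides (q ^ k) ^ ℓ - 1, hence q ^ k - 1 by `prime∣^∸1`. As `ℓ` is
-- its own only prime divisor and no prime is a multiple of 4, (q ^ k, ℓ) would be a Dickson pair.
noDickson⇒coprime : ∀ q n → IsPrimePower q → 1 ≤ n →
  (∀ k m → k * m ≡ n → k < n → ¬ DicksonPair (q ^ k) m) →
  ∀ ℓ → Prime ℓ → ℓ ∣ n → ¬ (ℓ ∣ q ^ n ∸ 1)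
noDickson⇒coprime q n (p , h , pr-p , refl) 1≤n noDickson ℓ pr (divides k refl) ℓ∣ =
  noDickson k ℓ refl k<n (prime⇒pos pr , primePower , onlyPrime , λ _ → 4∤prime pr)
  where
  0<k : 0 < k
  0<k = n≢0⇒n>0 λ { refl → 1+n≰n (≤-trans 1≤n ≤-refl) }
  k<n : k < k * ℓ
  k<n = m<m*n k ℓ {{>-nonZero 0<k}} (prime⇒>1 pr)
  primePower : IsPrimePower ((p ^ suc h) ^ k)
  primePower = p , pred (suc h * k) , pr-p ,
    trans (^-*-assoc p (suc h) k) (cong (p ^_) (sym (suc-pred (suc h * k) {{m*n≢0 (suc h) k {{_}} {{>-nonZero 0<k}}}})))
  q^k>0 : 1 ≤ (p ^ suc h) ^ k
  q^k>0 = m^n>0 (p ^ suc h) {{m^n≢0 p (suc h) {{prime⇒nonZero pr-p}}}} k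
  onlyPrime : ∀ ℓ′ → Prime ℓ′ → ℓ′ ∣ ℓ → ℓ′ ∣ (p ^ suc h) ^ k ∸ 1
  onlyPrime ℓ′ pr′ ℓ′∣ℓ with prime⇒irreducible pr ℓ′∣ℓ
  ... | inj₁ refl = contradiction (prime⇒>1 pr′) 1+n≰n
  ... | inj₂ refl = prime∣^∸1 pr q^k>0 (subst (λ x → ℓ ∣ x ∸ 1) (sym (^-*-assoc (p ^ suc h) k ℓ)) ℓ∣)

-- Finite groups

least : {P : ℕ → Set} → Decidable P → ∀ {k} → P k → ∃ λ d → P d × (∀ j → j < d → ¬ P j)
least {P} P? {k} = <-rec (λ k → P k → ∃ λ d → P d × (∀ j → j < d → ¬ P j)) go k
  where
  go : ∀ k → (∀ {j} → j < k → P j → ∃ λ d → P d × (∀ i → i < d → ¬ P i)) → P k → ∃ λ d → P d × (∀ j → j < d → ¬ P j)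
  go k rec p with anyUpTo? P? k
  ... | yes (j , j<k , pj) = rec j<k pj
  ... | no none = k , p , λ j j<k pj → none (j , j<k , pj)

module FiniteSum {X : Set} {N : ℕ} (I : Fin N ↔ X) where
  open Inverse I

  sumₓ : (X → ℕ) → ℕ
  sumₓ f = sum (f ∘ to)

  sumₓ-cong : {f g : X → ℕ} → (∀ x → f x ≡ g x) → sumₓ f ≡ sumₓ g
  sumₓ-cong e = sum-cong-≗ (λ i → e (to i))

  sumₓ-zero : {f : X → ℕ} → (∀ x → f x ≡ 0) → sumₓ f ≡ 0
  sumₓ-zero e = sum-zero _ (λ i → e (to i))

  sumₓ-mono : {f g : X → ℕ} → (∀ x → f x ≤ g x) → sumₓ f ≤ sumₓ g
  sumₓ-mono le = sum-mono (λ i → le (to i))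

  sumₓ-reindex : (f : X → ℕ) (β γ : X → X) → (∀ x → β (γ x) ≡ x) → (∀ x → γ (β x) ≡ x) →
    sumₓ (f ∘ β) ≡ sumₓ f
  sumₓ-reindex f β γ βγ γβ = sym (trans (Sum.∑-permute +-0-commutativeMonoid (f ∘ to) π)
    (sum-cong-≗ (λ i → cong f (strictlyInverseˡ (β (to i))))))
    where
    conjugate : (X → X) → Fin N → Fin N
    conjugate φ = from ∘ φ ∘ to
    cancel : ∀ φ ψ → (∀ x → φ (ψ x) ≡ x) → ∀ i → conjugate φ (conjugate ψ i) ≡ i
    cancel φ ψ φψ i = trans (cong (from ∘ φ) (strictlyInverseˡ _))
      (trans (cong from (φψ (to i))) (strictlyInverseʳ i))
    π : Fin N ↔ Fin N
    π = mk↔ₛ′ (conjugate β) (conjugate γ) (cancel β γ βγ) (cancel γ β γβ)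

  #_ : {P : X → Set} → Decidable P → ℕ
  # P? = sumₓ (λ x → 𝟙 (P? x))

  #-mono : {P Q : X → Set} (P? : Decidable P) (Q? : Decidable Q) → (∀ {x} → P x → Q x) → # P? ≤ # Q?
  #-mono P? Q? f = sum-mono (λ i → 𝟙-mono (P? (to i)) (Q? (to i)) f)

  #-⊎ : {P Q R : X → Set} (P? : Decidable P) (Q? : Decidable Q) (R? : Decidable R) →
    (∀ {x} → R x → P x ⊎ Q x) → # R? ≤ # P? + # Q?
  #-⊎ P? Q? R? f = subst (# R? ≤_) (∑-distrib-+ (λ i → 𝟙 (P? (to i))) _)
    (sum-mono (λ i → pointwise (to i) (R? (to i))))
    where
    pointwise : ∀ x (r : Dec _) → 𝟙 r ≤ 𝟙 (P? x) + 𝟙 (Q? x)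
    pointwise x (no _) = z≤n
    pointwise x (yes r) with f r
    ... | inj₁ p rewrite 𝟙-yes (P? x) p = s≤s z≤n
    ... | inj₂ q rewrite 𝟙-yes (Q? x) q = m≤n+m 1 _

  #-disjoint : {P Q R : X → Set} (P? : Decidable P) (Q? : Decidable Q) (R? : Decidable R) →
    (∀ {x} → P x → R x) → (∀ {x} → Q x → R x) → (∀ {x} → P x → ¬ Q x) → # P? + # Q? ≤ # R?
  #-disjoint P? Q? R? f g d = subst (_≤ # R?) (∑-distrib-+ (λ i → 𝟙 (P? (to i))) _)
    (sum-mono (λ i → pointwise (to i) (P? (to i)) (Q? (to i))))
    where
    pointwise : ∀ x (p : Dec _) (q : Dec _) → 𝟙 p + 𝟙 q ≤ 𝟙 (R? x)
    pointwise x (yes p) (yes q) = contradiction q (d p)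
    pointwise x (yes p) (no _) rewrite 𝟙-yes (R? x) (f p) = ≤-refl
    pointwise x (no _) (yes q) rewrite 𝟙-yes (R? x) (g q) = ≤-refl
    pointwise x (no _) (no _) = z≤n

  #-pos : {P : X → Set} (P? : Decidable P) {x : X} → P x → 0 < # P?
  #-pos P? {x} p = subst (_≤ # P?)
    (trans (sum-single (λ i → 𝟙 (finite-≟ I x (to i))) (from x)
      (λ j ne → 𝟙-no (finite-≟ I x (to j)) (λ e → ne (trans (sym (strictlyInverseʳ j)) (cong from (sym e))))))
      (𝟙-yes (finite-≟ I x (to (from x))) (sym (strictlyInverseˡ x))))
    (#-mono (finite-≟ I x) P? λ { refl → p })

  #-strict : {P Q : X → Set} (P? : Decidable P) (Q? : Decidable Q) → (∀ {x} → P x → Q x) →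
    ∀ {x} → Q x → ¬ P x → # P? < # Q?
  #-strict P? Q? f {x} q ¬p = <-≤-trans (m<m+n (# P?) (#-pos (finite-≟ I x) refl))
    (#-disjoint P? (finite-≟ I x) Q? f (λ { refl → q }) (λ { p refl → ¬p p }))

module FiniteGroup {G : Set} {_∙_ : G → G → G} {ε : G} {_⁻¹ : G → G}
  (isGroup : IsGroup _≡_ _∙_ ε _⁻¹) {N : ℕ} (I : Fin N ↔ G) where

  open IsGroup isGroup using (assoc; identityˡ; identityʳ; inverseˡ; inverseʳ)
  group : Group _ _
  group = record { isGroup = isGroup }

  open GroupProperties group using (∙-cancelʳ; ⁻¹-anti-homo-∙)
  open FiniteSum I

  Commute : G → G → Set
  Commute x y = x ∙ y ≡ y ∙ x

  conj : G → G → G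
  conj g x = (g ∙ x) ∙ (g ⁻¹)

  cancel-mid : ∀ x y z → (x ∙ (y ⁻¹)) ∙ (y ∙ z) ≡ x ∙ z
  cancel-mid x y z = begin
    (x ∙ (y ⁻¹)) ∙ (y ∙ z)  ≡⟨ assoc x (y ⁻¹) (y ∙ z) ⟩
    x ∙ ((y ⁻¹) ∙ (y ∙ z))  ≡⟨ cong (x ∙_) (assoc (y ⁻¹) y z) ⟨
    x ∙ (((y ⁻¹) ∙ y) ∙ z)  ≡⟨ cong (λ w → x ∙ (w ∙ z)) (inverseˡ y) ⟩
    x ∙ (ε ∙ z)             ≡⟨ cong (x ∙_) (identityˡ z) ⟩
    x ∙ z                   ∎
    where open ≡-Reasoning

  conj-∙ : ∀ g x y → conj g (x ∙ y) ≡ conj g x ∙ conj g y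
  conj-∙ g x y = sym (begin
    ((g ∙ x) ∙ (g ⁻¹)) ∙ ((g ∙ y) ∙ (g ⁻¹))  ≡⟨ assoc _ (g ∙ y) (g ⁻¹) ⟨
    (((g ∙ x) ∙ (g ⁻¹)) ∙ (g ∙ y)) ∙ (g ⁻¹)  ≡⟨ cong (_∙ (g ⁻¹)) (cancel-mid (g ∙ x) g y) ⟩
    ((g ∙ x) ∙ y) ∙ (g ⁻¹)                   ≡⟨ cong (_∙ (g ⁻¹)) (assoc g x y) ⟩
    (g ∙ (x ∙ y)) ∙ (g ⁻¹)                   ∎)
    where open ≡-Reasoning

  conj-conj : ∀ g h x → conj g (conj h x) ≡ conj (g ∙ h) x
  conj-conj g h x = begin
    (g ∙ ((h ∙ x) ∙ (h ⁻¹))) ∙ (g ⁻¹)    ≡⟨ cong (_∙ (g ⁻¹)) (assoc g (h ∙ x) (h ⁻¹)) ⟨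
    ((g ∙ (h ∙ x)) ∙ (h ⁻¹)) ∙ (g ⁻¹)    ≡⟨ assoc _ (h ⁻¹) (g ⁻¹) ⟩
    (g ∙ (h ∙ x)) ∙ ((h ⁻¹) ∙ (g ⁻¹))    ≡⟨ cong₂ _∙_ (assoc g h x) (⁻¹-anti-homo-∙ g h) ⟨
    ((g ∙ h) ∙ x) ∙ ((g ∙ h) ⁻¹)         ∎
    where open ≡-Reasoning

  conj-ε : ∀ x → conj ε x ≡ x
  conj-ε x = begin
    (ε ∙ x) ∙ (ε ⁻¹)  ≡⟨ cong (_∙ (ε ⁻¹)) (trans (identityˡ x) (sym (identityʳ x))) ⟩
    (x ∙ ε) ∙ (ε ⁻¹)  ≡⟨ assoc x ε (ε ⁻¹) ⟩
    x ∙ (ε ∙ (ε ⁻¹))  ≡⟨ cong (x ∙_) (inverseʳ ε) ⟩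
    x ∙ ε             ≡⟨ identityʳ x ⟩
    x                 ∎
    where open ≡-Reasoning

  conj-inverseˡ : ∀ g x → conj (g ⁻¹) (conj g x) ≡ x
  conj-inverseˡ g x = trans (conj-conj (g ⁻¹) g x) (trans (cong (λ h → conj h x) (inverseˡ g)) (conj-ε x))

  conj-inverseʳ : ∀ g x → conj g (conj (g ⁻¹) x) ≡ x
  conj-inverseʳ g x = trans (conj-conj g (g ⁻¹) x) (trans (cong (λ h → conj h x) (inverseʳ g)) (conj-ε x))

  Commute-conj : ∀ g {x y} → Commute x y → Commute (conj g x) (conj g y)
  Commute-conj g {x} {y} c = trans (sym (conj-∙ g x y)) (trans (cong (conj g) c) (conj-∙ g y x))

  Commute⇒conj-fixed : ∀ {g x} → Commute g x → conj g x ≡ x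
  Commute⇒conj-fixed {g} {x} c = begin
    (g ∙ x) ∙ (g ⁻¹)  ≡⟨ cong (_∙ (g ⁻¹)) c ⟩
    (x ∙ g) ∙ (g ⁻¹)  ≡⟨ assoc x g (g ⁻¹) ⟩
    x ∙ (g ∙ (g ⁻¹))  ≡⟨ cong (x ∙_) (inverseʳ g) ⟩
    x ∙ ε             ≡⟨ identityʳ x ⟩
    x                 ∎
    where open ≡-Reasoning

  conj-fixed⇒Commute : ∀ {g x} → conj g x ≡ x → Commute g x
  conj-fixed⇒Commute {g} {x} e = begin
    g ∙ x                    ≡⟨ identityʳ (g ∙ x) ⟨
    (g ∙ x) ∙ ε              ≡⟨ cong ((g ∙ x) ∙_) (inverseˡ g) ⟨
    (g ∙ x) ∙ ((g ⁻¹) ∙ g)   ≡⟨ assoc (g ∙ x) (g ⁻¹) g ⟨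
    conj g x ∙ g             ≡⟨ cong (_∙ g) e ⟩
    x ∙ g                    ∎
    where open ≡-Reasoning

  Commute-∙ : ∀ {x y z} → Commute x y → Commute x z → Commute x (y ∙ z)
  Commute-∙ {x} {y} {z} cy cz = begin
    x ∙ (y ∙ z)  ≡⟨ assoc x y z ⟨
    (x ∙ y) ∙ z  ≡⟨ cong (_∙ z) cy ⟩
    (y ∙ x) ∙ z  ≡⟨ assoc y x z ⟩
    y ∙ (x ∙ z)  ≡⟨ cong (y ∙_) cz ⟩
    y ∙ (z ∙ x)  ≡⟨ assoc y z x ⟨
    (y ∙ z) ∙ x  ∎
    where open ≡-Reasoning

  Commute-⁻¹ : ∀ {x y} → Commute x y → Commute x (y ⁻¹)
  Commute-⁻¹ {x} {y} c = sym (conj-fixed⇒Commute (trans (cong (conj (y ⁻¹)) (sym (Commute⇒conj-fixed (sym c))))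
    (conj-inverseˡ y x)))

  commute? : ∀ x → Decidable (Commute x)
  commute? x y = finite-≟ I (x ∙ y) (y ∙ x)

  record Subgroup (P : G → Set) : Set where
    field
      mem?    : Decidable P
      ε-mem   : P ε
      ∙-mem   : ∀ {x y} → P x → P y → P (x ∙ y)
      ⁻¹-mem  : ∀ {x} → P x → P (x ⁻¹)

    conj-mem : ∀ {g x} → P g → P x → P (conj g x)
    conj-mem g x = ∙-mem (∙-mem g x) (⁻¹-mem g)

    conj-mem⁻ : ∀ {g x} → P g → P (conj g x) → P x
    conj-mem⁻ {g} {x} g∈ gx∈ = subst P (conj-inverseˡ g x) (conj-mem (⁻¹-mem g∈) gx∈)

  open Subgroup

  whole : Subgroup (λ _ → ⊤)
  whole = record { mem? = λ _ → yes tt ; ε-mem = tt ; ∙-mem = λ _ _ → tt ; ⁻¹-mem = λ _ → tt }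

  centralizer : ∀ {P} → Subgroup P → ∀ x → Subgroup (λ y → P y × Commute x y)
  centralizer H x = record
    { mem?   = λ y → mem? H y ×-dec commute? x y
    ; ε-mem  = ε-mem H , trans (identityʳ x) (sym (identityˡ x))
    ; ∙-mem  = λ (p , c) (p′ , c′) → ∙-mem H p p′ , Commute-∙ c c′
    ; ⁻¹-mem = λ (p , c) → ⁻¹-mem H p , Commute-⁻¹ c
    }

  Abelian : (G → Set) → Set
  Abelian P = ∀ {x y} → P x → P y → Commute x y

  -- The counting argument for a group all of whose proper subgroups are abelian: its noncentral elements are
  -- partitioned by centralizers, which here are self-normalizing, so the conjugates of one centralizer already
  -- cover at least half of the group, and those of two centralizers are disjoint.
  module MinimalNonabelian
    (rigid : ∀ a b → Commute a (conj b a) → Commute b a)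
    {P : G → Set} (H : Subgroup P)
    (proper-abelian : ∀ {Q} (K : Subgroup Q) → # (mem? K) < # (mem? H) → Abelian Q) where

    Central : G → Set
    Central y = P y × (∀ p → P p → Commute y p)

    central? : Decidable Central
    central? y = mem? H y ×-dec finite-all? I (λ p → mem? H p →-dec commute? y p)

    Noncentral : G → Set
    Noncentral y = P y × ¬ Central y

    central-conj : ∀ {g y} → P g → Central y → Central (conj g y)
    central-conj {g} {y} g∈ (y∈ , c) = subst Central (sym (Commute⇒conj-fixed (sym (c g g∈)))) (y∈ , c)

    central-conj⁻ : ∀ {g y} → P g → Central (conj g y) → Central y
    central-conj⁻ {g} {y} g∈ z = subst Central (conj-inverseˡ g y) (central-conj (⁻¹-mem H g∈) z)

    C : G → G → Set
    C x y = P y × Commute x y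

    C? : ∀ x → Decidable (C x)
    C? x = mem? (centralizer H x)

    C-proper : ∀ {x} → Noncentral x → # (C? x) < # (mem? H)
    C-proper {x} (x∈ , nz) with finite-any? I (λ p → mem? H p ×-dec ¬? (commute? x p))
    ... | yes (p , p∈ , ¬c) = #-strict (C? x) (mem? H) proj₁ p∈ (¬c ∘ proj₂)
    ... | no none = contradiction (x∈ , λ p p∈ → decidable-stable (commute? x p) (λ ¬c → none (p , p∈ , ¬c))) nz

    C-abelian : ∀ {x} → Noncentral x → Abelian (C x)
    C-abelian {x} nx = proper-abelian (centralizer H x) (C-proper nx)

    C∖Z : G → G → Set
    C∖Z x y = C x y × ¬ Central y

    C∖Z? : ∀ x → Decidable (C∖Z x)
    C∖Z? x y = C? x y ×-dec ¬? (central? y)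

    Conjugates : G → G → Set
    Conjugates x y = P y × ∃ λ g → P g × C∖Z x (conj g y)

    conjugates? : ∀ x → Decidable (Conjugates x)
    conjugates? x y = mem? H y ×-dec finite-any? I (λ g → mem? H g ×-dec C∖Z? x (conj g y))

    z p : ℕ
    z = # central?
    p = # (mem? H)

    module _ {x : G} (nx : Noncentral x) where

      -- The incidence relation of a double count: `row` fixes the conjugating element `g`, `column`
      -- the conjugated element `y`.
      R : G → G → Set
      R g y = P g × P y × C∖Z x (conj g y)

      R? : ∀ g y → Dec (R g y)
      R? g y = mem? H g ×-dec (mem? H y ×-dec C∖Z? x (conj g y))

      row : ∀ g → sumₓ (λ y → 𝟙 (R? g y)) ≡ # (C∖Z? x) * 𝟙 (mem? H g)
      row g = go (mem? H g)
        where
        go : (d : Dec (P g)) → sumₓ (λ y → 𝟙 (R? g y)) ≡ # (C∖Z? x) * 𝟙 d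
        go (yes g∈) = begin
          sumₓ (λ y → 𝟙 (R? g y))              ≡⟨ sumₓ-cong (λ y → 𝟙-cong (R? g y) (C∖Z? x (conj g y))
                                                   (proj₂ ∘ proj₂) (λ r → g∈ , conj-mem⁻ H g∈ (proj₁ (proj₁ r)) , r)) ⟩
          sumₓ (λ y → 𝟙 (C∖Z? x (conj g y)))   ≡⟨ sumₓ-reindex (λ y → 𝟙 (C∖Z? x y)) (conj g) (conj (g ⁻¹))
                                                   (conj-inverseʳ g) (conj-inverseˡ g) ⟩
          # (C∖Z? x)                           ≡⟨ *-identityʳ _ ⟨
          # (C∖Z? x) * 1                       ∎
          where open ≡-Reasoning
        go (no g∉) = trans (sumₓ-zero (λ y → 𝟙-no (R? g y) (g∉ ∘ proj₁))) (sym (*-zeroʳ (# (C∖Z? x))))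

      -- Once `h` takes `y` to a noncentral `m` in `C x`, the elements taking `y` there form the
      -- coset of `C x` through `h`. For if `k` takes `m` into `C x`, then `m` commutes with its
      -- conjugate by `k`, so `rigid` makes `k` commute with `m`; and `C m` is abelian and contains
      -- `x`, so `k` commutes with `x`.
      column : ∀ y → sumₓ (λ g → 𝟙 (R? g y)) ≡ # (C? x) * 𝟙 (conjugates? x y)
      column y = go (conjugates? x y)
        where
        go : (d : Dec (Conjugates x y)) → sumₓ (λ g → 𝟙 (R? g y)) ≡ # (C? x) * 𝟙 d
        go (no none) = trans (sumₓ-zero (λ g → 𝟙-no (R? g y) (λ (g∈ , y∈ , r) → none (y∈ , _ , g∈ , r))))
                         (sym (*-zeroʳ (# (C? x))))
        go (yes (y∈ , h , h∈ , Cm , nm)) = begin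
          sumₓ (λ g → 𝟙 (R? g y))            ≡⟨ sumₓ-cong (λ g → 𝟙-cong (R? g y) (C? x (g ∙ (h ⁻¹))) (forth g) (back g)) ⟩
          sumₓ (λ g → 𝟙 (C? x (g ∙ (h ⁻¹)))) ≡⟨ sumₓ-reindex (λ g → 𝟙 (C? x g)) (_∙ (h ⁻¹)) (_∙ h)
                                                  (λ g → trans (assoc g h (h ⁻¹)) (trans (cong (g ∙_) (inverseʳ h)) (identityʳ g)))
                                                  cancel-h ⟩
          # (C? x)                           ≡⟨ *-identityʳ _ ⟨
          # (C? x) * 1                       ∎
          where
          open ≡-Reasoning
          m : G
          m = conj h y
          cancel-h : ∀ g → (g ∙ (h ⁻¹)) ∙ h ≡ g
          cancel-h g = trans (assoc g (h ⁻¹) h) (trans (cong (g ∙_) (inverseˡ h)) (identityʳ g))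
          conj-m : ∀ g → conj (g ∙ (h ⁻¹)) m ≡ conj g y
          conj-m g = trans (conj-conj (g ∙ (h ⁻¹)) h y) (cong (λ k → conj k y) (cancel-h g))
          forth : ∀ g → R g y → C x (g ∙ (h ⁻¹))
          forth g (g∈ , _ , Cg , _) = k∈ , C-abelian (proj₁ Cm , nm) (proj₁ nx , sym (proj₂ Cm)) (k∈ , sym k-m)
            where
            k∈ : P (g ∙ (h ⁻¹))
            k∈ = ∙-mem H g∈ (⁻¹-mem H h∈)
            k-m : Commute (g ∙ (h ⁻¹)) m
            k-m = rigid m (g ∙ (h ⁻¹)) (C-abelian nx Cm (subst (C x) (sym (conj-m g)) Cg))
          back : ∀ g → C x (g ∙ (h ⁻¹)) → R g y
          back g Ck = subst P (cancel-h g) (∙-mem H (proj₁ Ck) h∈) , y∈ ,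
            subst (C∖Z x) (trans (sym (Commute⇒conj-fixed (C-abelian nx Ck Cm))) (conj-m g)) (Cm , nm)

      class-equation : p * # (C∖Z? x) ≡ # (C? x) * # (conjugates? x)
      class-equation = begin
        p * # (C∖Z? x)                                  ≡⟨ *-comm p _ ⟩
        # (C∖Z? x) * p                                  ≡⟨ sum-*ˡ (# (C∖Z? x)) (λ i → 𝟙 (mem? H (Inverse.to I i))) ⟨
        sumₓ (λ g → # (C∖Z? x) * 𝟙 (mem? H g))          ≡⟨ sumₓ-cong row ⟨
        sumₓ (λ g → sumₓ (λ y → 𝟙 (R? g y)))            ≡⟨ ∑-comm (λ i j → 𝟙 (R? (Inverse.to I i) (Inverse.to I j))) ⟩
        sumₓ (λ y → sumₓ (λ g → 𝟙 (R? g y)))            ≡⟨ sumₓ-cong column ⟩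
        sumₓ (λ y → # (C? x) * 𝟙 (conjugates? x y))     ≡⟨ sum-*ˡ (# (C? x)) (λ i → 𝟙 (conjugates? x (Inverse.to I i))) ⟩
        # (C? x) * # (conjugates? x)                    ∎
        where open ≡-Reasoning

      central⇒C : ∀ {y} → Central y → C x y
      central⇒C (y∈ , cy) = y∈ , sym (cy x (proj₁ nx))

      C≤ : # (C? x) ≤ # (C∖Z? x) + z
      C≤ = #-⊎ (C∖Z? x) central? (C? x) split
        where
        split : ∀ {y} → C x y → C∖Z x y ⊎ Central y
        split {y} Cy with central? y
        ... | yes cy = inj₂ cy
        ... | no ny = inj₁ (Cy , ny)

      ≤C : # (C∖Z? x) + z ≤ # (C? x)
      ≤C = #-disjoint (C∖Z? x) central? (C? x) proj₁ central⇒C proj₂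

      -- Multiplying by the noncentral `x` moves the centre into the noncentral part of `C x`.
      z≤C∖Z : z ≤ # (C∖Z? x)
      z≤C∖Z = ≤-trans (sumₓ-mono (λ y → 𝟙-mono (central? y) (C∖Z? x (x ∙ y)) translate))
        (≤-reflexive (sumₓ-reindex (λ y → 𝟙 (C∖Z? x y)) (x ∙_) ((x ⁻¹) ∙_)
          (λ y → trans (sym (assoc x (x ⁻¹) y)) (trans (cong (_∙ y) (inverseʳ x)) (identityˡ y)))
          (λ y → trans (sym (assoc (x ⁻¹) x y)) (trans (cong (_∙ y) (inverseˡ x)) (identityˡ y)))))
        where
        translate : ∀ {y} → Central y → C∖Z x (x ∙ y)
        translate {y} (y∈ , cy) = (∙-mem H (proj₁ nx) y∈ , Commute-∙ refl (sym (cy x (proj₁ nx)))) ,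
          λ (_ , cxy) → proj₂ nx (proj₁ nx , λ q q∈ → sym (subst (Commute q) (trans (assoc x y (y ⁻¹))
            (trans (cong (x ∙_) (inverseʳ y)) (identityʳ x)))
            (Commute-∙ (sym (cxy q q∈)) (Commute-⁻¹ (sym (cy q q∈))))))

      C-pos : 0 < # (C? x)
      C-pos = #-pos (C? x) (proj₁ nx , refl)

      -- The centre fills at most half of `C x`, so `# (C? x)` is at most twice `# (C∖Z? x)`; the
      -- class equation carries this ratio over to `p` and the conjugates.
      half : p ≤ # (conjugates? x) + # (conjugates? x)
      half = *-cancelˡ-≤ (# (C? x)) {{>-nonZero C-pos}} (begin
        # (C? x) * p                                        ≤⟨ *-monoˡ-≤ p (≤-trans C≤ (+-monoʳ-≤ _ z≤C∖Z)) ⟩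
        (# (C∖Z? x) + # (C∖Z? x)) * p                       ≡⟨ *-distribʳ-+ p (# (C∖Z? x)) _ ⟩
        # (C∖Z? x) * p + # (C∖Z? x) * p                     ≡⟨ cong₂ _+_ eq eq ⟩
        # (C? x) * # (conjugates? x) + # (C? x) * # (conjugates? x)  ≡⟨ *-distribˡ-+ (# (C? x)) _ _ ⟨
        # (C? x) * (# (conjugates? x) + # (conjugates? x))  ∎)
        where
        open ≤-Reasoning 
        eq : # (C∖Z? x) * p ≡ # (C? x) * # (conjugates? x)
        eq = trans (*-comm (# (C∖Z? x)) p) class-equation

      z-pos : 0 < z
      z-pos = #-pos central? {ε} (ε-mem H , λ q _ → trans (identityˡ q) (sym (identityʳ q)))

      -- A version of the fact that the conjugates of a proper subgroup do not cover a finite group.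
      -- The strict inequality comes from `# (C? x) < p`, multiplied by the size of the nonempty
      -- centre.
      not-covered : # (conjugates? x) + z < p
      not-covered = *-cancelˡ-< (# (C? x)) _ _ (begin-strict
        # (C? x) * (# (conjugates? x) + z)              ≡⟨ *-distribˡ-+ (# (C? x)) _ z ⟩
        # (C? x) * # (conjugates? x) + # (C? x) * z     ≡⟨ cong (_+ # (C? x) * z) class-equation ⟨
        p * # (C∖Z? x) + # (C? x) * z                   <⟨ +-monoʳ-< _ (*-monoˡ-< z {{>-nonZero z-pos}} (C-proper nx)) ⟩
        p * # (C∖Z? x) + p * z                          ≡⟨ *-distribˡ-+ p _ z ⟨
        p * (# (C∖Z? x) + z)                            ≤⟨ *-monoʳ-≤ p ≤C ⟩
        p * # (C? x)                                    ≡⟨ *-comm p _ ⟩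
        # (C? x) * p                                    ∎)
        where open ≤-Reasoning 

      second : ∃ λ y → Noncentral y × ¬ Conjugates x y
      second with finite-any? I (λ y → (mem? H y ×-dec ¬? (central? y)) ×-dec ¬? (conjugates? x y))
      ... | yes r = r
      ... | no none = contradiction not-covered (≤⇒≯ (#-⊎ (conjugates? x) central? (mem? H) covered))
        where
        covered : ∀ {y} → P y → Conjugates x y ⊎ Central y
        covered {y} y∈ with conjugates? x y | central? y
        ... | yes r | _ = inj₁ r
        ... | no _ | yes c = inj₂ c
        ... | no nr | no nc = contradiction (y , (y∈ , nc) , nr) none

    -- Two disjoint families, each at least half of the group, leave no room for the centre, which
    -- contains at least `ε`.
    abelian : ∀ {x} → ¬ Noncentral x
    abelian {x} nx = <⇒≱ (begin-strict
      p + p                                   ≤⟨ +-mono-≤ (half nx) (half ny) ⟩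
      (X + X) + (Y + Y)                       ≡⟨ interchange X X Y Y ⟩
      (X + Y) + (X + Y)                       <⟨ +-mono-<-≤ (m<m+n (X + Y) (z-pos nx)) (m≤m+n (X + Y) z) ⟩
      (X + Y + z) + (X + Y + z)               ∎)
      (+-mono-≤ total total)
      where
      open ≤-Reasoning 
      open import Algebra.Properties.CommutativeSemigroup +-commutativeSemigroup using (interchange)
      y = proj₁ (second nx)
      ny = proj₁ (proj₂ (second nx))
      X = # (conjugates? x)
      Y = # (conjugates? y)
      -- A common `w` would be taken by `g` into `C x` and by `h` into `C y`. Then g h⁻¹ takes `y`
      -- into the centralizer of `conj g w`, which is abelian and contains `x`; so `y` would have a
      -- conjugate in `C x`, contrary to its choice.
      disjoint : ∀ {w} → Conjugates x w → ¬ Conjugates y w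
      disjoint {w} (_ , g , g∈ , Cg , ng) (_ , h , h∈ , Ch , nh) = proj₂ (proj₂ (second nx))
        (proj₁ ny , k , k∈ , (conj-mem H k∈ (proj₁ ny) , C-abelian (proj₁ Cg , ng) (proj₁ nx , sym (proj₂ Cg))
          (conj-mem H k∈ (proj₁ ny) , sym (subst (Commute (conj k y)) kh (Commute-conj k (proj₂ Ch))))) ,
         proj₂ ny ∘ central-conj⁻ k∈)
        where
        k : G
        k = g ∙ (h ⁻¹)
        k∈ : P k
        k∈ = ∙-mem H g∈ (⁻¹-mem H h∈)
        kh : conj k (conj h w) ≡ conj g w
        kh = trans (conj-conj k h w) (cong (λ l → conj l w)
          (trans (assoc g (h ⁻¹) h) (trans (cong (g ∙_) (inverseˡ h)) (identityʳ g))))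
      XY? : ∀ w → Dec (Conjugates x w ⊎ Conjugates y w)
      XY? w = conjugates? x w ⊎-dec conjugates? y w
      conj-noncentral : ∀ {u w} → Conjugates u w → ¬ Central w
      conj-noncentral (_ , g , g∈ , _ , ng) = ng ∘ central-conj g∈
      total : X + Y + z ≤ p
      total = ≤-trans (+-monoˡ-≤ z (#-disjoint (conjugates? x) (conjugates? y) XY? inj₁ inj₂ disjoint))
        (#-disjoint XY? central? (mem? H) [ proj₁ , proj₁ ]′ proj₁ [ conj-noncentral , conj-noncentral ]′)

  -- Induction over all subgroups by cardinality: a noncommuting pair in a subgroup whose smaller
  -- companions are all abelian would supply the noncentral element that `MinimalNonabelian.abelian`
  -- excludes.
  rigid⇒commutative : (∀ a b → Commute a (conj b a) → Commute b a) → ∀ x y → Commute x y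
  rigid⇒commutative rigid x y = <-rec Goal go (# (mem? whole)) whole refl tt tt
    where
    Goal : ℕ → Set₁
    Goal s = ∀ {P} (H : Subgroup P) → # (mem? H) ≡ s → Abelian P
    go : ∀ s → (∀ {s′} → s′ < s → Goal s′) → Goal s
    go s rec {P} H refl {x} {y} x∈ y∈ with commute? x y
    ... | yes c = c
    ... | no ¬c = contradiction (x∈ , λ (_ , c) → ¬c (c y y∈))
      (MinimalNonabelian.abelian rigid H (λ K lt → rec lt K refl))

  -- Powers and orders of group elements

  pow : G → ℕ → G
  pow a k = iter (a ∙_) k ε

  pow-+ : ∀ a i j → pow a (i + j) ≡ pow a i ∙ pow a j
  pow-+ a zero j = sym (identityˡ _)
  pow-+ a (suc i) j = trans (cong (a ∙_) (pow-+ a i j)) (sym (assoc a _ _))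

  pow-* : ∀ a i j → pow a (i * j) ≡ pow (pow a j) i
  pow-* a zero j = refl
  pow-* a (suc i) j = trans (pow-+ a j (i * j)) (cong (pow a j ∙_) (pow-* a i j))

  pow-1 : ∀ a → pow a 1 ≡ a
  pow-1 a = identityʳ a

  pow-ε : ∀ k → pow ε k ≡ ε
  pow-ε zero = refl
  pow-ε (suc k) = trans (identityˡ _) (pow-ε k)

  Commute-pow : ∀ {x a} → Commute x a → ∀ k → Commute x (pow a k)
  Commute-pow {x} c zero = trans (identityʳ x) (sym (identityˡ x))
  Commute-pow c (suc k) = Commute-∙ c (Commute-pow c k)

  conj-pow : ∀ g a k → conj g (pow a k) ≡ pow (conj g a) k
  conj-pow g a zero = Commute⇒conj-fixed (trans (identityʳ g) (sym (identityˡ g)))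
  conj-pow g a (suc k) = trans (conj-∙ g a (pow a k)) (cong (conj g a ∙_) (conj-pow g a k))

  iter-conj : ∀ g k x → iter (conj g) k x ≡ conj (pow g k) x
  iter-conj g zero x = sym (conj-ε x)
  iter-conj g (suc k) x = trans (cong (conj g) (iter-conj g k x)) (conj-conj g (pow g k) x)

  pow-difference : ∀ {a i j} → i < j → pow a i ≡ pow a j → pow a (j ∸ i) ≡ ε
  pow-difference {a} {i} {j} i<j e = ∙-cancelʳ (pow a i) _ _
    (trans (sym (pow-+ a (j ∸ i) i)) (trans (cong (pow a) (m∸n+n≡m (<⇒≤ i<j))) (trans (sym e) (sym (identityˡ _)))))

  record Order (a : G) : Set where
    field
      order-1  : ℕ
    order : ℕ
    order = suc order-1
    field
      pow-order : pow a order ≡ ε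
      minimal   : ∀ j → 0 < j → j < order → pow a j ≢ ε

    -- Lagrange's theorem for the cyclic group of `a`: all orbits of left multiplication by `a` on
    -- the group have length `order`.
    order∣N : order ∣ N
    order∣N = subst (order ∣_) (trans (sum-const N 1) (*-identityʳ N)) (orbits-∣-sum (s≤s z≤n) τ (λ _ → 1) (λ _ → refl)
      (λ i _ → trans (iter-τ order i) (trans (cong (λ x → from (x ∙ to i)) pow-order)
          (trans (cong from (identityˡ _)) (strictlyInverseʳ i))) ,
        λ j 0<j j<d e → minimal j 0<j j<d (∙-cancelʳ (to i) _ _ (trans (from-injective I
          (trans (sym (iter-τ j i)) (trans e (sym (strictlyInverseʳ i))))) (sym (identityˡ _))))))
      where
      open Inverse I
      τ : Fin N → Fin N
      τ i = from (a ∙ to i)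
      iter-τ : ∀ k i → iter τ k i ≡ from (pow a k ∙ to i)
      iter-τ zero i = trans (sym (strictlyInverseʳ i)) (cong from (sym (identityˡ _)))
      iter-τ (suc k) i = trans (cong τ (iter-τ k i)) (cong from (trans (cong (a ∙_) (strictlyInverseˡ _)) (sym (assoc a _ _))))

    pow-multiple : ∀ k → pow a (k * order) ≡ ε
    pow-multiple k = trans (pow-* a k order) (trans (cong (λ x → pow x k) pow-order) (pow-ε k))

    pow-N : pow a N ≡ ε
    pow-N with order∣N
    ... | divides k eq = trans (cong (pow a) eq) (pow-multiple k)

    pow-% : ∀ k → pow a (k % order) ≡ pow a k
    pow-% k = sym (trans (cong (pow a) (m≡m%n+[m/n]*n k order)) (trans (pow-+ a (k % order) _)
      (trans (cong (pow a (k % order) ∙_) (pow-multiple (k / order))) (identityʳ _))))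

    pow-injective : ∀ {i j} → i < order → j < order → pow a i ≡ pow a j → i ≡ j
    pow-injective {i} {j} i<d j<d e with <-cmp i j
    ... | tri≈ _ i≡j _ = i≡j
    ... | tri< i<j _ _ = contradiction (pow-difference i<j e) (minimal (j ∸ i) (m<n⇒0<n∸m i<j) (≤-<-trans (m∸n≤m j i) j<d))
    ... | tri> _ _ j<i = contradiction (pow-difference j<i (sym e)) (minimal (i ∸ j) (m<n⇒0<n∸m j<i) (≤-<-trans (m∸n≤m i j) i<d))

  order-exists : ∀ a → Order a
  order-exists a = record { order-1 = pred d ; pow-order = subst (λ k → pow a k ≡ ε) (sym suc-d) d≡ε
    ; minimal = λ j 0<j j<d e → d-least j (subst (j <_) suc-d j<d) (0<j , e) }
    where
    P : ℕ → Set
    P k = 0 < k × pow a k ≡ ε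
    P? : Decidable P
    P? k = (0 <? k) ×-dec finite-≟ I (pow a k) ε
    some : ∃ P
    -- Exponents run from 0 to `N`, so these N + 1 powers cannot be distinct.
    some with Fin.pigeonhole (n<1+n N) (λ i → Inverse.from I (pow a (toℕ i)))
    ... | i , j , i<j , e = toℕ j ∸ toℕ i , m<n⇒0<n∸m i<j , pow-difference i<j (from-injective I e)
    least-P = least P? (proj₂ some)
    d = proj₁ least-P
    d≡ε = proj₂ (proj₁ (proj₂ least-P))
    d-least = proj₂ (proj₂ least-P)
    suc-d : suc (pred d) ≡ d
    suc-d = suc-pred d {{>-nonZero (proj₁ (proj₁ (proj₂ least-P)))}}

-- Vector spaces and cardinalities of their subspaces

-- The enumeration lists elements of `X` and not pairs in the sum type, since `P` may have several
-- proofs at the same element.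
record Card {X : Set} (P : X → Set) (s : ℕ) : Set where
  field
    elt        : Fin s → X
    elt-mem    : ∀ i → P (elt i)
    injective  : ∀ {i j} → elt i ≡ elt j → i ≡ j
    surjective : ∀ {x} → P x → ∃ λ i → elt i ≡ x

open Card

Card-≤ : {X Y : Set} {P : X → Set} {Q : Y → Set} {s t : ℕ} → Card P s → Card Q t → (f : X → Y) →
  (∀ {x} → P x → Q (f x)) → (∀ {x y} → P x → P y → f x ≡ f y → x ≡ y) → s ≤ t
Card-≤ {s = s} {t} A B f f∈ f-inj = Fin.injective⇒≤ {f = g} g-inj
  where
  g : Fin s → Fin t
  g i = proj₁ (surjective B (f∈ (elt-mem A i)))
  elt-g : ∀ i → elt B (g i) ≡ f (elt A i)
  elt-g i = proj₂ (surjective B (f∈ (elt-mem A i)))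
  g-inj : ∀ {i j} → g i ≡ g j → i ≡ j
  g-inj {i} {j} e = injective A (f-inj (elt-mem A i) (elt-mem A j)
    (trans (sym (elt-g i)) (trans (cong (elt B) e) (elt-g j))))

Card-unique : {X : Set} {P : X → Set} {s t : ℕ} → Card P s → Card P t → s ≡ t
Card-unique A B = ≤-antisym (Card-≤ A B (λ x → x) (λ p → p) (λ _ _ e → e))
                            (Card-≤ B A (λ x → x) (λ p → p) (λ _ _ e → e))

Card-singleton : {X : Set} {P : X → Set} (x : X) → P x → (∀ {y} → P y → y ≡ x) → Card P 1
Card-singleton x p unique = record
  { elt = λ _ → x ; elt-mem = λ _ → p
  ; injective = λ { {Fin.zero} {Fin.zero} _ → refl }
  ; surjective = λ q → Fin.zero , sym (unique q) }

Card-↔ : {X : Set} {s : ℕ} {P : X → Set} → Fin s ↔ X → (∀ x → P x) → Card P s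
Card-↔ I all = record
  { elt = Inverse.to I ; elt-mem = λ _ → all _ ; injective = to-injective I
  ; surjective = λ {x} _ → Inverse.from I x , Inverse.strictlyInverseˡ I x }

-- The map `f` is arbitrary because the count serves both a subspace fibred over its first
-- coordinates and an internal direct sum.
Card-× : {X Y Z : Set} {A : X → Set} {B : Y → Set} {C : Z → Set} {s t : ℕ} → Card A s → Card B t →
  (f : X → Y → Z) → (∀ {x y} → A x → B y → C (f x y)) →
  (∀ {x y x′ y′} → A x → B y → A x′ → B y′ → f x y ≡ f x′ y′ → x ≡ x′ × y ≡ y′) →
  (∀ {z} → C z → ∃ λ x → ∃ λ y → A x × B y × f x y ≡ z) → Card C (s * t)
Card-× {s = s} {t} α β f f∈ f-inj f-surj = record
  { elt = λ k → g (Fin.remQuot t k)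
  ; elt-mem = λ k → f∈ (elt-mem α _) (elt-mem β _)
  ; injective = λ {k} {k′} e → trans (sym (Fin.combine-remQuot {s} t k))
      (trans (cong (uncurry Fin.combine) (g-inj _ _ e)) (Fin.combine-remQuot {s} t k′))
  ; surjective = λ Cz → let x , y , Ax , By , e = f-surj Cz
                            i , ei = surjective α Ax
                            j , ej = surjective β By
                        in Fin.combine i j , trans (cong g (Fin.remQuot-combine i j)) (trans (cong₂ f ei ej) e)
  }
  where
  g : Fin s × Fin t → _
  g (i , j) = f (elt α i) (elt β j)
  g-inj : ∀ p p′ → g p ≡ g p′ → p ≡ p′
  g-inj (i , j) (i′ , j′) e =
    let ei , ej = f-inj (elt-mem α i) (elt-mem β j) (elt-mem α i′) (elt-mem β j′) e
    in cong₂ _,_ (injective α ei) (injective β ej)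

vec-finite : {X : Set} {N : ℕ} → Fin N ↔ X → ∀ k → Fin (N ^ k) ↔ Vec X k
vec-finite I zero = mk↔ₛ′ (λ _ → []) (λ _ → Fin.zero) (λ { [] → refl }) (λ { Fin.zero → refl ; (Fin.suc ()) })
vec-finite {X} {N} I (suc k) = mk↔ₛ′ (cons ∘ Fin.remQuot (N ^ k))
  (λ { (x ∷ xs) → Fin.combine (from I x) (from rest xs) })
  (λ { (x ∷ xs) → trans (cong cons (Fin.remQuot-combine (from I x) (from rest xs)))
                        (cong₂ _∷_ (strictlyInverseˡ I x) (strictlyInverseˡ rest xs)) })
  (λ i → trans (uncons (Fin.remQuot (N ^ k) i)) (Fin.combine-remQuot {N} (N ^ k) i))
  where
  open Inverse
  rest = vec-finite I k
  cons : Fin N × Fin (N ^ k) → Vec X (suc k)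
  cons (i , j) = to I i ∷ to rest j
  uncons : ∀ p → Fin.combine (from I (to I (proj₁ p))) (from rest (to rest (proj₂ p))) ≡ uncurry Fin.combine p
  uncons (i , j) = cong₂ Fin.combine (strictlyInverseʳ I i) (strictlyInverseʳ rest j)

module LinearAlgebra (F : Field) where
  open Field F public using () renaming
    (Carrier to 𝔽; _+_ to _+ᶠ_; _*_ to _*ᶠ_; -_ to -ᶠ_; 0# to 0ᶠ; 1# to 1ᶠ)
  module 𝔽 = IsCommutativeRing (Field.isCommutativeRing F)

  -- Equality of vectors is propositional equality. Concrete spaces are therefore built from `Vec`,
  -- and linear maps are stored as vectors of columns.
  record Space : Set₁ where
    infixl 6 _⊞_
    infixr 7 _•_
    field
      Vector         : Set
      _⊞_            : Vector → Vector → Vector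
      𝟎              : Vector
      ⊟_             : Vector → Vector
      _•_            : 𝔽 → Vector → Vector
      isAbelianGroup : IsAbelianGroup _≡_ _⊞_ 𝟎 ⊟_
      •-⊞            : ∀ a x y → a • (x ⊞ y) ≡ a • x ⊞ a • y
      +-•            : ∀ a b x → (a +ᶠ b) • x ≡ a • x ⊞ b • x
      *-•            : ∀ a b x → (a *ᶠ b) • x ≡ a • b • x
      1-•            : ∀ x → 1ᶠ • x ≡ x

    open IsAbelianGroup isAbelianGroup public
      using (assoc; comm; identityˡ; identityʳ; inverseˡ; inverseʳ; isGroup; isCommutativeMonoid)
    group : Group _ _
    group = record { isGroup = isGroup }

    open GroupProperties group public
      using (∙-cancelˡ; ∙-cancelʳ; identityˡ-unique; inverseˡ-unique)
    open SumLemmas isCommutativeMonoid public renaming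
      ( sum to ∑; sum-cong-≗ to ∑-cong; sum-zero to ∑-zero; sum-single to ∑-single; sum-last to ∑-last
      ; sum-replicate-zero to ∑-replicate-zero; sum-init-last to ∑-init-last
      ; ∑-distrib-+ to ∑-⊞; ∑-comm to ∑-swap )

    0-• : ∀ x → 0ᶠ • x ≡ 𝟎
    0-• x = identityˡ-unique (0ᶠ • x) (0ᶠ • x) (trans (sym (+-• 0ᶠ 0ᶠ x)) (cong (_• x) (𝔽.+-identityˡ 0ᶠ)))

    •-𝟎 : ∀ a → a • 𝟎 ≡ 𝟎
    •-𝟎 a = identityˡ-unique (a • 𝟎) (a • 𝟎) (trans (sym (•-⊞ a 𝟎 𝟎)) (cong (a •_) (identityˡ 𝟎)))

    -1-• : ∀ x → (-ᶠ 1ᶠ) • x ≡ ⊟ x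
    -1-• x = inverseˡ-unique ((-ᶠ 1ᶠ) • x) x (trans (cong ((-ᶠ 1ᶠ) • x ⊞_) (sym (1-• x)))
      (trans (sym (+-• (-ᶠ 1ᶠ) 1ᶠ x)) (trans (cong (_• x) (𝔽.-‿inverseˡ 1ᶠ)) (0-• x))))

    interchange : ∀ a b c d → (a ⊞ b) ⊞ (c ⊞ d) ≡ (a ⊞ c) ⊞ (b ⊞ d)
    interchange a b c d = trans (assoc a b (c ⊞ d)) (trans (cong (a ⊞_) (trans (sym (assoc b c d))
      (trans (cong (_⊞ d) (comm b c)) (assoc c b d)))) (sym (assoc a c (b ⊞ d))))

    sub-add : ∀ x y → (x ⊞ ⊟ y) ⊞ y ≡ x
    sub-add x y = trans (assoc x (⊟ y) y) (trans (cong (x ⊞_) (inverseˡ y)) (identityʳ x))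

    record IsSubspace (P : Vector → Set) : Set where
      field
        mem?  : Decidable P
        𝟎-mem : P 𝟎
        ⊞-mem : ∀ {x y} → P x → P y → P (x ⊞ y)
        •-mem : ∀ a {x} → P x → P (a • x)

      ⊟-mem : ∀ {x} → P x → P (⊟ x)
      ⊟-mem {x} p = subst P (-1-• x) (•-mem (-ᶠ 1ᶠ) p)

    -- Replaces dimension: only the exponent of the cardinality is ever needed.
    SubspacesHavePowerCard : ℕ → Set₁
    SubspacesHavePowerCard q = ∀ {P} → IsSubspace P → ∃ λ e → Card P (q ^ e)

  record IsLinear (X Y : Space) (f : Space.Vector X → Space.Vector Y) : Set where
    private
      module X = Space X
      module Y = Space Y
    field
      additive    : ∀ x y → f (x X.⊞ y) ≡ f x Y.⊞ f y
      homogeneous : ∀ a x → f (a X.• x) ≡ a Y.• f x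

    map-𝟎 : f X.𝟎 ≡ Y.𝟎
    map-𝟎 = Y.identityˡ-unique (f X.𝟎) (f X.𝟎) (trans (sym (additive X.𝟎 X.𝟎)) (cong f (X.identityˡ X.𝟎)))

    map-∑ : ∀ {k} (h : Fin k → X.Vector) → f (X.∑ h) ≡ Y.∑ (f ∘ h)
    map-∑ {zero} h = map-𝟎
    map-∑ {suc k} h = trans (additive _ _) (cong (f (h Fin.zero) Y.⊞_) (map-∑ (h ∘ Fin.suc)))

    map-⊟ : ∀ x → f (X.⊟ x) ≡ Y.⊟ f x
    map-⊟ x = trans (cong f (sym (X.-1-• x))) (trans (homogeneous _ x) (Y.-1-• (f x)))

    trivial-kernel⇒injective : (∀ x → f x ≡ Y.𝟎 → x ≡ X.𝟎) → ∀ {x y} → f x ≡ f y → x ≡ y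
    trivial-kernel⇒injective ker {x} {y} e = trans (sym (X.sub-add x y)) (trans (cong (X._⊞ y)
      (ker _ (trans (additive x (X.⊟ y)) (trans (cong₂ Y._⊞_ e (map-⊟ y)) (Y.inverseʳ (f y))))))
      (X.identityˡ y))

  open IsLinear

  ∘-linear : ∀ {X Y Z f g} → IsLinear Y Z g → IsLinear X Y f → IsLinear X Z (g ∘ f)
  ∘-linear {g = g} G H = record
    { additive = λ x y → trans (cong g (additive H x y)) (additive G _ _)
    ; homogeneous = λ a x → trans (cong g (homogeneous H a x)) (homogeneous G a _) }

  iter-linear : ∀ {X f} → IsLinear X X f → ∀ k → IsLinear X X (iter f k)
  iter-linear L zero = record { additive = λ _ _ → refl ; homogeneous = λ _ _ → refl }
  iter-linear L (suc k) = ∘-linear L (iter-linear L k)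

  scalars : Space
  scalars = record
    { Vector = 𝔽 ; _⊞_ = _+ᶠ_ ; 𝟎 = 0ᶠ ; ⊟_ = -ᶠ_ ; _•_ = _*ᶠ_
    ; isAbelianGroup = 𝔽.+-isAbelianGroup
    ; •-⊞ = 𝔽.distribˡ ; +-• = λ a b x → 𝔽.distribʳ x a b ; *-• = 𝔽.*-assoc ; 1-• = 𝔽.*-identityˡ }

  module _ (Y : Space) where
    open Space Y

    vec-space : ℕ → Space
    vec-space k = record
      { Vector = Vec Vector k ; _⊞_ = zipWith _⊞_ ; 𝟎 = replicate k 𝟎 ; ⊟_ = map ⊟_ ; _•_ = λ a → map (a •_)
      ; isAbelianGroup = record
        { isGroup = record
          { isMonoid = record
            { isSemigroup = record
              { isMagma = record { isEquivalence = isEquivalence ; ∙-cong = cong₂ _ }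
              ; assoc = Vec.zipWith-assoc assoc }
            ; identity = Vec.zipWith-identityˡ identityˡ , Vec.zipWith-identityʳ identityʳ }
          ; inverse = Vec.zipWith-inverseˡ inverseˡ , Vec.zipWith-inverseʳ inverseʳ
          ; ⁻¹-cong = cong _ }
        ; comm = Vec.zipWith-comm comm }
      ; •-⊞ = λ a → •-⊞ᵛ a ; +-• = λ a b → +-•ᵛ a b ; *-• = λ a b → *-•ᵛ a b
      ; 1-• = λ xs → trans (Vec.map-cong 1-• xs) (Vec.map-id xs) }
      where
      •-⊞ᵛ : ∀ a {k} (xs ys : Vec Vector k) → map (a •_) (zipWith _⊞_ xs ys) ≡ zipWith _⊞_ (map (a •_) xs) (map (a •_) ys)
      •-⊞ᵛ a [] [] = refl
      •-⊞ᵛ a (x ∷ xs) (y ∷ ys) = cong₂ _∷_ (•-⊞ a x y) (•-⊞ᵛ a xs ys)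
      +-•ᵛ : ∀ a b {k} (xs : Vec Vector k) → map ((a +ᶠ b) •_) xs ≡ zipWith _⊞_ (map (a •_) xs) (map (b •_) xs)
      +-•ᵛ a b [] = refl
      +-•ᵛ a b (x ∷ xs) = cong₂ _∷_ (+-• a b x) (+-•ᵛ a b xs)
      *-•ᵛ : ∀ a b {k} (xs : Vec Vector k) → map ((a *ᶠ b) •_) xs ≡ map (a •_) (map (b •_) xs)
      *-•ᵛ a b [] = refl
      *-•ᵛ a b (x ∷ xs) = cong₂ _∷_ (*-• a b x) (*-•ᵛ a b xs)

    map-linear : ∀ {f} → IsLinear Y Y f → ∀ {k} → IsLinear (vec-space k) (vec-space k) (map f)
    map-linear {f} L = record { additive = add ; homogeneous = λ a → hom a }
      where
      add : ∀ {k} (xs ys : Vec Vector k) → map f (zipWith _⊞_ xs ys) ≡ zipWith _⊞_ (map f xs) (map f ys)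
      add [] [] = refl
      add (x ∷ xs) (y ∷ ys) = cong₂ _∷_ (additive L x y) (add xs ys)
      hom : ∀ a {k} (xs : Vec Vector k) → map f (map (a •_) xs) ≡ map (a •_) (map f xs)
      hom a [] = refl
      hom a (x ∷ xs) = cong₂ _∷_ (homogeneous L a x) (hom a xs)

  module _ (Y : Space) where
    open Space Y

    -- The linear map with the given columns; `matrix` is the inverse passage. In this way
    -- `Vec Vector k` stands for the space of linear maps from the k-tuples of scalars.
    ⟦_⟧ : ∀ {k} → Vec Vector k → Vec 𝔽 k → Vector
    ⟦ [] ⟧ [] = 𝟎
    ⟦ x ∷ xs ⟧ (a ∷ as) = a • x ⊞ ⟦ xs ⟧ as

    ⟦⟧-linear : ∀ {k} (xs : Vec Vector k) → IsLinear (vec-space scalars k) Y ⟦ xs ⟧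
    ⟦⟧-linear xs = record { additive = add xs ; homogeneous = hom xs }
      where
      add : ∀ {k} (xs : Vec Vector k) v w → ⟦ xs ⟧ (zipWith _+ᶠ_ v w) ≡ ⟦ xs ⟧ v ⊞ ⟦ xs ⟧ w
      add [] [] [] = sym (identityˡ 𝟎)
      add (x ∷ xs) (a ∷ v) (b ∷ w) = trans (cong₂ _⊞_ (+-• a b x) (add xs v w)) (interchange _ _ _ _)
      hom : ∀ {k} (xs : Vec Vector k) a v → ⟦ xs ⟧ (map (a *ᶠ_) v) ≡ a • ⟦ xs ⟧ v
      hom [] a [] = sym (•-𝟎 a)
      hom (x ∷ xs) a (b ∷ v) = trans (cong₂ _⊞_ (*-• a b x) (hom xs a v)) (sym (•-⊞ a _ _))

    ⟦⟧-⊞ : ∀ {k} (xs ys : Vec Vector k) w → ⟦ zipWith _⊞_ xs ys ⟧ w ≡ ⟦ xs ⟧ w ⊞ ⟦ ys ⟧ w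
    ⟦⟧-⊞ [] [] [] = sym (identityˡ 𝟎)
    ⟦⟧-⊞ (x ∷ xs) (y ∷ ys) (a ∷ w) = trans (cong₂ _⊞_ (•-⊞ a x y) (⟦⟧-⊞ xs ys w)) (interchange _ _ _ _)

    ⟦𝟎⟧ : ∀ {k} (w : Vec 𝔽 k) → ⟦ replicate k 𝟎 ⟧ w ≡ 𝟎
    ⟦𝟎⟧ [] = refl
    ⟦𝟎⟧ (a ∷ w) = trans (cong₂ _⊞_ (•-𝟎 a) (⟦𝟎⟧ w)) (identityˡ 𝟎)

    ⟦⟧-map : ∀ {f} → IsLinear Y Y f → ∀ {k} (xs : Vec Vector k) w → ⟦ map f xs ⟧ w ≡ f (⟦ xs ⟧ w)
    ⟦⟧-map L [] [] = sym (map-𝟎 L)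
    ⟦⟧-map L (x ∷ xs) (a ∷ w) = trans (cong₂ _⊞_ (sym (homogeneous L a x)) (⟦⟧-map L xs w)) (sym (additive L _ _))

    scale-linear : ∀ a → IsLinear Y Y (a •_)
    scale-linear a = record { additive = •-⊞ a ; homogeneous = λ b x →
      trans (sym (*-• a b x)) (trans (cong (_• x) (𝔽.*-comm a b)) (*-• b a x)) }

    matrix : ∀ {k} → (Vec 𝔽 k → Vector) → Vec Vector k
    matrix {zero} f = []
    matrix {suc k} f = f (1ᶠ ∷ replicate k 0ᶠ) ∷ matrix (λ w → f (0ᶠ ∷ w))

    ⟦⟧-matrix : ∀ {k f} → IsLinear (vec-space scalars k) Y f → ∀ w → ⟦ matrix f ⟧ w ≡ f w
    ⟦⟧-matrix {zero} L [] = sym (map-𝟎 L)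
    ⟦⟧-matrix {suc k} {f} L (a ∷ w) = trans (cong₂ _⊞_ (sym (homogeneous L a _)) (⟦⟧-matrix tail-linear w))
      (trans (sym (additive L _ _)) (cong f (cong₂ _∷_
        (trans (𝔽.+-identityʳ _) (𝔽.*-identityʳ a))
        (trans (cong (λ z → zipWith _+ᶠ_ z w) (Space.•-𝟎 (vec-space scalars k) a)) (Space.identityˡ (vec-space scalars k) w)))))
      where
      tail-linear : IsLinear (vec-space scalars k) Y (λ w → f (0ᶠ ∷ w))
      tail-linear = record
        { additive = λ v w → trans (cong (λ z → f (z ∷ zipWith _+ᶠ_ v w)) (sym (𝔽.+-identityˡ 0ᶠ))) (additive L _ _)
        ; homogeneous = λ a w → trans (cong (λ z → f (z ∷ map (a *ᶠ_) w)) (sym (𝔽.zeroʳ a))) (homogeneous L a _) }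

    ⟦⟧-ext : ∀ {k} {xs ys : Vec Vector k} → (∀ w → ⟦ xs ⟧ w ≡ ⟦ ys ⟧ w) → xs ≡ ys
    ⟦⟧-ext {xs = []} {[]} e = refl
    ⟦⟧-ext {suc k} {x ∷ xs} {y ∷ ys} e = cong₂ _∷_
      (trans (sym (first x xs)) (trans (e (1ᶠ ∷ replicate k 0ᶠ)) (first y ys)))
      (⟦⟧-ext λ w → trans (sym (others x xs w)) (trans (e (0ᶠ ∷ w)) (others y ys w)))
      where
      first : ∀ x xs → ⟦ x ∷ xs ⟧ (1ᶠ ∷ replicate k 0ᶠ) ≡ x
      first x xs = trans (cong₂ _⊞_ (1-• x) (map-𝟎 (⟦⟧-linear xs))) (identityʳ x)
      others : ∀ x xs w → ⟦ x ∷ xs ⟧ (0ᶠ ∷ w) ≡ ⟦ xs ⟧ w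
      others x xs w = trans (cong (_⊞ ⟦ xs ⟧ w) (0-• x)) (identityˡ _)

  module _ {q : ℕ} (ord : HasOrder F q) where

    -- A subspace of the line of scalars is everything or zero according to whether it contains 1.
    scalars-subspaces : Space.SubspacesHavePowerCard scalars q
    scalars-subspaces {P} S with mem? 1ᶠ
      where open Space.IsSubspace S
    ... | yes P1 = 1 , subst (Card P) (sym (*-identityʳ q)) (Card-↔ ord (λ x → subst P (𝔽.*-identityʳ x) (•-mem x P1)))
      where open Space.IsSubspace S
    ... | no ¬P1 = 0 , Card-singleton 0ᶠ 𝟎-mem (λ {x} Px → decidable-stable (finite-≟ ord x 0ᶠ) λ x≢0 →
        let y , xy≡1 = Field.inverse F x x≢0 in ¬P1 (subst P (trans (𝔽.*-comm y x) xy≡1) (•-mem y Px)))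
      where open Space.IsSubspace S

  module _ (Y : Space) {q N : ℕ} (I : Fin N ↔ Space.Vector Y) (powers : Space.SubspacesHavePowerCard Y q) where
    open Space Y

    -- Rank and nullity of the first coordinate: `P` is counted as its set `Q` of first coordinates
    -- times the kernel `K`, a point of each fibre being chosen by `section`.
    vec-subspaces : ∀ k → Space.SubspacesHavePowerCard (vec-space Y k) q
    vec-subspaces zero S = 0 , Card-singleton [] 𝟎-mem (λ { {[]} _ → refl })
      where open Space.IsSubspace S
    vec-subspaces (suc k) {P} S = proj₁ cardQ + proj₁ cardK ,
      subst (Card P) (sym (^-distribˡ-+-* q (proj₁ cardQ) (proj₁ cardK)))
        (Card-× (proj₂ cardQ) (proj₂ cardK) (λ x ys → x ∷ zipWith _⊞_ (section x (Q? x)) ys) member inject surject)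
      where
      open Space.IsSubspace S
      module Yᵏ = Space (vec-space Y k)
      rehead : ∀ {x y xs} → x ≡ y → P (x ∷ xs) → P (y ∷ xs)
      rehead refl p = p
      Q : Vector → Set
      Q x = ∃ λ xs → P (x ∷ xs)
      Q? : Decidable Q
      Q? x = finite-any? (vec-finite I k) (λ xs → mem? (x ∷ xs))
      K : Vec Vector k → Set
      K xs = P (𝟎 ∷ xs)
      section : ∀ x → Dec (Q x) → Vec Vector k
      section x (yes (xs , _)) = xs
      -- An arbitrary value: `section` only matters on `Q`.
      section x (no _) = Yᵏ.𝟎
      section-mem : ∀ x → Q x → (d : Dec (Q x)) → P (x ∷ section x d)
      section-mem x _ (yes (xs , p)) = p
      section-mem x q (no ¬q) = contradiction q ¬q
      cardQ : ∃ λ e → Card Q (q ^ e)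
      cardQ = powers (record
        { mem? = Q? ; 𝟎-mem = Yᵏ.𝟎 , 𝟎-mem
        ; ⊞-mem = λ (xs , p) (ys , p′) → zipWith _⊞_ xs ys , ⊞-mem p p′
        ; •-mem = λ a (xs , p) → map (a •_) xs , •-mem a p })
      cardK : ∃ λ e → Card K (q ^ e)
      cardK = vec-subspaces k (record
        { mem? = λ xs → mem? (𝟎 ∷ xs) ; 𝟎-mem = 𝟎-mem
        ; ⊞-mem = λ p p′ → rehead (identityˡ 𝟎) (⊞-mem p p′)
        ; •-mem = λ a p → rehead (•-𝟎 a) (•-mem a p) })
      member : ∀ {x ys} → Q x → K ys → P (x ∷ zipWith _⊞_ (section x (Q? x)) ys)
      member {x} q p = rehead (identityʳ x) (⊞-mem (section-mem x q (Q? x)) p)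
      inject : ∀ {x ys x′ ys′} → Q x → K ys → Q x′ → K ys′ →
        x ∷ zipWith _⊞_ (section x (Q? x)) ys ≡ x′ ∷ zipWith _⊞_ (section x′ (Q? x′)) ys′ → x ≡ x′ × ys ≡ ys′
      inject _ _ _ _ e with refl ← Vec.∷-injectiveˡ e = refl , Yᵏ.∙-cancelˡ _ _ _ (Vec.∷-injectiveʳ e)
      surject : ∀ {z} → P z → ∃ λ x → ∃ λ ys → Q x × K ys × x ∷ zipWith _⊞_ (section x (Q? x)) ys ≡ z
      surject {x ∷ xs} p = x , Yᵏ._⊞_ (Yᵏ.⊟ s) xs , (xs , p) ,
        rehead (inverseˡ x) (⊞-mem (⊟-mem (section-mem x (xs , p) (Q? x))) p) ,
        cong (x ∷_) (trans (sym (Yᵏ.assoc s _ xs)) (trans (cong (λ z → zipWith _⊞_ z xs) (Yᵏ.inverseʳ s)) (Yᵏ.identityˡ xs)))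
        where s = section x (Q? x)

-- Operators of finite period and their eigenspaces

module _ {F : Field} where
  open LinearAlgebra F
  open IsLinear

  module _ (Y : Space) {n : ℕ} where
    open Space Y
    private d = suc n

    ∑-shift : (h : ℕ → Vector) → h d ≡ h 0 → ∑ {d} (h ∘ suc ∘ toℕ) ≡ ∑ {d} (h ∘ toℕ)
    ∑-shift h e = trans (∑-last (h ∘ suc) n) (trans (cong (∑ {n} (h ∘ suc ∘ toℕ) ⊞_) e) (comm _ (h 0)))

    orbit-sum-fixed : ∀ {f} → IsLinear Y Y f → ∀ y → iter f d y ≡ y →
      f (∑ {d} (λ j → iter f (toℕ j) y)) ≡ ∑ {d} (λ j → iter f (toℕ j) y)
    orbit-sum-fixed {f} L y per = trans (map-∑ L {d} (λ j → iter f (toℕ j) y)) (∑-shift (λ j → iter f j y) per)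

  module _ (Y : Space) where
    open Space Y

    -- Two commuting operators α and δ of period d, where the powers of δ act freely: Y is the direct sum of the
    -- spaces on which α acts as a fixed power of δ⁻¹, just as if δ were multiplication by a primitive d-th root of unity.
    module CommutingOperators (n : ℕ) {α δ : Vector → Vector}
      (α-linear : IsLinear Y Y α) (δ-linear : IsLinear Y Y δ) (αδ : ∀ y → α (δ y) ≡ δ (α y))
      (α-period : ∀ y → iter α (suc n) y ≡ y) (δ-period : ∀ y → iter δ (suc n) y ≡ y)
      (δ-free : ∀ j → 0 < j → j < suc n → ∀ y → iter δ j y ≡ y → y ≡ 𝟎)
      (c : 𝔽) (c-inverts : ∀ y → c • ∑ {suc n} (λ _ → y) ≡ y) where

      d : ℕ
      d = suc n

      -- Its fixed vectors are those on which `α` acts as the inverse of the `k`-th power of `δ`.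
      g : ℕ → Vector → Vector
      g k y = α (iter δ k y)

      g-linear : ∀ k → IsLinear Y Y (g k)
      g-linear k = ∘-linear α-linear (iter-linear δ-linear k)

      iter-g : ∀ k j y → iter (g k) j y ≡ iter α j (iter δ (j * k) y)
      iter-g k zero y = refl
      iter-g k (suc j) y = begin
        α (iter δ k (iter (g k) j y))                 ≡⟨ cong (g k) (iter-g k j y) ⟩
        α (iter δ k (iter α j (iter δ (j * k) y)))    ≡⟨ cong α (iter-commute α δ αδ j k _) ⟨
        α (iter α j (iter δ k (iter δ (j * k) y)))    ≡⟨ cong (α ∘ iter α j) (iter-+ δ k (j * k) y) ⟨
        α (iter α j (iter δ (k + j * k) y))           ∎
        where open ≡-Reasoning

      δ-period* : ∀ k y → iter δ (k * d) y ≡ y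
      δ-period* k y = trans (iter-* δ k d y) (iter-fixed (iter δ d) k y (δ-period y))

      g-period : ∀ k y → iter (g k) d y ≡ y
      g-period k y = trans (iter-g k d y) (trans (α-period _)
        (trans (cong (λ m → iter δ m y) (*-comm d k)) (δ-period* k y)))

      -- `d` times the projection onto `V k`: the average over the powers of `g k` without the
      -- division by `d`.
      π : ℕ → Vector → Vector
      π k y = ∑ {d} (λ j → iter (g k) (toℕ j) y)

      π-linear : ∀ k → IsLinear Y Y (π k)
      π-linear k = record
        { additive = λ x y → trans (∑-cong {d} (λ j → additive (iter-linear (g-linear k) (toℕ j)) x y))
            (∑-⊞ {d} (λ j → iter (g k) (toℕ j) x) (λ j → iter (g k) (toℕ j) y))
        ; homogeneous = λ a x → trans (∑-cong {d} (λ j → homogeneous (iter-linear (g-linear k) (toℕ j)) a x))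
            (sym (map-∑ (scale-linear Y a) {d} (λ j → iter (g k) (toℕ j) x))) }

      V : ℕ → Vector → Set
      V k y = g k y ≡ y

      π-V : ∀ k y → V k (π k y)
      π-V k y = orbit-sum-fixed Y {n} (g-linear k) y (g-period k y)

      -- Orthogonality: after the sums are exchanged, the `j`-th power of `α` is applied to the sum
      -- over k of the powers δ ^ (j k). That sum is fixed by δ ^ j, hence zero unless j = 0.
      ∑π : ∀ y → ∑ {d} (λ k → π (toℕ k) y) ≡ ∑ {d} (λ _ → y)
      ∑π y = begin
        ∑ {d} (λ k → ∑ {d} (λ j → iter (g (toℕ k)) (toℕ j) y))
          ≡⟨ ∑-cong {d} (λ k → ∑-cong {d} (λ j → iter-g (toℕ k) (toℕ j) y)) ⟩
        ∑ {d} (λ k → ∑ {d} (λ j → iter α (toℕ j) (iter δ (toℕ j * toℕ k) y)))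
          ≡⟨ ∑-swap {d} {d} (λ k j → iter α (toℕ j) (iter δ (toℕ j * toℕ k) y)) ⟩
        ∑ {d} (λ j → ∑ {d} (λ k → iter α (toℕ j) (iter δ (toℕ j * toℕ k) y)))
          ≡⟨ ∑-cong {d} (λ j → map-∑ (iter-linear α-linear (toℕ j)) {d} (λ k → iter δ (toℕ j * toℕ k) y)) ⟨
        ∑ {d} (λ j → iter α (toℕ j) (∑ {d} (λ k → iter δ (toℕ j * toℕ k) y)))
          ≡⟨ ∑-single {d} row Fin.zero (λ { Fin.zero ne → contradiction refl ne ; j@(Fin.suc _) _ → vanish j (s≤s z≤n) }) ⟩
        ∑ {d} (λ _ → y) ∎
        where
        open ≡-Reasoning
        row : Fin d → Vector
        row j = iter α (toℕ j) (∑ {d} (λ k → iter δ (toℕ j * toℕ k) y))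
        vanish : ∀ (j : Fin d) → 0 < toℕ j → iter α (toℕ j) (∑ {d} (λ k → iter δ (toℕ j * toℕ k) y)) ≡ 𝟎
        vanish j 0<j = trans (cong (iter α (toℕ j)) (trans
          (∑-cong {d} (λ k → trans (cong (λ m → iter δ m y) (*-comm (toℕ j) (toℕ k))) (iter-* δ (toℕ k) (toℕ j) y)))
          (δ-free (toℕ j) 0<j (Fin.toℕ<n j) _ (orbit-sum-fixed Y {n} (iter-linear δ-linear (toℕ j)) y
            (trans (sym (iter-* δ d (toℕ j) y)) (trans (cong (λ m → iter δ m y) (*-comm d (toℕ j))) (δ-period* (toℕ j) y)))))))
          (map-𝟎 (iter-linear α-linear (toℕ j)))

      d-cancel : ∀ {y z} → ∑ {d} (λ _ → y) ≡ ∑ {d} (λ _ → z) → y ≡ z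
      d-cancel {y} {z} e = trans (sym (c-inverts y)) (trans (cong (c •_) e) (c-inverts z))

      ∑π≡0⇒≡0 : ∀ y → (∀ k → k < d → π k y ≡ 𝟎) → y ≡ 𝟎
      ∑π≡0⇒≡0 y e = d-cancel (trans (sym (∑π y)) (trans (∑-zero {d} (λ k → π (toℕ k) y) (λ k → e (toℕ k) (Fin.toℕ<n k)))
        (sym (∑-zero {d} (λ _ → 𝟎) (λ _ → refl)))))

      no-eigenvectors⇒trivial : (∀ k → k < d → ∀ y → V k y → y ≡ 𝟎) → ∀ y → y ≡ 𝟎
      no-eigenvectors⇒trivial none y = ∑π≡0⇒≡0 y (λ k k<d → none k k<d (π k y) (π-V k y))

      π-same : ∀ k {z} → V k z → π k z ≡ ∑ {d} (λ _ → z)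
      π-same k v = ∑-cong {d} (λ j → iter-fixed (g k) (toℕ j) _ v)

      V-iter-δ : ∀ l i {z} → V l z → V l (iter δ i z)
      V-iter-δ l i {z} v = trans (cong α (iter-commute δ δ (λ _ → refl) l i z))
        (trans (iter-commute α δ αδ 1 i (iter δ l z)) (cong (iter δ i) v))

      -- On `V l` the operator `g k` acts as the `s`-th power of `δ`, where `s` is k - l modulo `d`.
      -- So `π k z` is fixed by that power, which is free for 0 < s < d.
      π-vanish : ∀ {k l} s → 0 < s → s < d → (∀ y → g k y ≡ α (iter δ (l + s) y)) → ∀ {z} → V l z → π k z ≡ 𝟎
      π-vanish {k} {l} s 0<s s<d e {z} v = δ-free s 0<s s<d _ (trans (cong (iter δ s) (∑-cong {d} (λ j → powers (toℕ j))))
        (trans (orbit-sum-fixed Y {n} (iter-linear δ-linear s) z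
          (trans (sym (iter-* δ d s z)) (trans (cong (λ m → iter δ m z) (*-comm d s)) (δ-period* s z))))
        (sym (∑-cong {d} (λ j → powers (toℕ j))))))
        where
        same : ∀ {w} → V l w → g k w ≡ iter δ s w
        same {w} v = trans (e w) (trans (cong α (iter-+ δ l s w)) (V-iter-δ l s v))
        powers : ∀ j → iter (g k) j z ≡ iter (iter δ s) j z
        powers zero = refl
        powers (suc j) = trans (cong (g k) (powers j))
          (same (subst (V l) (iter-* δ j s z) (V-iter-δ l (j * s) v)))

      π-different : ∀ {k l} → k < d → l < d → k ≢ l → ∀ {z} → V l z → π k z ≡ 𝟎
      π-different {k} {l} k<d l<d k≢l with <-cmp k l
      ... | tri≈ _ e _ = contradiction e k≢l
      -- Since k < l, the difference k - l is represented modulo `d` by d - l + k.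
      ... | tri< k<l _ _ = π-vanish {k} {l} (d ∸ l + k) (<-≤-trans (m<n⇒0<n∸m l<d) (m≤m+n _ k))
              (subst (d ∸ l + k <_) (m∸n+n≡m (<⇒≤ l<d)) (+-monoʳ-< (d ∸ l) k<l))
              (λ y → sym (cong α (trans (cong (λ m → iter δ m y) e) (trans (iter-+ δ k d y) (cong (iter δ k) (δ-period y))))))
        where
        e : l + (d ∸ l + k) ≡ k + d
        e = trans (sym (+-assoc l (d ∸ l) k)) (trans (cong (_+ k) (m+[n∸m]≡n (<⇒≤ l<d))) (+-comm d k))
      ... | tri> _ _ l<k = π-vanish {k} {l} (k ∸ l) (m<n⇒0<n∸m l<k) (≤-<-trans (m∸n≤m k l) k<d)
              (λ y → cong (λ m → α (iter δ m y)) (sym (m+[n∸m]≡n (<⇒≤ l<k))))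

      -- The sum of the spaces `V k` with k < K, expressed by the vanishing of the remaining
      -- components so that membership does not refer to a decomposition.
      U : ℕ → Vector → Set
      U K y = ∀ k → K ≤ k → k < d → π k y ≡ 𝟎

      module _ {q : ℕ} (e : ℕ → ℕ) (cardV : ∀ k → k < d → Card (V k) (q ^ e k)) where

        cardU : ∀ K → K ≤ d → Card (U K) (q ^ sum {K} (e ∘ toℕ))
        cardU zero _ = Card-singleton 𝟎 (λ k _ _ → map-𝟎 (π-linear k)) (λ u → ∑π≡0⇒≡0 _ (λ k → u k z≤n))
        cardU (suc K) K<d = subst (Card (U (suc K)))
          (trans (sym (^-distribˡ-+-* q (sum {K} (e ∘ toℕ)) (e K))) (cong (q ^_) (sym (sum-last e K))))
          (Card-× (cardU K (<⇒≤ K<d)) (cardV K K<d) _⊞_ member inject surject)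
          where
          member : ∀ {u v} → U K u → V K v → U (suc K) (u ⊞ v)
          member {u} {v} Uu Vv k K<k k<d = trans (additive (π-linear k) u v)
            (trans (cong₂ _⊞_ (Uu k (<⇒≤ K<k) k<d) (π-different k<d K<d (<⇒≢ K<k ∘ sym) Vv)) (identityˡ 𝟎))
          πK : ∀ {u v} → U K u → V K v → π K (u ⊞ v) ≡ ∑ {d} (λ _ → v)
          πK {u} {v} Uu Vv = trans (additive (π-linear K) u v)
            (trans (cong₂ _⊞_ (Uu K ≤-refl K<d) (π-same K Vv)) (identityˡ _))
          inject : ∀ {u v u′ v′} → U K u → V K v → U K u′ → V K v′ → u ⊞ v ≡ u′ ⊞ v′ → u ≡ u′ × v ≡ v′
          inject {u} {v} {u′} {v′} Uu Vv Uu′ Vv′ eq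
            with refl ← d-cancel (trans (sym (πK Uu Vv)) (trans (cong (π K) eq) (πK Uu′ Vv′))) =
            ∙-cancelʳ v u u′ eq , refl
          surject : ∀ {z} → U (suc K) z → ∃ λ u → ∃ λ v → U K u × V K v × u ⊞ v ≡ z
          surject {z} Uz = z ⊞ ⊟ v , v , Uu , Vv , sub-add z v
            where
            v : Vector
            -- `c` is 1 / d, which turns `π K` into the true projection onto `V K`.
            v = c • π K z
            Vv : V K v
            Vv = trans (homogeneous (g-linear K) c (π K z)) (cong (c •_) (π-V K z))
            π-u : ∀ k → π k (z ⊞ ⊟ v) ≡ π k z ⊞ ⊟ π k v
            π-u k = trans (additive (π-linear k) z (⊟ v)) (cong (π k z ⊞_) (map-⊟ (π-linear k) v))
            Uu : U K (z ⊞ ⊟ v)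
            Uu k K≤k k<d with <-cmp K k
            ... | tri> _ _ k<K = contradiction K≤k (<⇒≱ k<K)
            ... | tri< K<k _ _ = trans (π-u k) (trans (cong₂ (λ a b → a ⊞ ⊟ b) (Uz k K<k k<d)
                  (π-different k<d K<d (<⇒≢ K<k ∘ sym) Vv)) (inverseʳ 𝟎))
            ... | tri≈ _ refl _ = trans (π-u K) (trans (cong (λ b → π K z ⊞ ⊟ b)
                  (trans (π-same K Vv) (trans (sym (map-∑ (scale-linear Y c) {d} (λ _ → π K z))) (c-inverts (π K z)))))
                  (inverseʳ (π K z)))

        eigenspace-decomposition : ∀ {N} → Fin N ↔ Vector → N ≡ q ^ sum {d} (e ∘ toℕ)
        eigenspace-decomposition I = Card-unique
          (Card-↔ {P = U d} I (λ y k d≤k k<d → contradiction d≤k (<⇒≱ k<d))) (cardU d ≤-refl)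

-- Free linear actions and nearfields

prime-divisor : ∀ {k} → 1 < k → ∃ λ p → Prime p × p ∣ k
prime-divisor {k} 1<k with factorise k {{>-nonZero (<-trans z<s 1<k)}}
... | record { factors = [] ; isFactorisation = refl } = contradiction 1<k 1+n≰n
... | record { factors = p ∷ ps ; isFactorisation = refl ; factorsPrime = pr ∷ _ } = p , pr , m∣m*n _

^-cancelʳ-≤ : ∀ q {i j} → 1 < q → q ^ i ≤ q ^ j → i ≤ j
^-cancelʳ-≤ q {i} {j} 1<q le with i ≤? j
... | yes i≤j = i≤j
... | no i≰j = contradiction le (<⇒≱ (^-monoʳ-< q 1<q (≰⇒> i≰j)))

^-injectiveʳ : ∀ q {i j} → 1 < q → q ^ i ≡ q ^ j → i ≡ j
^-injectiveʳ q 1<q e = ≤-antisym (^-cancelʳ-≤ q 1<q (≤-reflexive e)) (^-cancelʳ-≤ q 1<q (≤-reflexive (sym e)))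

module Punctured {X : Set} {m : ℕ} (I : Fin (suc m) ↔ X) (z : X) where
  open Inverse I

  -- The inequality is irrelevant, so that equal values make equal elements (`Other-≡`); decidable
  -- equality recovers it in `≢-val`.
  record Other : Set where
    constructor _,_
    field
      val : X
      .≢z : val ≢ z

  open Other public

  ≢-val : (x : Other) → val x ≢ z
  ≢-val (x , ne) = recompute (¬? (finite-≟ I x z)) ne

  Other-≡ : {x y : Other} → val x ≡ val y → x ≡ y
  Other-≡ {_ , _} {_ , _} refl = refl

  punctured-finite : Fin m ↔ Other
  punctured-finite = mk↔ₛ′
    (λ i → to (Fin.punchIn (from z) i) , λ e → Fin.punchInᵢ≢i (from z) i (trans (sym (strictlyInverseʳ _)) (cong from e)))
    (λ x → Fin.punchOut (from-≢ x))
    (λ x → Other-≡ (trans (cong to (Fin.punchIn-punchOut (from-≢ x))) (strictlyInverseˡ (val x))))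
    (λ i → trans (Fin.punchOut-cong (from z) (strictlyInverseʳ _)) (Fin.punchOut-punchIn (from z)))
    where
    from-≢ : (x : Other) → from z ≢ from (val x)
    from-≢ x e = ≢-val x (sym (from-injective I e))

module _ {F : Field} {q : ℕ} (ord : HasOrder F q) where
  open LinearAlgebra F
  open IsLinear

  1<q : 1 < q
  1<q = Fin.injective⇒≤ {f = f} f-inj
    where
    open Inverse ord
    f : Fin 2 → Fin q
    f Fin.zero = from 0ᶠ
    f (Fin.suc _) = from 1ᶠ
    f-inj : ∀ {i j} → f i ≡ f j → i ≡ j
    f-inj {Fin.zero} {Fin.zero} _ = refl
    f-inj {Fin.zero} {Fin.suc Fin.zero} e = contradiction (from-injective ord e) (Field.0≢1 F)
    f-inj {Fin.suc Fin.zero} {Fin.zero} e = contradiction (sym (from-injective ord e)) (Field.0≢1 F)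
    f-inj {Fin.suc Fin.zero} {Fin.suc Fin.zero} _ = refl

  private module S = Space scalars

  cast : ℕ → 𝔽
  cast k = S.∑ {k} (λ _ → 1ᶠ)

  ∑-const : ∀ (Y : Space) k y → Space.∑ Y {k} (λ _ → y) ≡ Space._•_ Y (cast k) y
  ∑-const Y zero y = sym (Space.0-• Y y)
  ∑-const Y (suc k) y = trans (cong₂ (Space._⊞_ Y) (sym (Space.1-• Y y)) (∑-const Y k y)) (sym (Space.+-• Y 1ᶠ (cast k) y))

  cast-+ : ∀ i j → cast (i + j) ≡ cast i +ᶠ cast j
  cast-+ zero j = sym (𝔽.+-identityˡ _)
  cast-+ (suc i) j = trans (cong (1ᶠ +ᶠ_) (cast-+ i j)) (sym (𝔽.+-assoc 1ᶠ _ _))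

  cast-* : ∀ i j → cast (i * j) ≡ cast i *ᶠ cast j
  cast-* zero j = sym (𝔽.zeroˡ _)
  cast-* (suc i) j = trans (cast-+ j (i * j)) (trans (cong₂ _+ᶠ_ (sym (𝔽.*-identityˡ _)) (cast-* i j)) (sym (𝔽.distribʳ _ _ _)))

  -- Translating by 1 permutes the field, so the sum of all elements does not change when q copies of 1 are added.
  cast-q : cast q ≡ 0ᶠ
  cast-q = S.identityˡ-unique (cast q) total (trans (S.comm (cast q) total) (sym (begin
    total                              ≡⟨ Sum.∑-permute (record { isCommutativeMonoid = S.isCommutativeMonoid }) to shift ⟩
    S.∑ (λ i → to (from (to i +ᶠ 1ᶠ)))  ≡⟨ S.∑-cong {q} (λ i → strictlyInverseˡ (to i +ᶠ 1ᶠ)) ⟩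
    S.∑ (λ i → to i +ᶠ 1ᶠ)              ≡⟨ S.∑-⊞ {q} to (λ _ → 1ᶠ) ⟩
    total +ᶠ cast q                    ∎)))
    where
    open Inverse ord
    open ≡-Reasoning
    total : 𝔽
    total = S.∑ {q} to
    shift : Fin q ↔ Fin q
    shift = mk↔ₛ′ (λ i → from (to i +ᶠ 1ᶠ)) (λ i → from (to i +ᶠ (-ᶠ 1ᶠ)))
      (λ i → trans (cong (λ x → from (x +ᶠ 1ᶠ)) (strictlyInverseˡ _)) (trans (cong from (S.sub-add _ _)) (strictlyInverseʳ i)))
      (λ i → trans (cong (λ x → from (x +ᶠ (-ᶠ 1ᶠ))) (strictlyInverseˡ _))
        (trans (cong from (trans (𝔽.+-assoc _ _ _) (trans (cong (to i +ᶠ_) (𝔽.-‿inverseʳ 1ᶠ)) (𝔽.+-identityʳ _)))) (strictlyInverseʳ i)))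

  -- In F the number q ^ n is 0, so m = d′ d becomes -1 and -d′ is the inverse of `d`.
  cast-invertible : ∀ {m n d} → suc m ≡ q ^ n → 0 < n → d ∣ m → ∃ λ c → c *ᶠ cast d ≡ 1ᶠ
  cast-invertible {m} {suc n} {d} eq _ (divides d′ refl) = -ᶠ cast d′ , (begin
    (-ᶠ cast d′) *ᶠ cast d        ≡⟨ RingProperties.-‿distribˡ-* (record { isRing = 𝔽.isRing }) _ _ ⟨
    -ᶠ (cast d′ *ᶠ cast d)        ≡⟨ cong -ᶠ_ (cast-* d′ d) ⟨
    -ᶠ cast (d′ * d)              ≡⟨ S.inverseˡ-unique 1ᶠ (cast (d′ * d)) (trans (cong cast eq)
                                      (trans (cast-* q (q ^ n)) (trans (cong (_*ᶠ cast (q ^ n)) cast-q) (𝔽.zeroˡ _)))) ⟨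
    1ᶠ                            ∎)
    where
    open ≡-Reasoning

  module _ (n : ℕ) where

    W : Space
    W = vec-space scalars n
    open Space W

    ones≢𝟎 : 0 < n → replicate n 1ᶠ ≢ 𝟎
    ones≢𝟎 = go n
      where
      go : ∀ n → 0 < n → replicate n 1ᶠ ≢ replicate n 0ᶠ
      go (suc n) _ e = Field.0≢1 F (sym (Vec.∷-injectiveˡ e))

    -- A noncommutative G would contain a and b such that b normalizes but does not centralize ⟨ a ⟩, while b ^ ℓ
    -- centralizes it, for a prime ℓ dividing m. The n²-dimensional space of endomorphisms is then the direct sum of
    -- the spaces { X ∣ a X a ^ k = X }, and composition with b⁻¹ permutes the nonzero ones in orbits of length ℓ.
    -- Hence ℓ divides n².
    module FreeAction (0<n : 0 < n) {m : ℕ} (m-eq : suc m ≡ q ^ n)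
      (coprime : ∀ ℓ → Prime ℓ → ℓ ∣ n → ¬ ℓ ∣ m)
      {G : Set} {_·_ : G → G → G} {ε : G} {_⁻¹ : G → G} (isGroup-G : IsGroup _≡_ _·_ ε _⁻¹) (enum : Fin m ↔ G)
      (_▹_ : G → Vector → Vector) (▹-linear : ∀ x → IsLinear W W (x ▹_))
      (·-▹ : ∀ x y w → (x · y) ▹ w ≡ x ▹ (y ▹ w)) (ε-▹ : ∀ w → ε ▹ w ≡ w)
      (▹-free : ∀ {x w} → w ≢ 𝟎 → x ▹ w ≡ w → x ≡ ε) where

      I : Fin (q ^ n) ↔ Vector
      I = vec-finite ord n

      open FiniteGroup isGroup-G enum renaming (group to group-G)
      open IsGroup isGroup-G using () renaming (assoc to ·-assoc; identityˡ to ·-identityˡ; identityʳ to ·-identityʳ; inverseʳ to ⁻¹-inverseʳ; inverseˡ to ⁻¹-inverseˡ)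
      open GroupProperties group-G using () renaming
        (∙-cancelˡ to ·-cancelˡ; ∙-cancelʳ to ·-cancelʳ)

      iter-▹ : ∀ x k w → iter (x ▹_) k w ≡ pow x k ▹ w
      iter-▹ x zero w = sym (ε-▹ w)
      iter-▹ x (suc k) w = trans (cong (x ▹_) (iter-▹ x k w)) (sym (·-▹ _ _ _))

      period : ∀ x k → pow x k ≡ ε → ∀ w → iter (x ▹_) k w ≡ w
      period x k e w = trans (iter-▹ x k w) (trans (cong (λ y → y ▹ w) e) (ε-▹ w))

      free : ∀ x k → pow x k ≢ ε → ∀ w → iter (x ▹_) k w ≡ w → w ≡ 𝟎
      free x k ne w e = decidable-stable (finite-≟ I w 𝟎) λ w≢𝟎 →
        ne (▹-free w≢𝟎 (trans (sym (iter-▹ x k w)) e))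

      inverts : ∀ (Y : Space) {d} → d ∣ m → ∃ λ c → ∀ y → Space._•_ Y c (Space.∑ Y {d} (λ _ → y)) ≡ y
      inverts Y {d} d∣m with c , e ← cast-invertible m-eq 0<n d∣m =
        c , λ y → trans (cong (Space._•_ Y c) (∑-const Y d y))
          (trans (sym (Space.*-• Y c (cast d) y)) (trans (cong (λ a → Space._•_ Y a y) e) (Space.1-• Y y)))

      module _ {a : G} (O : Order a) where
        open Order O

        -- `a` serves as the operator `δ` and `y` as `α`, both on `W`.
        module Eigenspaces (y : G) (cy : Commute a y) (ye : pow y order ≡ ε) where
          commutes : ∀ w → y ▹ (a ▹ w) ≡ a ▹ (y ▹ w)
          commutes w = trans (sym (·-▹ y a w))
            (trans (cong (λ x → x ▹ w) (sym cy)) (·-▹ a y w))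
          a-free : ∀ j → 0 < j → j < order → ∀ w → iter (a ▹_) j w ≡ w → w ≡ 𝟎
          a-free j 0<j j<d = free a j (minimal j 0<j j<d)
          c : 𝔽
          c = proj₁ (inverts W order∣N)
          c-inverts : ∀ w → c • ∑ {order} (λ _ → w) ≡ w
          c-inverts = proj₂ (inverts W order∣N)
          open CommutingOperators W order-1 (▹-linear y) (▹-linear a) commutes
            (period y order ye) (period a order pow-order) a-free c c-inverts public

        -- If no product of `y` with a power of `a` were `ε`, none would fix a nonzero vector, by
        -- freeness. All eigenspaces would vanish and with them `W`, which has a nonzero vector
        -- since 0 < n.
        commuting⇒inverse-power : ∀ y → Commute a y → pow y order ≡ ε → ∃ λ k → y · pow a k ≡ ε
        commuting⇒inverse-power y cy ye =
          decide (Fin.any? (λ (k : Fin order) → finite-≟ enum (y · pow a (toℕ k)) ε))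
          where
          trivial : ¬ (∃ λ (k : Fin order) → y · pow a (toℕ k) ≡ ε) →
            ∀ k → k < order → ∀ w → y ▹ iter (a ▹_) k w ≡ w → w ≡ 𝟎
          trivial none k k<d w v = decidable-stable (finite-≟ I w 𝟎) λ w≢𝟎 →
            none (fromℕ< k<d , subst (λ j → y · pow a j ≡ ε) (sym (Fin.toℕ-fromℕ< k<d))
              (▹-free w≢𝟎 (trans (·-▹ y (pow a k) w)
                (trans (cong (y ▹_) (sym (iter-▹ a k w))) v))))
          decide : Dec (∃ λ (k : Fin order) → y · pow a (toℕ k) ≡ ε) → ∃ λ k → y · pow a k ≡ ε
          decide (yes (k , e)) = toℕ k , e
          decide (no none) = contradiction (Eigenspaces.no-eigenvectors⇒trivial y cy ye (trivial none) (replicate n 1ᶠ)) (ones≢𝟎 0<n)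

        commuting⇒power : ∀ y → Commute a y → pow y order ≡ ε → ∃ λ k → y ≡ pow a k
        -- `y` is the inverse of `pow a k`, that is, the power of `a` with exponent k (order - 1).
        commuting⇒power y cy ye = k * order-1 ,
          ·-cancelʳ (pow a k) _ _ (trans e (sym (trans (sym (pow-+ a (k * order-1) k))
            (trans (cong (pow a) (trans (+-comm (k * order-1) k) (sym (*-suc k order-1)))) (pow-multiple k)))))
          where
          k : ℕ
          k = proj₁ (commuting⇒inverse-power y cy ye)
          e : y · pow a k ≡ ε
          e = proj₂ (commuting⇒inverse-power y cy ye)

      -- The endomorphisms of `W`, given by their columns; `left` and `right` compose with a group
      -- element after and before.
      M : Space
      M = vec-space W n
      module M = Space M

      I-M : Fin ((q ^ n) ^ n) ↔ M.Vector
      I-M = vec-finite I n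

      left : G → M.Vector → M.Vector
      left x = map (x ▹_)

      left-linear : ∀ x → IsLinear M M (left x)
      left-linear x = map-linear W (▹-linear x)

      ⟦left⟧ : ∀ x X w → ⟦_⟧ W (left x X) w ≡ x ▹ ⟦_⟧ W X w
      ⟦left⟧ x X w = ⟦⟧-map W (▹-linear x) X w

      left-· : ∀ x y X → left (x · y) X ≡ left x (left y X)
      left-· x y X = ⟦⟧-ext W λ w → trans (⟦left⟧ (x · y) X w) (trans (·-▹ x y _)
        (sym (trans (⟦left⟧ x (left y X) w) (cong (x ▹_) (⟦left⟧ y X w)))))

      left-ε : ∀ X → left ε X ≡ X
      left-ε X = ⟦⟧-ext W λ w → trans (⟦left⟧ ε X w) (ε-▹ _)

      iter-left : ∀ x k X → iter (left x) k X ≡ left (pow x k) X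
      iter-left x zero X = sym (left-ε X)
      iter-left x (suc k) X = trans (cong (left x) (iter-left x k X)) (sym (left-· x (pow x k) X))

      left-cancel : ∀ x {X Y} → left x X ≡ left x Y → X ≡ Y
      left-cancel x {X} {Y} e = trans (undo X) (trans (cong (left (x ⁻¹)) e) (sym (undo Y)))
        where
        undo : ∀ X → X ≡ left (x ⁻¹) (left x X)
        undo X = trans (sym (left-ε X)) (trans (cong (λ y → left y X) (sym (⁻¹-inverseˡ x))) (left-· (x ⁻¹) x X))

      -- Where `x` and `y` agree, y⁻¹ x fixes a vector; by freeness that vector is 0, so the image
      -- of `X` is 0.
      left-separates : ∀ {x y} → x ≢ y → ∀ X → left x X ≡ left y X → X ≡ M.𝟎
      left-separates {x} {y} x≢y X e = ⟦⟧-ext W λ w → trans (vanish w) (sym (⟦𝟎⟧ W w))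
        where
        vanish : ∀ w → ⟦_⟧ W X w ≡ 𝟎
        vanish w = decidable-stable (finite-≟ I _ 𝟎) λ ne → x≢y (sym (·-cancelˡ (y ⁻¹) _ _ (trans (⁻¹-inverseˡ y) (sym
          (▹-free ne (trans (·-▹ (y ⁻¹) x _) (trans (cong ((y ⁻¹) ▹_) (trans (sym (⟦left⟧ x X w))
            (trans (cong (λ Y → ⟦_⟧ W Y w) e) (⟦left⟧ y X w)))) (trans (sym (·-▹ (y ⁻¹) y _))
            (trans (cong (_▹ _) (⁻¹-inverseˡ y)) (ε-▹ _))))))))))

      right : G → M.Vector → M.Vector
      right x X = matrix W (λ w → ⟦_⟧ W X (x ▹ w))

      ⟦right⟧ : ∀ x X w → ⟦_⟧ W (right x X) w ≡ ⟦_⟧ W X (x ▹ w)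
      ⟦right⟧ x X w = ⟦⟧-matrix W (∘-linear (⟦⟧-linear W X) (▹-linear x)) w

      right-linear : ∀ x → IsLinear M M (right x)
      right-linear x = record
        { additive = λ X Y → ⟦⟧-ext W λ w → trans (⟦right⟧ x (X M.⊞ Y) w) (trans (⟦⟧-⊞ W X Y (x ▹ w))
            (sym (trans (⟦⟧-⊞ W (right x X) (right x Y) w) (cong₂ _⊞_ (⟦right⟧ x X w) (⟦right⟧ x Y w)))))
        ; homogeneous = λ a X → ⟦⟧-ext W λ w → trans (⟦right⟧ x (a M.• X) w) (trans (⟦⟧-map W (scale-linear W a) X (x ▹ w))
            (sym (trans (⟦⟧-map W (scale-linear W a) (right x X) w) (cong (a •_) (⟦right⟧ x X w))))) }

      left-right : ∀ x y X → left x (right y X) ≡ right y (left x X)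
      left-right x y X = ⟦⟧-ext W λ w → trans (⟦left⟧ x (right y X) w) (trans (cong (x ▹_) (⟦right⟧ y X w))
        (sym (trans (⟦right⟧ y (left x X) w) (⟦left⟧ x X (y ▹ w)))))

      ⟦iter-right⟧ : ∀ x k X w → ⟦_⟧ W (iter (right x) k X) w ≡ ⟦_⟧ W X (pow x k ▹ w)
      ⟦iter-right⟧ x zero X w = cong (⟦_⟧ W X) (sym (ε-▹ w))
      ⟦iter-right⟧ x (suc k) X w = trans (⟦right⟧ x (iter (right x) k X) w) (trans (⟦iter-right⟧ x k X (x ▹ w))
        (cong (⟦_⟧ W X) (trans (sym (·-▹ (pow x k) x w)) (cong (_▹ w) (sym (Commute-pow refl k))))))

      iter-right-pow : ∀ x i j → pow x i ≡ pow x j → ∀ X → iter (right x) i X ≡ iter (right x) j X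
      iter-right-pow x i j e X = ⟦⟧-ext W λ w → trans (⟦iter-right⟧ x i X w)
        (trans (cong (λ y → ⟦_⟧ W X (y ▹ w)) e) (sym (⟦iter-right⟧ x j X w)))

      -- `X` vanishes on the image of x ^ k - 1. This map has trivial kernel by freeness and is
      -- surjective because `W` is finite.
      right-free : ∀ x k → pow x k ≢ ε → ∀ X → iter (right x) k X ≡ X → X ≡ M.𝟎
      right-free x k ne X e = ⟦⟧-ext W λ w → trans (vanish w) (sym (⟦𝟎⟧ W w))
        where
        x-1 : Vector → Vector
        x-1 w = pow x k ▹ w ⊞ ⊟ w
        x-1-linear : IsLinear W W x-1
        x-1-linear = record
          { additive = λ v w → trans (cong₂ _⊞_ (additive (▹-linear (pow x k)) v w) (⊟-⊞ v w)) (interchange _ _ _ _)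
          ; homogeneous = λ a w → trans (cong₂ _⊞_ (homogeneous (▹-linear (pow x k)) a w) (•-⊟ a w)) (sym (•-⊞ a _ _)) }
          where
          ⊟-⊞ : ∀ v w → ⊟ (v ⊞ w) ≡ ⊟ v ⊞ ⊟ w
          ⊟-⊞ v w = trans (sym (-1-• _)) (trans (•-⊞ _ v w) (cong₂ _⊞_ (-1-• v) (-1-• w)))
          •-⊟ : ∀ a w → ⊟ (a • w) ≡ a • ⊟ w
          •-⊟ a w = sym (map-⊟ (scale-linear W a) w)
        x-1-injective : ∀ {v w} → x-1 v ≡ x-1 w → v ≡ w
        x-1-injective = trivial-kernel⇒injective x-1-linear λ w e → decidable-stable (finite-≟ I w 𝟎)
          λ w≢𝟎 → ne (▹-free w≢𝟎 (∙-cancelʳ (⊟ w) _ _ (trans e (sym (inverseʳ w)))))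
        vanish : ∀ w → ⟦_⟧ W X w ≡ 𝟎
        vanish w = trans (cong (⟦_⟧ W X) (sym (proj₂ pre))) (trans (additive (⟦⟧-linear W X) _ _)
          (trans (cong₂ _⊞_ (trans (sym (⟦iter-right⟧ x k X v)) (cong (λ Y → ⟦_⟧ W Y v) e)) (map-⊟ (⟦⟧-linear W X) v)) (inverseʳ _)))
          where
          pre : ∃ λ v → x-1 v ≡ w
          pre = injective⇒surjective I x-1 x-1-injective w
          v : Vector
          v = proj₁ pre

      module BadPair {a b : G} (O : Order a) {ℓ t : ℕ} (pr : Prime ℓ)
        (normalizes : conj b a ≡ pow a t) (¬commute : ¬ Commute b a) (commute-ℓ : Commute (pow b ℓ) a) where
        open Order O

        c : 𝔽
        c = proj₁ (inverts M order∣N)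
        c-inverts : ∀ X → c M.• M.∑ {order} (λ _ → X) ≡ X
        c-inverts = proj₂ (inverts M order∣N)
        left-period : ∀ X → iter (left a) order X ≡ X
        left-period X = trans (iter-left a order X) (trans (cong (λ x → left x X) pow-order) (left-ε X))
        right-period : ∀ X → iter (right a) order X ≡ X
        right-period = iter-right-pow a order 0 pow-order
        a-free : ∀ j → 0 < j → j < order → ∀ X → iter (right a) j X ≡ X → X ≡ M.𝟎
        a-free j 0<j j<d = right-free a j (minimal j 0<j j<d)

        module E = CommutingOperators M order-1 (left-linear a) (right-linear a) (left-right a a)
          left-period right-period a-free c c-inverts
        open E using (V; g)

        V-subspace : ∀ k → Space.IsSubspace M (V k)
        V-subspace k = record
          { mem? = λ X → finite-≟ I-M (g k X) X
          ; 𝟎-mem = map-𝟎 (E.g-linear k)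
          ; ⊞-mem = λ {X} {Y} p p′ → trans (additive (E.g-linear k) X Y) (cong₂ M._⊞_ p p′)
          ; •-mem = λ s {X} p → trans (homogeneous (E.g-linear k) s X) (cong (s M.•_) p) }

        cardV : ∀ k → ∃ λ e → Card (V k) (q ^ e)
        cardV k = vec-subspaces W I (vec-subspaces scalars ord (scalars-subspaces ord) n) n (V-subspace k)

        e : ℕ → ℕ
        e k = proj₁ (cardV k)

        n²≡ : n * n ≡ sum {order} (λ k → e (toℕ k))
        n²≡ = ^-injectiveʳ q (1<q) (trans (sym (^-*-assoc q n n))
          (E.eigenspace-decomposition e (λ k _ → proj₂ (cardV k)) I-M))

        -- Multiplication of exponents by `t` is what conjugation by `b` does to the powers of `a`;
        -- composition with b⁻¹ takes `V k` to `V (τ k)`. Its period `ℓ` comes from `commute-ℓ`.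
        τ : Fin order → Fin order
        τ k = (t * toℕ k) mod order

        pow-toℕ-τ : ∀ k → pow a (toℕ (τ k)) ≡ pow a (t * toℕ k)
        pow-toℕ-τ k = trans (cong (pow a) {toℕ (τ k)} {(t * toℕ k) % order} (Fin.toℕ-fromℕ< _)) (pow-% (t * toℕ k))

        pow-τ : ∀ k → pow a (toℕ (τ k)) ≡ conj b (pow a (toℕ k))
        pow-τ k = trans (pow-toℕ-τ k) (trans (cong (pow a) (*-comm t (toℕ k)))
          (trans (pow-* a (toℕ k) t) (trans (cong (λ x → pow x (toℕ k)) (sym normalizes)) (sym (conj-pow b a (toℕ k))))))

        pow-iter-τ : ∀ i k → pow a (toℕ (iter τ i k)) ≡ conj (pow b i) (pow a (toℕ k))
        pow-iter-τ i k = trans (go i) (iter-conj b i _)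
          where
          go : ∀ i → pow a (toℕ (iter τ i k)) ≡ iter (conj b) i (pow a (toℕ k))
          go zero = refl
          go (suc i) = trans (pow-τ (iter τ i k)) (cong (conj b) (go i))

        τ-period : ∀ k → iter τ ℓ k ≡ k
        τ-period k = Fin.toℕ-injective (pow-injective (Fin.toℕ<n _) (Fin.toℕ<n k)
          (trans (pow-iter-τ ℓ k) (Commute⇒conj-fixed (Commute-pow commute-ℓ (toℕ k)))))

        V-power : ∀ k {X} → V k X → ∀ i → left (pow a i) (iter (right a) (i * k) X) ≡ X
        V-power k {X} v i = trans (sym (iter-left a i _)) (trans (sym (E.iter-g k i X)) (iter-fixed (g k) i X v))

        -- b⁻¹ X lies in V (τ k) for X in V k, because a b⁻¹ = b⁻¹ a ^ t.
        left-V : ∀ k {X} → V (toℕ k) X → V (toℕ (τ k)) (left (b ⁻¹) X)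
        left-V k {X} v = begin
          left a (iter (right a) (toℕ (τ k)) (left (b ⁻¹) X))
            ≡⟨ cong (left a) (iter-right-pow a (toℕ (τ k)) (t * toℕ k) (pow-toℕ-τ k) (left (b ⁻¹) X)) ⟩
          left a (iter (right a) (t * toℕ k) (left (b ⁻¹) X))
            ≡⟨ cong (left a) (iter-commute (left (b ⁻¹)) (right a) (left-right (b ⁻¹) a) 1 (t * toℕ k) X) ⟨
          left a (left (b ⁻¹) (iter (right a) (t * toℕ k) X))
            ≡⟨ left-· a (b ⁻¹) _ ⟨
          left (a · (b ⁻¹)) (iter (right a) (t * toℕ k) X)
            ≡⟨ cong (λ x → left x (iter (right a) (t * toℕ k) X)) swap ⟩
          left ((b ⁻¹) · pow a t) (iter (right a) (t * toℕ k) X)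
            ≡⟨ left-· (b ⁻¹) (pow a t) _ ⟩
          left (b ⁻¹) (left (pow a t) (iter (right a) (t * toℕ k) X))
            ≡⟨ cong (left (b ⁻¹)) (V-power (toℕ k) v t) ⟩
          left (b ⁻¹) X ∎
          where
          open ≡-Reasoning
          swap : a · (b ⁻¹) ≡ (b ⁻¹) · pow a t
          swap = sym (trans (cong ((b ⁻¹) ·_) (sym normalizes)) (trans (sym (·-assoc (b ⁻¹) (b · a) (b ⁻¹)))
            (cong (_· (b ⁻¹)) (trans (sym (·-assoc (b ⁻¹) b a)) (trans (cong (_· a) (⁻¹-inverseˡ b)) (·-identityˡ a))))))

        e-≤ : ∀ k → e (toℕ k) ≤ e (toℕ (τ k))
        e-≤ k = ^-cancelʳ-≤ q 1<q (Card-≤ (proj₂ (cardV (toℕ k))) (proj₂ (cardV (toℕ (τ k)))) (left (b ⁻¹))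
          (left-V k) (λ _ _ → left-cancel (b ⁻¹)))

        e-≤-iter : ∀ i k → e (toℕ k) ≤ e (toℕ (iter τ i k))
        e-≤-iter zero k = ≤-refl
        e-≤-iter (suc i) k = ≤-trans (e-≤-iter i k) (e-≤ (iter τ i k))

        -- The exponents cannot decrease along an orbit of `τ`, and the orbit closes after `ℓ`
        -- steps.
        e-τ : ∀ k → e (toℕ (τ k)) ≡ e (toℕ k)
        e-τ k = ≤-antisym (subst (λ j → e (toℕ (τ k)) ≤ e (toℕ j)) back (e-≤-iter (pred ℓ) (τ k))) (e-≤ k)
          where
          back : iter τ (pred ℓ) (τ k) ≡ k
          back = trans (sym (iter-+ τ (pred ℓ) 1 k)) (trans (cong (λ i → iter τ i k)
            (trans (+-comm (pred ℓ) 1) (suc-pred ℓ {{>-nonZero (prime⇒pos pr)}}))) (τ-period k))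

        -- If `τ` fixes `k`, then a ^ (t k) = a ^ k, and for `X` in `V k` both a ^ t X a ^ k and a X
        -- a ^ k equal `X`. As `b` does not centralize `a`, a ^ t differs from `a`, and
        -- `left-separates` gives X a ^ k = 0.
        τ-moves : ∀ k → e (toℕ k) ≢ 0 → τ k ≢ k
        τ-moves k ne τk≡k = ne (^-injectiveʳ q {e (toℕ k)} {0} 1<q
          (Card-unique (proj₂ (cardV (toℕ k))) (Card-singleton M.𝟎 (Space.IsSubspace.𝟎-mem (V-subspace (toℕ k))) zero-only)))
          where
          pow-a-t≢a : pow a t ≢ a
          pow-a-t≢a e = ¬commute (conj-fixed⇒Commute (trans normalizes e))
          fixed-power : pow a (t * toℕ k) ≡ pow a (toℕ k)
          fixed-power = trans (sym (pow-toℕ-τ k)) (cong (λ j → pow a (toℕ j)) τk≡k)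
          zero-only : ∀ {X} → V (toℕ k) X → X ≡ M.𝟎
          zero-only {X} v = trans (sym v) (trans (cong (left a) vanish) (map-𝟎 (left-linear a)))
            where
            vanish : iter (right a) (toℕ k) X ≡ M.𝟎
            vanish = left-separates pow-a-t≢a _ (trans (cong (left (pow a t)) (iter-right-pow a (toℕ k) (t * toℕ k) (sym fixed-power) X))
              (trans (V-power (toℕ k) v t) (sym v)))

        ℓ∣n : ℓ ∣ n
        ℓ∣n = [ (λ p → p) , (λ p → p) ]′ (euclidsLemma n n pr (subst (ℓ ∣_) (sym n²≡)
          (prime-orbits-∣-sum pr τ (λ k → e (toℕ k)) e-τ (λ k _ → τ-period k) τ-moves)))

      PrimeStep : G → G → Set
      PrimeStep a b = ∃ λ ℓ → Prime ℓ × ℓ ∣ m × ∃ λ i → ¬ Commute (pow b i) a × Commute (pow (pow b i) ℓ) a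

      -- Induction on an exponent `D` that kills `b`, with `D ∣ m` maintained so that the prime
      -- found divides `m`. For a prime ℓ dividing `D`, either b ^ ℓ commutes with `a` and the
      -- search ends, or b ^ ℓ with exponent D / ℓ takes the place of `b`.
      prime-power-step : ∀ {a} D → D ∣ m → ∀ b → pow b D ≡ ε → ¬ Commute b a → PrimeStep a b
      prime-power-step {a} = <-rec Goal go
        where
        Goal : ℕ → Set
        Goal D = D ∣ m → ∀ b → pow b D ≡ ε → ¬ Commute b a → PrimeStep a b
        go : ∀ D → (∀ {D′} → D′ < D → Goal D′) → Goal D
        go D rec D∣m b bD ¬c = case (1 <? D)
          where
          0<m : 0 < m
          0<m = s<s⁻¹ (subst (1 <_) (sym m-eq) (<-≤-trans 1<q (subst (_≤ q ^ n) (^-identityʳ q)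
            (^-monoʳ-≤ q {{>-nonZero (<-trans z<s 1<q)}} 0<n))))
          0<D : 0 < D
          0<D = n≢0⇒n>0 λ { refl → <⇒≢ 0<m (sym (0∣⇒≡0 D∣m)) }
          case : Dec (1 < D) → PrimeStep a b
          case (no D≯1) = contradiction (subst (λ x → Commute x a) (sym b≡ε) (trans (·-identityˡ a) (sym (·-identityʳ a)))) ¬c
            where
            b≡ε : b ≡ ε
            b≡ε = trans (sym (pow-1 b)) (trans (cong (pow b) (sym (≤-antisym (≮⇒≥ D≯1) 0<D))) bD)
          case (yes 1<D) = descend (prime-divisor 1<D)
            where
            descend : (∃ λ ℓ → Prime ℓ × ℓ ∣ D) → PrimeStep a b
            descend (ℓ , pr , ℓ∣D@(divides D′ D≡)) = choose (commute? (pow b ℓ) a)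
              where
              D′<D : D′ < D
              D′<D = subst (D′ <_) (sym D≡) (m<m*n D′ ℓ {{>-nonZero (n≢0⇒n>0 λ { refl → <⇒≢ 0<D (sym D≡) })}} (prime⇒>1 pr))
              choose : Dec (Commute (pow b ℓ) a) → PrimeStep a b
              choose (yes c) = ℓ , pr , ∣-trans ℓ∣D D∣m , 1 , (λ c′ → ¬c (subst (λ x → Commute x a) (pow-1 b) c′)) ,
                subst (λ x → Commute (pow x ℓ) a) (sym (pow-1 b)) c
              choose (no ¬cℓ) with ℓ′ , pr′ , ℓ′∣m , i , ni , ci ← rec D′<D (∣-trans (divides ℓ (trans D≡ (*-comm D′ ℓ))) D∣m)
                                     (pow b ℓ) (trans (sym (pow-* b D′ ℓ)) (trans (cong (pow b) (sym D≡)) bD)) ¬cℓ =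
                ℓ′ , pr′ , ℓ′∣m , i * ℓ , subst (λ x → ¬ Commute x a) (sym (pow-* b i ℓ)) ni ,
                subst (λ x → Commute (pow x ℓ′) a) (sym (pow-* b i ℓ)) ci

      -- The conjugate of `a` commutes with `a` and is killed by the order of `a`, so it is a power
      -- of `a`; hence all powers of `b` normalize the cyclic group of `a`. If `b` did not
      -- centralize it, some power of `b` would form a `BadPair` with `a`, and a prime would divide
      -- both `n` and `m`.
      rigid : ∀ a b → Commute a (conj b a) → Commute b a
      rigid a b c = decidable-stable (commute? b a) λ ¬c → bad (prime-power-step m ∣-refl b (Order.pow-N (order-exists b)) ¬c)
        where
        O : Order a
        O = order-exists a
        open Order O
        s : ∃ λ s → conj b a ≡ pow a s
        s = commuting⇒power O (conj b a) c (trans (sym (conj-pow b a order)) (trans (cong (conj b) pow-order)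
          (Commute⇒conj-fixed (trans (·-identityʳ b) (sym (·-identityˡ b))))))
        conj-power : ∀ i → ∃ λ t → conj (pow b i) a ≡ pow a t
        conj-power zero = 1 , trans (conj-ε a) (sym (pow-1 a))
        conj-power (suc i) = proj₁ (conj-power i) * proj₁ s , (begin
          conj (b · pow b i) a                        ≡⟨ conj-conj b (pow b i) a ⟨
          conj b (conj (pow b i) a)                   ≡⟨ cong (conj b) (proj₂ (conj-power i)) ⟩
          conj b (pow a (proj₁ (conj-power i)))       ≡⟨ conj-pow b a (proj₁ (conj-power i)) ⟩
          pow (conj b a) (proj₁ (conj-power i))       ≡⟨ cong (λ x → pow x (proj₁ (conj-power i))) (proj₂ s) ⟩
          pow (pow a (proj₁ s)) (proj₁ (conj-power i)) ≡⟨ pow-* a (proj₁ (conj-power i)) (proj₁ s) ⟨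
          pow a (proj₁ (conj-power i) * proj₁ s)      ∎)
          where open ≡-Reasoning
        bad : PrimeStep a b → ⊥
        bad (ℓ , pr , ℓ∣m , i , ¬ci , cℓ) =
          coprime ℓ pr (BadPair.ℓ∣n O {t = proj₁ (conj-power i)} pr (proj₂ (conj-power i)) ¬ci cℓ) ℓ∣m

      commutative : ∀ x y → x · y ≡ y · x
      commutative = rigid⇒commutative rigid

    -- Multiplication distributes over sums in its right argument only; hence `𝟎-∙` has to be an
    -- axiom.
    record Nearfield : Set where
      infixr 7 _∙_
      field
        _∙_       : Vector → Vector → Vector
        one       : Vector
        ∙-linear  : ∀ y → IsLinear W W (y ∙_)
        ∙-assoc   : ∀ x y z → (x ∙ y) ∙ z ≡ x ∙ (y ∙ z)
        one-∙     : ∀ x → one ∙ x ≡ x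
        ∙-one     : ∀ x → x ∙ one ≡ x
        𝟎-∙       : ∀ x → 𝟎 ∙ x ≡ 𝟎
        one≢𝟎     : one ≢ 𝟎
        right-inv : ∀ x → x ≢ 𝟎 → ∃ λ y → x ∙ y ≡ one

      ∙-𝟎 : ∀ x → x ∙ 𝟎 ≡ 𝟎
      ∙-𝟎 x = map-𝟎 (∙-linear x)

      inverse-≢𝟎 : ∀ {x y} → x ∙ y ≡ one → y ≢ 𝟎
      inverse-≢𝟎 {x} e refl = one≢𝟎 (trans (sym e) (∙-𝟎 x))

      left-inv : ∀ {x y} → x ∙ y ≡ one → y ∙ x ≡ one
      left-inv {x} {y} e with z , e′ ← right-inv y (inverse-≢𝟎 e) =
        trans (cong (y ∙_) (trans (sym (∙-one x)) (trans (cong (x ∙_) (sym e′))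
          (trans (sym (∙-assoc x y z)) (trans (cong (_∙ z) e) (one-∙ z)))))) e′

      no-zero-divisors : ∀ {x y} → x ≢ 𝟎 → x ∙ y ≡ 𝟎 → y ≡ 𝟎
      no-zero-divisors {x} {y} x≢𝟎 e with z , xz ← right-inv x x≢𝟎 =
        trans (sym (one-∙ y)) (trans (cong (_∙ y) (sym (left-inv xz)))
          (trans (∙-assoc z x y) (trans (cong (z ∙_) e) (∙-𝟎 z))))

      fixes-nonzero⇒one : ∀ {x w} → w ≢ 𝟎 → x ∙ w ≡ w → x ≡ one
      fixes-nonzero⇒one {x} {w} w≢𝟎 e with z , wz ← right-inv w w≢𝟎 =
        trans (sym (∙-one x)) (trans (cong (x ∙_) (sym wz)) (trans (sym (∙-assoc x w z)) (trans (cong (_∙ z) e) wz)))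

    module UnitGroup (0<n : 0 < n) {m : ℕ} (m-eq : suc m ≡ q ^ n)
      (coprime : ∀ ℓ → Prime ℓ → ℓ ∣ n → ¬ ℓ ∣ m) (K : Nearfield) where
      open Nearfield K

      private
        I₊ : Fin (suc m) ↔ Vector
        I₊ = subst (λ s → Fin s ↔ Vector) (sym m-eq) (vec-finite ord n)

      open Punctured I₊ 𝟎 renaming (Other to G; Other-≡ to G-≡)

      _·_ : G → G → G
      x · y = (val x ∙ val y) , λ e → ≢-val y (no-zero-divisors (≢-val x) e)

      ε : G
      ε = one , one≢𝟎

      _⁻¹ : G → G
      x ⁻¹ = proj₁ (right-inv (val x) (≢-val x)) , inverse-≢𝟎 (proj₂ (right-inv (val x) (≢-val x)))

      isGroup-G : IsGroup _≡_ _·_ ε _⁻¹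
      isGroup-G = record
        { isMonoid = record
          { isSemigroup = record
            { isMagma = record { isEquivalence = isEquivalence ; ∙-cong = cong₂ _·_ }
            ; assoc = λ x y z → G-≡ (∙-assoc (val x) (val y) (val z)) }
          ; identity = (λ x → G-≡ (one-∙ (val x))) , (λ x → G-≡ (∙-one (val x))) }
        ; inverse = (λ x → G-≡ (left-inv (proj₂ (right-inv (val x) (≢-val x)))))
                  , (λ x → G-≡ (proj₂ (right-inv (val x) (≢-val x))))
        ; ⁻¹-cong = cong _⁻¹ }

      nearfield-commutative : ∀ x y → x ∙ y ≡ y ∙ x
      nearfield-commutative x y = decide (finite-≟ I₊ x 𝟎) (finite-≟ I₊ y 𝟎)
        where
        module A = FreeAction 0<n m-eq coprime isGroup-G punctured-finite (λ x → val x ∙_) (λ x → ∙-linear (val x))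
          (λ x y → ∙-assoc (val x) (val y)) one-∙ (λ w≢𝟎 e → G-≡ (fixes-nonzero⇒one w≢𝟎 e))
        decide : Dec (x ≡ 𝟎) → Dec (y ≡ 𝟎) → x ∙ y ≡ y ∙ x
        decide (yes refl) _ = trans (𝟎-∙ y) (sym (∙-𝟎 y))
        decide (no _) (yes refl) = trans (∙-𝟎 x) (sym (𝟎-∙ x))
        decide (no x≢𝟎) (no y≢𝟎) = cong val (A.commutative (x , x≢𝟎) (y , y≢𝟎))

-- Spreads with normal elements in general position

module Coordinates {F : Field} {q : ℕ} (ord : HasOrder F q) (n r : ℕ) where
  open LinearAlgebra F
  open IsLinear
  open Space (W ord n)

  Config : Set
  Config = Fin r → Vector

  _≟ʷ_ : (x y : Vector) → Dec (x ≡ y)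
  _≟ʷ_ = finite-≟ (vec-finite ord n)

  Zero Nonzero : Config → Set
  Zero c = ∀ j → c j ≡ 𝟎
  Nonzero c = ∃ λ j → c j ≢ 𝟎

  zero? : ∀ c → Dec (Zero c)
  zero? c = Fin.all? (λ j → c j ≟ʷ 𝟎)

  ¬Zero⇒Nonzero : ∀ {c} → ¬ Zero c → Nonzero c
  ¬Zero⇒Nonzero {c} = Fin.¬∀⟶∃¬ r (λ j → c j ≡ 𝟎) (λ j → c j ≟ʷ 𝟎)

  Nonzero⇒¬Zero : ∀ {c} → Nonzero c → ¬ Zero c
  Nonzero⇒¬Zero (j , ne) z = ne (z j)

  _⊞ᶜ_ : Config → Config → Config
  (c ⊞ᶜ c′) j = c j ⊞ c′ j

  _•ᶜ_ : 𝔽 → Config → Config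
  (a •ᶜ c) j = a • c j

  -- A spread with r normal elements in general position, seen in the coordinates in which these are the axes.
  record NormalSpread : Set₁ where
    field
      Idx      : Set
      Mem      : Idx → Config → Set
      Mem-cong : ∀ {i c c′} → c ≗ c′ → Mem i c → Mem i c′
      Mem-⊞    : ∀ {i c c′} → Mem i c → Mem i c′ → Mem i (c ⊞ᶜ c′)
      Mem-•    : ∀ {i} a {c} → Mem i c → Mem i (a •ᶜ c)
      cover    : ∀ c → Nonzero c → ∃ λ i → Mem i c
      disjoint : ∀ {c i j} → Nonzero c → Mem i c → Mem j c → i ≡ j
      point    : Idx → Vector → Config
      point-⊞  : ∀ i x y → point i (x ⊞ y) ≗ point i x ⊞ᶜ point i y
      point-•  : ∀ i a x → point i (a • x) ≗ a •ᶜ point i x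
      point-0  : ∀ i x → Zero (point i x) → x ≡ 𝟎
      point-in : ∀ i x → Mem i (point i x)
      axis     : Fin r → Idx
      axis-mem : ∀ j {c} → (∀ k → k ≢ j → c k ≡ 𝟎) → Mem (axis j) c
      mem-axis : ∀ j {c} → Mem (axis j) c → ∀ k → k ≢ j → c k ≡ 𝟎
      normal   : ∀ j {f g u v w} → f ≢ axis j → Mem (axis j) u → Mem f v → Nonzero (u ⊞ᶜ v) →
                 Mem g (u ⊞ᶜ v) → Mem g w → ∃ λ u′ → ∃ λ v′ → Mem (axis j) u′ × Mem f v′ × w ≗ u′ ⊞ᶜ v′

  module _ (𝒮 : NormalSpread) where
    open NormalSpread 𝒮

    Mem-Zero : ∀ {i c} → Zero c → Mem i c
    Mem-Zero {i} {c} z = Mem-cong (λ j → trans (0-• _) (sym (z j))) (Mem-• 0ᶠ (point-in i 𝟎))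

    zeroAt : Fin r → Config → Config
    zeroAt k c l = if does (l Fin.≟ k) then 𝟎 else c l

    zeroAt-same : ∀ {k c l} → l ≡ k → zeroAt k c l ≡ 𝟎
    zeroAt-same {k} {c} {l} e rewrite dec-true (l Fin.≟ k) e = refl

    zeroAt-other : ∀ {k c l} → l ≢ k → zeroAt k c l ≡ c l
    zeroAt-other {k} {c} {l} ne rewrite dec-false (l Fin.≟ k) ne = refl

    onlyAt : Fin r → Config → Config
    onlyAt k c l = if does (l Fin.≟ k) then c l else 𝟎

    onlyAt-other : ∀ {k c l} → l ≢ k → onlyAt k c l ≡ 𝟎
    onlyAt-other {k} {c} {l} ne rewrite dec-false (l Fin.≟ k) ne = refl

    split : ∀ k c → onlyAt k c ⊞ᶜ zeroAt k c ≗ c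
    split k c l with l Fin.≟ k
    ... | yes _ = identityʳ (c l)
    ... | no _ = identityˡ (c l)

    onlyAt-axis : ∀ k c → Mem (axis k) (onlyAt k c)
    onlyAt-axis k c = axis-mem k (λ l → onlyAt-other {c = c})

    -- `v` is the sum of a point of the axis `k` and of `zeroAt k v`. By normality its element `g`
    -- therefore lies in the span of that axis and of the element through `zeroAt k v`, and the axis
    -- contributes to coordinate `k` alone.
    project : ∀ k {v w g} → Nonzero v → Mem g v → Mem g w → (nz : Nonzero (zeroAt k v)) →
      ∃ λ v′ → Mem (proj₁ (cover (zeroAt k v) nz)) v′ × (∀ l → l ≢ k → w l ≡ v′ l)
    project k {v} {w} {g} nv gv gw nz@(l , ne) = finish (normal k f≢axis (onlyAt-axis k v) (proj₂ (cover (zeroAt k v) nz))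
        (proj₁ nv , λ e → proj₂ nv (trans (sym (split k v (proj₁ nv))) e)) (Mem-cong (λ l → sym (split k v l)) gv) gw)
      where
      f : Idx
      f = proj₁ (cover (zeroAt k v) nz)
      l≢k : l ≢ k
      l≢k e = ne (zeroAt-same {c = v} e)
      f≢axis : f ≢ axis k
      f≢axis e = ne (mem-axis k (subst (λ i → Mem i (zeroAt k v)) e (proj₂ (cover (zeroAt k v) nz))) l l≢k)
      finish : (∃ λ u′ → ∃ λ v′ → Mem (axis k) u′ × Mem f v′ × w ≗ u′ ⊞ᶜ v′) → ∃ λ v′ → Mem f v′ × (∀ l → l ≢ k → w l ≡ v′ l)
      finish (u′ , v′ , Mu , Mv , eq) = v′ , Mv , λ l l≢k → trans (eq l) (trans (cong (_⊞ v′ l) (mem-axis k Mu l l≢k)) (identityˡ _))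

    -- Induction on a bound `m` beyond which the coordinates of `v` vanish. The last coordinate, if
    -- it is not the `j`-th, is removed by `project`, which changes neither `v j` nor `w j`, until
    -- `v` lies on an axis other than the `j`-th, where `mem-axis` applies.
    support : ∀ {j v w g} → Nonzero v → v j ≡ 𝟎 → Mem g v → Mem g w → w j ≡ 𝟎
    support {j} = go r (λ k r≤k → contradiction r≤k (<⇒≱ (Fin.toℕ<n k)))
      where
      go : ∀ m {v w g} → (∀ k → m ≤ toℕ k → v k ≡ 𝟎) → Nonzero v → v j ≡ 𝟎 → Mem g v → Mem g w → w j ≡ 𝟎
      go zero z (k , ne) _ _ _ = contradiction (z k z≤n) ne
      go (suc m) {v} {w} {g} z nv vj gv gw = byBound (m <? r)
        where
        byBound : Dec (m < r) → w j ≡ 𝟎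
        byBound (no m≮r) = go m (λ k m≤k → contradiction (≤-trans (≮⇒≥ m≮r) m≤k) (<⇒≱ (Fin.toℕ<n k))) nv vj gv gw
        byBound (yes m<r) = byIndex (j Fin.≟ k)
          where
          k : Fin r
          k = fromℕ< m<r
          beyond : ∀ l → l ≢ k → m ≤ toℕ l → v l ≡ 𝟎
          beyond l l≢k m≤l = z l (≤∧≢⇒< m≤l (λ e → l≢k (Fin.toℕ-injective (trans (sym e) (sym (Fin.toℕ-fromℕ< m<r))))))
          byIndex : Dec (j ≡ k) → w j ≡ 𝟎
          byIndex (yes j≡k) = go m below nv vj gv gw
            where
            below : ∀ l → m ≤ toℕ l → v l ≡ 𝟎
            below l m≤l with l Fin.≟ k
            ... | yes l≡k = trans (cong v (trans l≡k (sym j≡k))) vj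
            ... | no l≢k = beyond l l≢k m≤l
          byIndex (no j≢k) = byZero (zero? (zeroAt k v))
            where
            byZero : Dec (Zero (zeroAt k v)) → w j ≡ 𝟎
            byZero (yes zv) = mem-axis k (subst (λ i → Mem i w) (disjoint nv gv (axis-mem k
              (λ l l≢k → trans (sym (zeroAt-other {c = v} l≢k)) (zv l)))) gw) j j≢k
            byZero (no ¬zv) = useProject (project k nv gv gw nz)
              where
              nz : Nonzero (zeroAt k v)
              nz = ¬Zero⇒Nonzero ¬zv
              below : ∀ l → m ≤ toℕ l → zeroAt k v l ≡ 𝟎
              below l m≤l with l Fin.≟ k
              ... | yes _ = refl
              ... | no l≢k = beyond l l≢k m≤l
              useProject : (∃ λ v′ → Mem (proj₁ (cover (zeroAt k v) nz)) v′ × (∀ l → l ≢ k → w l ≡ v′ l)) → w j ≡ 𝟎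
              useProject (v′ , Mv′ , eq) = trans (eq j j≢k)
                (go m below nz (trans (zeroAt-other {c = v} j≢k) vj) (proj₂ (cover (zeroAt k v) nz)) Mv′)

    Together : Config → Config → Set
    Together v w = ∃ λ i → Mem i v × Mem i w

    Together-cong : ∀ {v w v′ w′} → v ≗ v′ → w ≗ w′ → Together v w → Together v′ w′
    Together-cong ev ew (i , a , b) = i , Mem-cong ev a , Mem-cong ew b

    -- `project` leaves the `k`-th coordinate of the new point open. It is 0 by `support`, because
    -- it is 0 at `zeroAt k v`.
    Together-zeroAt : ∀ k {v w} → Together v w → Together (zeroAt k v) (zeroAt k w)
    Together-zeroAt k {v} {w} (g , gv , gw) = byZero (zero? (zeroAt k v)) (zero? (zeroAt k w))
      where
      byZero : Dec (Zero (zeroAt k v)) → Dec (Zero (zeroAt k w)) → Together (zeroAt k v) (zeroAt k w)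
      byZero (yes zv) (yes zw) = g , Mem-Zero zv , Mem-Zero zw
      byZero (yes zv) (no ¬zw) = let i , iw = cover _ (¬Zero⇒Nonzero ¬zw) in i , Mem-Zero zv , iw
      byZero (no ¬zv) _ = useProject (project k nv gv gw nz)
        where
        nz : Nonzero (zeroAt k v)
        nz = ¬Zero⇒Nonzero ¬zv
        nv : Nonzero v
        nv = ¬Zero⇒Nonzero (λ z → ¬zv (λ l → zeroAt-Zero z l))
          where
          zeroAt-Zero : Zero v → Zero (zeroAt k v)
          zeroAt-Zero z l with l Fin.≟ k
          ... | yes _ = refl
          ... | no _ = z l
        f : Idx
        f = proj₁ (cover (zeroAt k v) nz)
        f-v : Mem f (zeroAt k v)
        f-v = proj₂ (cover (zeroAt k v) nz)
        useProject : (∃ λ v′ → Mem f v′ × (∀ l → l ≢ k → w l ≡ v′ l)) → Together (zeroAt k v) (zeroAt k w)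
        useProject (v′ , Mv′ , eq) = f , f-v , Mem-cong same Mv′
          where
          same : v′ ≗ zeroAt k w
          same l with l Fin.≟ k
          ... | yes refl = support nz (zeroAt-same {c = v} refl) f-v Mv′
          ... | no l≢k = sym (eq l l≢k)

    mask : (Fin r → Bool) → Config → Config
    mask J c k = if J k then c k else 𝟎

    Together-mask : ∀ J {v w} → Together v w → Together (mask J v) (mask J w)
    Together-mask J {v} {w} t = go r J (λ k r≤k → contradiction r≤k (<⇒≱ (Fin.toℕ<n k)))
      where
      go : ∀ m J → (∀ k → m ≤ toℕ k → J k ≡ true) → Together (mask J v) (mask J w)
      go zero J all = Together-cong (keep v) (keep w) t
        where
        keep : ∀ c → c ≗ mask J c
        keep c k rewrite all k z≤n = refl
      go (suc m) J above = byBound (m <? r)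
        where
        byBound : Dec (m < r) → Together (mask J v) (mask J w)
        byBound (no m≮r) = go m J (λ k m≤k → contradiction (≤-trans (≮⇒≥ m≮r) m≤k) (<⇒≱ (Fin.toℕ<n k)))
        byBound (yes m<r) = byValue (J k) refl
          where
          k : Fin r
          k = fromℕ< m<r
          beyond : ∀ l → l ≢ k → m ≤ toℕ l → J l ≡ true
          beyond l l≢k m≤l = above l (≤∧≢⇒< m≤l (λ e → l≢k (Fin.toℕ-injective (trans (sym e) (sym (Fin.toℕ-fromℕ< m<r))))))
          J′ : Fin r → Bool
          J′ l = if does (l Fin.≟ k) then true else J l
          byValue : ∀ b → J k ≡ b → Together (mask J v) (mask J w)
          byValue true Jk = go m J here
            where
            here : ∀ l → m ≤ toℕ l → J l ≡ true
            here l m≤l with l Fin.≟ k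
            ... | yes refl = Jk
            ... | no l≢k = beyond l l≢k m≤l
          byValue false Jk = Together-cong (remask v) (remask w) (Together-zeroAt k (go m J′ here))
            where
            here : ∀ l → m ≤ toℕ l → J′ l ≡ true
            here l m≤l with l Fin.≟ k
            ... | yes _ = refl
            ... | no l≢k = beyond l l≢k m≤l
            remask : ∀ c → zeroAt k (mask J′ c) ≗ mask J c
            remask c l with l Fin.≟ k
            ... | yes refl rewrite Jk = refl
            ... | no _ = refl

    -- The difference of the two points lies in the element and vanishes at `j`. Were it nonzero,
    -- `support` would force `c j` to vanish as well.
    determined : ∀ {i c c′ c″ j} → Mem i c → c j ≢ 𝟎 → Mem i c′ → Mem i c″ → c′ j ≡ c″ j → c′ ≗ c″
    determined {i} {c} {c′} {c″} {j} ic ne ic′ ic″ e = agree (zero? d)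
      where
      d : Config
      d = c′ ⊞ᶜ ((-ᶠ 1ᶠ) •ᶜ c″)
      d-def : ∀ k → d k ≡ c′ k ⊞ ⊟ c″ k
      d-def k = cong (c′ k ⊞_) (-1-• (c″ k))
      agree : Dec (Zero d) → c′ ≗ c″
      agree (yes z) k = ∙-cancelʳ (⊟ c″ k) _ _ (trans (sym (d-def k)) (trans (z k) (sym (inverseʳ (c″ k)))))
      agree (no ¬z) = contradiction (support (¬Zero⇒Nonzero ¬z)
        (trans (d-def j) (trans (cong (_⊞ ⊟ c″ j) e) (inverseʳ (c″ j)))) (Mem-⊞ ic′ (Mem-• _ ic″)) ic) ne

    coordinate-linear : ∀ i j → IsLinear (W ord n) (W ord n) (λ x → point i x j)
    coordinate-linear i j = record { additive = λ x y → point-⊞ i x y j ; homogeneous = λ a x → point-• i a x j }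

    -- A nonzero point with vanishing `j`-th coordinate would, by `support`, make the whole element
    -- vanish there.
    coordinate-injective : ∀ {i c j} → Mem i c → c j ≢ 𝟎 → ∀ {x y} → point i x j ≡ point i y j → x ≡ y
    coordinate-injective {i} {c} {j} ic ne = trivial-kernel⇒injective (coordinate-linear i j) λ x e →
      decidable-stable (x ≟ʷ 𝟎) λ x≢𝟎 → ne (support (¬Zero⇒Nonzero (λ z → x≢𝟎 (point-0 i x z))) e (point-in i x) ic)

    coordinate-surjective : ∀ {i c j} → Mem i c → c j ≢ 𝟎 → ∀ y → ∃ λ x → point i x j ≡ y
    coordinate-surjective {i} {c} {j} ic ne =
      injective⇒surjective (vec-finite ord n) (λ x → point i x j) (coordinate-injective ic ne)

  -- Rescaling the axes by the coordinates of a given spread element turns it into the diagonal.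
  record DiagonalSpread : Set₁ where
    field
      normalSpread : NormalSpread
    open NormalSpread normalSpread public
    field
      diagonal     : Idx
      diagonal-mem : ∀ x → Mem diagonal (λ _ → x)

  module _ (𝒮 : NormalSpread) where
    open NormalSpread 𝒮

    -- Every coordinate of (u, ..., u) is nonzero, so each coordinate maps the element `d`
    -- bijectively onto `W`. Taking these bijections as the scales makes `point d x` the image of
    -- the constant configuration `x`.
    module Rescale {u : Vector} (u≢𝟎 : u ≢ 𝟎)
      {d : Idx} (d-mem : Mem d (λ _ → u)) where

      scale : Fin r → Vector → Vector
      scale j x = point d x j

      scale-linear′ : ∀ j → IsLinear (W ord n) (W ord n) (scale j)
      scale-linear′ j = coordinate-linear 𝒮 d j

      scale-injective : ∀ j {x y} → scale j x ≡ scale j y → x ≡ y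
      scale-injective j = coordinate-injective 𝒮 {j = j} d-mem u≢𝟎

      unscale : Fin r → Vector → Vector
      unscale j y = proj₁ (coordinate-surjective 𝒮 {j = j} d-mem u≢𝟎 y)

      scale-unscale : ∀ j y → scale j (unscale j y) ≡ y
      scale-unscale j y = proj₂ (coordinate-surjective 𝒮 {j = j} d-mem u≢𝟎 y)

      scaleᶜ unscaleᶜ : Config → Config
      scaleᶜ c j = scale j (c j)
      unscaleᶜ c j = unscale j (c j)

      scale-𝟎 : ∀ {j x} → x ≡ 𝟎 → scale j x ≡ 𝟎
      scale-𝟎 {j} e = trans (cong (scale j) e) (map-𝟎 (scale-linear′ j))

      scale-𝟎⁻ : ∀ {j x} → scale j x ≡ 𝟎 → x ≡ 𝟎
      scale-𝟎⁻ {j} e = scale-injective j (trans e (sym (map-𝟎 (scale-linear′ j))))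

      unscale-𝟎⁻ : ∀ {j y} → unscale j y ≡ 𝟎 → y ≡ 𝟎
      unscale-𝟎⁻ {j} {y} e = trans (sym (scale-unscale j y)) (scale-𝟎 e)

      scaleᶜ-Nonzero : ∀ {c} → Nonzero c → Nonzero (scaleᶜ c)
      scaleᶜ-Nonzero (j , ne) = j , ne ∘ scale-𝟎⁻

      scaleᶜ-⊞ : ∀ c c′ → scaleᶜ (c ⊞ᶜ c′) ≗ scaleᶜ c ⊞ᶜ scaleᶜ c′
      scaleᶜ-⊞ c c′ j = additive (scale-linear′ j) (c j) (c′ j)

      rescaled : NormalSpread
      rescaled = record
        { Idx = Idx
        ; Mem = λ i c → Mem i (scaleᶜ c)
        ; Mem-cong = λ e → Mem-cong (λ j → cong (scale j) (e j))
        ; Mem-⊞ = λ {i} {c} {c′} m m′ → Mem-cong (λ j → sym (scaleᶜ-⊞ c c′ j)) (Mem-⊞ m m′)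
        ; Mem-• = λ a {c} m → Mem-cong (λ j → sym (homogeneous (scale-linear′ j) a (c j))) (Mem-• a m)
        ; cover = λ c nz → cover (scaleᶜ c) (scaleᶜ-Nonzero nz)
        ; disjoint = λ nz → disjoint (scaleᶜ-Nonzero nz)
        ; point = λ i x → unscaleᶜ (point i x)
        ; point-⊞ = λ i x y j → scale-injective j (trans (scale-unscale j _) (trans (point-⊞ i x y j)
            (sym (trans (additive (scale-linear′ j) _ _) (cong₂ _⊞_ (scale-unscale j _) (scale-unscale j _))))))
        ; point-• = λ i a x j → scale-injective j (trans (scale-unscale j _) (trans (point-• i a x j)
            (sym (trans (homogeneous (scale-linear′ j) a _) (cong (a •_) (scale-unscale j _))))))
        ; point-0 = λ i x z → point-0 i x (λ j → unscale-𝟎⁻ (z j))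
        ; point-in = λ i x → Mem-cong (λ j → sym (scale-unscale j _)) (point-in i x)
        ; axis = axis
        ; axis-mem = λ j z → axis-mem j (λ k k≢j → scale-𝟎 (z k k≢j))
        ; mem-axis = λ j m k k≢j → scale-𝟎⁻ (mem-axis j m k k≢j)
        ; normal = λ j {f} {g} {u} {v} {w} f≢ mu mv nz mg mw →
            pullback (normal j f≢ mu mv (nonzero u v nz) (Mem-cong (scaleᶜ-⊞ u v) mg) mw)
        }
        where
        nonzero : ∀ u v → Nonzero (u ⊞ᶜ v) → Nonzero (scaleᶜ u ⊞ᶜ scaleᶜ v)
        nonzero u v (j , ne) = j , λ e → ne (scale-𝟎⁻ (trans (scaleᶜ-⊞ u v j) e))
        pullback : ∀ {j f w} → (∃ λ u′ → ∃ λ v′ → Mem (axis j) u′ × Mem f v′ × scaleᶜ w ≗ u′ ⊞ᶜ v′) →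
          ∃ λ u′ → ∃ λ v′ → Mem (axis j) (scaleᶜ u′) × Mem f (scaleᶜ v′) × w ≗ u′ ⊞ᶜ v′
        pullback (u′ , v′ , mu′ , mv′ , e) = unscaleᶜ u′ , unscaleᶜ v′ ,
          Mem-cong (λ j → sym (scale-unscale j _)) mu′ , Mem-cong (λ j → sym (scale-unscale j _)) mv′ ,
          λ j → scale-injective j (trans (e j) (sym (trans (additive (scale-linear′ j) _ _)
            (cong₂ _⊞_ (scale-unscale j _) (scale-unscale j _)))))

      diagonalSpread : DiagonalSpread
      diagonalSpread = record { normalSpread = rescaled ; diagonal = d ; diagonal-mem = λ x → point-in d x }

  -- The spreads induced on the lines through two axes

  module Pairs (𝒟 : DiagonalSpread) where
    open DiagonalSpread 𝒟

    pair : Fin r → Vector → Fin r → Vector → Config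
    pair j x k y l = if does (l Fin.≟ j) then x else (if does (l Fin.≟ k) then y else 𝟎)

    pair-1 : ∀ {j x k y} → pair j x k y j ≡ x
    pair-1 {j} rewrite dec-true (j Fin.≟ j) refl = refl

    pair-2 : ∀ {j x k y} → j ≢ k → pair j x k y k ≡ y
    pair-2 {j} {x} {k} j≢k rewrite dec-false (k Fin.≟ j) (j≢k ∘ sym) | dec-true (k Fin.≟ k) refl = refl

    pair-other : ∀ {j x k y l} → l ≢ j → l ≢ k → pair j x k y l ≡ 𝟎
    pair-other {j} {x} {k} {y} {l} l≢j l≢k rewrite dec-false (l Fin.≟ j) l≢j | dec-false (l Fin.≟ k) l≢k = refl

    pair-ext : ∀ {j x k y c} → c j ≡ x → c k ≡ y → (∀ l → l ≢ j → l ≢ k → c l ≡ 𝟎) → pair j x k y ≗ c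
    pair-ext {j} {x} {k} {y} {c} ej ek z l with l Fin.≟ j
    ... | yes refl = sym ej
    ... | no l≢j with l Fin.≟ k
    ...   | yes refl = sym ek
    ...   | no l≢k = sym (z l l≢j l≢k)

    -- On the line ⟨E j, E k⟩, the points with coordinates (x, y) and (x′, y′) lie in a common spread element.
    D : Fin r → Fin r → Vector → Vector → Vector → Vector → Set
    D j k x y x′ y′ = Together normalSpread (pair j x k y) (pair j x′ k y′)

    restrict : ∀ {j k v w} → j ≢ k → Together normalSpread v w → D j k (v j) (v k) (w j) (w k)
    restrict {j} {k} {v} {w} j≢k t = Together-cong normalSpread (same v) (same w) (Together-mask normalSpread keep t)
      where
      keep : Fin r → Bool
      keep l = does (l Fin.≟ j) ∨ does (l Fin.≟ k)
      same : ∀ c → mask normalSpread keep c ≗ pair j (c j) k (c k)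
      same c l with l Fin.≟ j | l Fin.≟ k
      ... | yes refl | _ = refl
      ... | no _ | yes refl = refl
      ... | no _ | no _ = refl

    pair-Nonzero : ∀ {j k x y} → x ≢ 𝟎 → Nonzero (pair j x k y)
    pair-Nonzero {j} {k} {x} {y} x≢𝟎 = j , λ e → x≢𝟎 (trans (sym (pair-1 {j} {x} {k} {y})) e)

    swap : ∀ {j k x y x′ y′} → j ≢ k → D j k x y x′ y′ → D k j y x y′ x′
    swap {j} {k} j≢k = Together-cong normalSpread (flip _ _) (flip _ _)
      where
      flip : ∀ x y → pair j x k y ≗ pair k y j x
      flip x y l = sym (pair-ext {k} {y} {j} {x} {pair j x k y} (pair-2 j≢k) (pair-1 {j} {x} {k} {y}) (λ l l≢k l≢j → pair-other l≢j l≢k) l)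

    module _ {j k : Fin r} {x y : Vector} (x≢𝟎 : x ≢ 𝟎) where

      same-element : ∀ {x′ y′ x″ y″} → D j k x y x′ y′ → D j k x y x″ y″ →
        ∃ λ i → Mem i (pair j x k y) × Mem i (pair j x′ k y′) × Mem i (pair j x″ k y″)
      same-element {x′} {y′} (i , m , m′) (i″ , n , m″) with refl ← disjoint (pair-Nonzero {j} {k} x≢𝟎) m n = i , m , m′ , m″

      D-unique : ∀ {x′ y′ y″} → j ≢ k → D j k x y x′ y′ → D j k x y x′ y″ → y′ ≡ y″
      D-unique {x′} {y′} {y″} j≢k t t′ = let i , m , m′ , m″ = same-element t t′ in
        trans (sym (pair-2 j≢k)) (trans (determined normalSpread {j = j} m (λ e → x≢𝟎 (trans (sym (pair-1 {j} {x} {k} {y})) e)) m′ m″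
          (trans (pair-1 {j} {x′} {k} {y′}) (sym (pair-1 {j} {x′} {k} {y″}))) k) (pair-2 j≢k))

      D-trans : ∀ {x′ y′ x″ y″} → D j k x y x′ y′ → D j k x y x″ y″ → D j k x′ y′ x″ y″
      D-trans t t′ = let i , _ , m′ , m″ = same-element t t′ in i , m′ , m″

      D-⊞ : ∀ {x′ y′ x″ y″} → j ≢ k → D j k x y x′ y′ → D j k x y x″ y″ → D j k x y (x′ ⊞ x″) (y′ ⊞ y″)
      D-⊞ {x′} {y′} {x″} {y″} j≢k t t′ = let i , m , m′ , m″ = same-element t t′ in i , m , Mem-cong
        (λ l → sym (pair-ext {j} {x′ ⊞ x″} {k} {y′ ⊞ y″} {pair j x′ k y′ ⊞ᶜ pair j x″ k y″}
          (cong₂ _⊞_ (pair-1 {j} {x′} {k} {y′}) (pair-1 {j} {x″} {k} {y″}))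
          (cong₂ _⊞_ (pair-2 j≢k) (pair-2 j≢k))
          (λ l l≢j l≢k → trans (cong₂ _⊞_ (pair-other {j} {x′} {k} {y′} l≢j l≢k) (pair-other {j} {x″} {k} {y″} l≢j l≢k)) (identityˡ 𝟎)) l)) (Mem-⊞ m′ m″)

      D-• : ∀ {x′ y′} → j ≢ k → ∀ a → D j k x y x′ y′ → D j k x y (a • x′) (a • y′)
      D-• {x′} {y′} j≢k a (i , m , m′) = i , m , Mem-cong
        (λ l → sym (pair-ext {j} {a • x′} {k} {a • y′} {a •ᶜ pair j x′ k y′}
          (cong (a •_) (pair-1 {j} {x′} {k} {y′})) (cong (a •_) (pair-2 j≢k))
          (λ l l≢j l≢k → trans (cong (a •_) (pair-other {j} {x′} {k} {y′} l≢j l≢k)) (•-𝟎 a)) l)) (Mem-• a m′)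

    D-refl : ∀ {j k x y} → x ≢ 𝟎 → D j k x y x y
    D-refl {j} {k} {x} {y} x≢𝟎 = let i , m = cover (pair j x k y) (pair-Nonzero {j} {k} x≢𝟎) in i , m , m

    D-diagonal : ∀ {j k} → j ≢ k → ∀ x x′ → D j k x x x′ x′
    D-diagonal j≢k x x′ = restrict j≢k (diagonal , diagonal-mem x , diagonal-mem x′)

    D-axis : ∀ {j k} x x′ → D j k x 𝟎 x′ 𝟎
    D-axis {j} {k} x x′ = axis j , axis-mem j (off x) , axis-mem j (off x′)
      where
      off : ∀ x l → l ≢ j → pair j x k 𝟎 l ≡ 𝟎
      off x l l≢j = byIndex (l Fin.≟ k)
        where
        byIndex : Dec (l ≡ k) → pair j x k 𝟎 l ≡ 𝟎
        byIndex (yes refl) = pair-2 (l≢j ∘ sym)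
        byIndex (no l≢k) = pair-other l≢j l≢k

    triple : Fin r → Vector → Fin r → Vector → Fin r → Vector → Config
    triple j x k y l z i = if does (i Fin.≟ j) then x else pair k y l z i

    extend : ∀ {c j} → c j ≢ 𝟎 → ∀ x → ∃ λ c′ → Together normalSpread c c′ × c′ j ≡ x
    extend {c} {j} ne x = let i , m = cover c (j , ne)
                              p , e = coordinate-surjective normalSpread m ne x
                          in point i p , (i , m , point-in i p) , e

    -- The point (x, y, z) on three axes lies in one element, which has a point with `j`-th
    -- coordinate `x′`. Restricting to the pairs j k and j l identifies its other coordinates as
    -- `y′` and `z′`; restricting to k l gives the claim.
    triangle : ∀ {j k l x y z x′ y′ z′} → j ≢ k → j ≢ l → k ≢ l → x ≢ 𝟎 →
      D j k x y x′ y′ → D j l x z x′ z′ → D k l y z y′ z′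
    triangle {j} {k} {l} {x} {y} {z} {x′} {y′} {z′} j≢k j≢l k≢l x≢𝟎 t t′ = subst₂ (D k l y z) c′k c′l
      (subst₂ (λ a b → D k l a b (c′ k) (c′ l)) ck cl (restrict k≢l tog))
      where
      c : Config
      c = triple j x k y l z
      cj : c j ≡ x
      cj rewrite dec-true (j Fin.≟ j) refl = refl
      ck : c k ≡ y
      ck rewrite dec-false (k Fin.≟ j) (j≢k ∘ sym) = pair-1 {k} {y} {l} {z}
      cl : c l ≡ z
      cl rewrite dec-false (l Fin.≟ j) (j≢l ∘ sym) = pair-2 k≢l
      ext : ∃ λ c′ → Together normalSpread c c′ × c′ j ≡ x′
      ext = extend {c} {j} (λ e → x≢𝟎 (trans (sym cj) e)) x′
      c′ : Config
      c′ = proj₁ ext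
      tog : Together normalSpread c c′
      tog = proj₁ (proj₂ ext)
      c′k : c′ k ≡ y′
      c′k = D-unique x≢𝟎 j≢k (subst₂ (λ a b → D j k a b x′ (c′ k)) cj ck
        (subst (λ a → D j k (c j) (c k) a (c′ k)) (proj₂ (proj₂ ext)) (restrict j≢k tog))) t
      c′l : c′ l ≡ z′
      c′l = D-unique x≢𝟎 j≢l (subst₂ (λ a b → D j l a b x′ (c′ l)) cj cl
        (subst (λ a → D j l (c j) (c l) a (c′ l)) (proj₂ (proj₂ ext)) (restrict j≢l tog))) t′

    -- A triangle whose side j l is the diagonal relation, which acts as the identity, transports
    -- the first axis from `j` to `l`.
    moveˡ : ∀ {j k l x y x′ y′} → j ≢ k → l ≢ k → x ≢ 𝟎 → D j k x y x′ y′ → D l k x y x′ y′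
    moveˡ {j} {k} {l} {x} {y} {x′} {y′} j≢k l≢k x≢𝟎 t = byIndex (l Fin.≟ j)
      where
      byIndex : Dec (l ≡ j) → D l k x y x′ y′
      byIndex (yes refl) = t
      byIndex (no l≢j) = swap (l≢k ∘ sym) (triangle j≢k (l≢j ∘ sym) (l≢k ∘ sym) x≢𝟎 t (D-diagonal (l≢j ∘ sym) x x′))

    -- Exchanging the axes reduces this to `moveˡ`, but then `y` is the reference coordinate and
    -- must be nonzero. For y = 0 both points lie on the axis `j`.
    moveʳ : ∀ {j k l x y x′ y′} → j ≢ k → j ≢ l → x ≢ 𝟎 → D j k x y x′ y′ → D j l x y x′ y′
    moveʳ {j} {k} {l} {x} {y} {x′} {y′} j≢k j≢l x≢𝟎 t = byZero (y ≟ʷ 𝟎)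
      where
      byZero : Dec (y ≡ 𝟎) → D j l x y x′ y′
      byZero (no y≢𝟎) = swap (j≢l ∘ sym) (moveˡ (j≢k ∘ sym) (j≢l ∘ sym) y≢𝟎 (swap j≢k t))
      byZero (yes refl) = subst (D j l x 𝟎 x′) (sym (D-unique x≢𝟎 j≢k t (D-axis x x′))) (D-axis x x′)

  -- The product is read off on the line through the axes `o` and `i`; `t` is the spare axis needed
  -- to compose two maps.
  module Multiplication (𝒟 : DiagonalSpread) {o i t : Fin r} (o≢i : o ≢ i) (o≢t : o ≢ t) (i≢t : i ≢ t)
    {one : Vector} (one≢𝟎 : one ≢ 𝟎) where
    open DiagonalSpread 𝒟
    open Pairs 𝒟

    -- `z` is the image of `x` under the linear map whose graph is the element through (one, y).
    product : ∀ y x → ∃ λ z → D o i one y x z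
    product y x = c i , subst₂ (λ a b → D o i a b x (c i)) (pair-1 {o} {one} {i} {y}) (pair-2 o≢i)
        (subst (λ a → D o i (pair o one i y o) (pair o one i y i) a (c i)) (proj₂ (proj₂ ext)) (restrict o≢i (proj₁ (proj₂ ext))))
      where
      ext : ∃ λ c → Together normalSpread (pair o one i y) c × c o ≡ x
      ext = extend (λ e → one≢𝟎 (trans (sym (pair-1 {o} {one} {i} {y})) e)) x
      c : Config
      c = proj₁ ext

    infixr 7 _∙_
    _∙_ : Vector → Vector → Vector
    y ∙ x = proj₁ (product y x)

    ∙-D : ∀ y x → D o i one y x (y ∙ x)
    ∙-D y x = proj₂ (product y x)

    ∙-unique : ∀ {y x z} → D o i one y x z → y ∙ x ≡ z
    ∙-unique {y} {x} d = D-unique one≢𝟎 o≢i (∙-D y x) d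

    ∙-D′ : ∀ y s x → D o i s (y ∙ s) x (y ∙ x)
    ∙-D′ y s x = D-trans one≢𝟎 (∙-D y s) (∙-D y x)

    ∙-linear : ∀ y → IsLinear (W ord n) (W ord n) (y ∙_)
    ∙-linear y = record
      { additive = λ v w → ∙-unique (D-⊞ one≢𝟎 o≢i (∙-D y v) (∙-D y w))
      ; homogeneous = λ a v → ∙-unique (D-• one≢𝟎 o≢i a (∙-D y v)) }

    ∙-𝟎 : ∀ y → y ∙ 𝟎 ≡ 𝟎
    ∙-𝟎 y = map-𝟎 (∙-linear y)

    𝟎-∙ : ∀ x → 𝟎 ∙ x ≡ 𝟎
    𝟎-∙ x = ∙-unique (D-axis one x)

    -- Composition of maps, and the reason for three axes: the map of `z` is read on `i` and `o`,
    -- that of `y` on `i` and `t`, and `triangle` composes them on `o` and `t`. The reference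
    -- coordinate on `i` is `z`, so z = 0 is treated apart.
    ∙-assoc : ∀ y z x → (y ∙ z) ∙ x ≡ y ∙ (z ∙ x)
    ∙-assoc y z x = byZero (z ≟ʷ 𝟎)
      where
      byZero : Dec (z ≡ 𝟎) → (y ∙ z) ∙ x ≡ y ∙ (z ∙ x)
      byZero (yes refl) = trans (cong (_∙ x) (∙-𝟎 y)) (trans (𝟎-∙ x) (sym (trans (cong (y ∙_) (𝟎-∙ x)) (∙-𝟎 y))))
      byZero (no z≢𝟎) = ∙-unique (moveʳ o≢t o≢i one≢𝟎 (triangle (o≢i ∘ sym) i≢t o≢t z≢𝟎
        (swap o≢i (∙-D z x))
        (moveˡ o≢t i≢t z≢𝟎 (moveʳ o≢i o≢t z≢𝟎 (∙-D′ y z (z ∙ x))))))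

    -- As `y` is nonzero, the element through (one, y) has a point with second coordinate `one`; its
    -- first coordinate is the inverse.
    right-inv : ∀ y → y ≢ 𝟎 → ∃ λ z → y ∙ z ≡ one
    right-inv y y≢𝟎 = c o , ∙-unique (subst₂ (λ a b → D o i a b (c o) one) (pair-1 {o} {one} {i} {y}) (pair-2 o≢i)
        (subst (D o i (pair o one i y o) (pair o one i y i) (c o)) (proj₂ (proj₂ ext)) (restrict o≢i (proj₁ (proj₂ ext)))))
      where
      ext : ∃ λ c → Together normalSpread (pair o one i y) c × c i ≡ one
      ext = extend (λ e → y≢𝟎 (trans (sym (pair-2 o≢i)) e)) one
      c : Config
      c = proj₁ ext

    nearfield : Nearfield ord n
    nearfield = record
      { _∙_ = _∙_ ; one = one ; ∙-linear = ∙-linear ; ∙-assoc = ∙-assoc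
      ; one-∙ = λ x → ∙-unique (D-diagonal o≢i one x)
      ; ∙-one = λ y → ∙-unique (D-refl one≢𝟎)
      ; 𝟎-∙ = 𝟎-∙ ; one≢𝟎 = one≢𝟎 ; right-inv = right-inv }

    module Lines (∙-comm : ∀ x y → x ∙ y ≡ y ∙ x) where
      open Nearfield nearfield using (∙-one; left-inv)

      private
        anywhere : ∀ {j k s x y z} → j ≢ k → s ≢ 𝟎 → D o i s x y z → D j k s x y z
        anywhere {j} {k} j≢k s≢𝟎 d = byIndex (j Fin.≟ i)
          where
          byIndex : Dec (j ≡ i) → D j k _ _ _ _
          byIndex (no j≢i) = moveʳ j≢i j≢k s≢𝟎 (moveˡ o≢i j≢i s≢𝟎 d)
          -- The first axis cannot move to `i` while the second is there, so the second one makes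
          -- way to `t`.
          byIndex (yes refl) = moveʳ i≢t j≢k s≢𝟎 (moveˡ o≢t i≢t s≢𝟎 (moveʳ o≢i o≢t s≢𝟎 d))

      divide : ∀ t s → s ≢ 𝟎 → ∃ λ y → y ∙ s ≡ t
      divide t s s≢𝟎 = t ∙ s′ , trans (∙-assoc t s′ s) (trans (cong (t ∙_) (left-inv e)) (∙-one t))
        where
        s′ : Vector
        s′ = proj₁ (right-inv s s≢𝟎)
        e : s ∙ s′ ≡ one
        e = proj₂ (right-inv s s≢𝟎)

      -- Here commutativity enters: with t = y ∙ s, it gives y ∙ (λ′ ∙ s) = λ′ ∙ t, so the map of
      -- `y` respects multiples.
      D-multiple : ∀ {j k s} → j ≢ k → s ≢ 𝟎 → ∀ t λ′ → D j k s t (λ′ ∙ s) (λ′ ∙ t)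
      D-multiple {j} {k} {s} j≢k s≢𝟎 t λ′ = anywhere j≢k s≢𝟎 (subst₂ (λ a b → D o i s a (λ′ ∙ s) b) ys≡t
          (trans (sym (∙-assoc y λ′ s)) (trans (cong (_∙ s) (∙-comm y λ′)) (trans (∙-assoc λ′ y s) (cong (λ′ ∙_) ys≡t))))
          (∙-D′ y s (λ′ ∙ s)))
        where
        y : Vector
        y = proj₁ (divide t s s≢𝟎)
        ys≡t : y ∙ s ≡ t
        ys≡t = proj₂ (divide t s s≢𝟎)

      _⊙_ : Vector → Config → Config
      (λ′ ⊙ w) j = λ′ ∙ w j

      -- The point of `g` with `j`-th coordinate `λ′ ∙ w j` is the multiple: `D-unique` forces its
      -- other coordinates to be those in `D-multiple`.
      multiple-mem : ∀ {g w} → Nonzero w → Mem g w → ∀ λ′ → Mem g (λ′ ⊙ w)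
      multiple-mem {g} {w} nz@(j , wj≢𝟎) gw λ′ = Mem-cong agree gc
        where
        ext : ∃ λ p → point g p j ≡ λ′ ∙ w j
        ext = coordinate-surjective normalSpread gw wj≢𝟎 (λ′ ∙ w j)
        c : Config
        c = point g (proj₁ ext)
        gc : Mem g c
        gc = point-in g (proj₁ ext)
        agree : c ≗ λ′ ⊙ w
        agree k = byIndex (k Fin.≟ j)
          where
          byIndex : Dec (k ≡ j) → c k ≡ λ′ ∙ w k
          byIndex (yes refl) = proj₂ ext
          byIndex (no k≢j) = D-unique wj≢𝟎 (k≢j ∘ sym)
            (subst (λ a → D j k (w j) (w k) a (c k)) (proj₂ ext) (restrict (k≢j ∘ sym) (g , gw , gc)))
            (D-multiple (k≢j ∘ sym) wj≢𝟎 (w k) λ′)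

      mem-multiple : ∀ {g w} → Nonzero w → Mem g w → ∀ {c} → Mem g c → ∃ λ λ′ → c ≗ λ′ ⊙ w
      mem-multiple {g} {w} nz@(j , wj≢𝟎) gw {c} gc = proj₁ λ′ ,
        determined normalSpread gw wj≢𝟎 gc (multiple-mem nz gw (proj₁ λ′)) (sym (proj₂ λ′))
        where
        λ′ : ∃ λ y → y ∙ w j ≡ c j
        λ′ = divide (c j) (w j) wj≢𝟎

-- Linear combinations over F

lookup-ext : ∀ {A : Set} {k} {x y : Vec A k} → (∀ j → lookup x j ≡ lookup y j) → x ≡ y
lookup-ext {x = x} {y} e = trans (sym (Vec.tabulate∘lookup x)) (trans (Vec.tabulate-cong e) (Vec.tabulate∘lookup y))

module Combinations (F : Field) where
  open LinearAlgebra F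
  open LinAlg F
  open IsLinear
  private module S = Space scalars

  ∑-pointwise : ∀ {N k} (f : Fin k → V N) p → ∑ f p ≡ S.∑ {k} (λ j → f j p)
  ∑-pointwise {k = zero} f p = refl
  ∑-pointwise {k = suc k} f p = cong (f Fin.zero p +ᶠ_) (∑-pointwise (f ∘ Fin.suc) p)

  lincomb-pointwise : ∀ {N k} (c : Fin k → 𝔽) (b : Fin k → V N) p → lincomb c b p ≡ S.∑ {k} (λ j → c j *ᶠ b j p)
  lincomb-pointwise c b = ∑-pointwise (λ j → c j · b j)

  lincomb-cong : ∀ {N k} (c c′ : Fin k → 𝔽) (b : Fin k → V N) → c ≗ c′ → lincomb c b ≈ lincomb c′ b
  lincomb-cong {k = k} c c′ b e p = trans (lincomb-pointwise c b p) (trans (S.∑-cong {k} (λ j → cong (_*ᶠ b j p) (e j)))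
    (sym (lincomb-pointwise c′ b p)))

  ∑-++ : ∀ m {k} (h : Fin (m + k) → 𝔽) → S.∑ {m + k} h ≡ S.∑ {m} (λ j → h (j ↑ˡ k)) +ᶠ S.∑ {k} (λ j → h (m ↑ʳ j))
  ∑-++ zero h = sym (𝔽.+-identityˡ _)
  ∑-++ (suc m) h = trans (cong (h Fin.zero +ᶠ_) (∑-++ m (h ∘ Fin.suc))) (sym (𝔽.+-assoc _ _ _))

  ∑-combine : ∀ r {n} (h : Fin (r * n) → 𝔽) → S.∑ {r * n} h ≡ S.∑ {r} (λ j → S.∑ {n} (λ k → h (combine j k)))
  ∑-combine zero h = refl
  ∑-combine (suc r) {n} h = trans (∑-++ n h) (cong (S.∑ {n} (λ k → h (k ↑ˡ (r * n))) +ᶠ_) (∑-combine r (h ∘ (n ↑ʳ_))))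

  lincomb-++ : ∀ {N m k} (c : Fin (m + k) → 𝔽) (a : Fin m → V N) (b : Fin k → V N) →
    lincomb c (a VF.++ b) ≈ (lincomb (λ j → c (j ↑ˡ k)) a ⊕ lincomb (λ j → c (m ↑ʳ j)) b)
  lincomb-++ {m = m} {k} c a b p = trans (lincomb-pointwise c (a VF.++ b) p) (trans (∑-++ m _)
    (cong₂ _+ᶠ_ (trans (S.∑-cong {m} left) (sym (lincomb-pointwise _ a p)))
                (trans (S.∑-cong {k} right) (sym (lincomb-pointwise _ b p)))))
    where
    left : ∀ j → c (j ↑ˡ k) *ᶠ (a VF.++ b) (j ↑ˡ k) p ≡ c (j ↑ˡ k) *ᶠ a j p
    left j rewrite Fin.splitAt-↑ˡ m j k = refl
    right : ∀ j → c (m ↑ʳ j) *ᶠ (a VF.++ b) (m ↑ʳ j) p ≡ c (m ↑ʳ j) *ᶠ b j p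
    right j rewrite Fin.splitAt-↑ʳ m k j = refl

  lincomb-concat : ∀ {N r n} (c : Fin (r * n) → 𝔽) (b : Fin r → Fin n → V N) p →
    lincomb c (VF.concat b) p ≡ S.∑ {r} (λ j → lincomb (λ k → c (combine j k)) (b j) p)
  lincomb-concat {r = r} {n} c b p = trans (lincomb-pointwise c (VF.concat b) p) (trans (∑-combine r _)
    (S.∑-cong {r} (λ j → trans (S.∑-cong {n} (λ k → cong (λ x → c (combine j k) *ᶠ x p) (entry j k)))
      (sym (lincomb-pointwise _ (b j) p)))))
    where
    entry : ∀ j k → VF.concat b (combine j k) ≡ b j k
    entry j k rewrite cong Product.swap (Fin.remQuot-combine {r} {n} j k) = refl

  lincomb-Vec : ∀ {N n} → (Fin n → V N) → Vec 𝔽 n → V N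
  lincomb-Vec b x = lincomb (lookup x) b

  module _ {N n : ℕ} (b : Fin n → V N) where

    lincomb-⊞ : ∀ x y → lincomb-Vec b (zipWith _+ᶠ_ x y) ≈ (lincomb-Vec b x ⊕ lincomb-Vec b y)
    lincomb-⊞ x y p = trans (lincomb-pointwise (lookup (zipWith _+ᶠ_ x y)) b p) (trans (S.∑-cong {n} (λ j →
        trans (cong (_*ᶠ b j p) (Vec.lookup-zipWith _+ᶠ_ j x y)) (𝔽.distribʳ (b j p) (lookup x j) (lookup y j))))
      (trans (S.∑-⊞ {n} _ _) (sym (cong₂ _+ᶠ_ (lincomb-pointwise (lookup x) b p) (lincomb-pointwise (lookup y) b p)))))

    lincomb-• : ∀ a x → lincomb-Vec b (map (a *ᶠ_) x) ≈ (a · lincomb-Vec b x)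
    lincomb-• a x p = trans (lincomb-pointwise (lookup (map (a *ᶠ_) x)) b p) (trans (S.∑-cong {n} (λ j →
        trans (cong (_*ᶠ b j p) (Vec.lookup-map j (a *ᶠ_) x)) (𝔽.*-assoc a (lookup x j) (b j p))))
      (trans (sym (map-∑ (scale-linear scalars a) {n} (λ j → lookup x j *ᶠ b j p)))
        (cong (a *ᶠ_) (sym (lincomb-pointwise (lookup x) b p)))))

    span⇒lincomb-Vec : ∀ {v} → v ∈span b → ∃ λ x → v ≈ lincomb-Vec b x
    span⇒lincomb-Vec (c , e) = tabulate c , λ p → trans (e p) (lincomb-cong c (lookup (tabulate c)) b (λ j → sym (Vec.lookup∘tabulate c j)) p)

    lincomb-Vec⇒span : ∀ {v} x → v ≈ lincomb-Vec b x → v ∈span b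
    lincomb-Vec⇒span x e = lookup x , e

    lincomb-injective : LinIndep b → ∀ x → lincomb-Vec b x ≈ 0v → x ≡ replicate n 0ᶠ
    lincomb-injective indep x e = lookup-ext (λ j → trans (indep (lookup x) e j) (sym (Vec.lookup-replicate j 0ᶠ)))

-- Coordinates along the normal elements of a given spread

module NormalCoordinates {F : Field} {q : ℕ} (ord : HasOrder F q) (n r : ℕ)
  (S : LinAlg.Spread F (r * n) n) (e : Fin r → LinAlg.Spread.Idx S)
  (normal : ∀ j → LinAlg.IsNormal F S (e j)) (spans : LinAlg.SpanWhole F S e) where
  open LinearAlgebra F
  open IsLinear
  open LinAlg F using (V; _≈_; 0v; _⊕_; _·_; NonZeroV; lincomb; _∈span_)
  private module L = LinAlg F
  open L.Spread S
  open Combinations F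
  open Coordinates {F} ord n r
  open Space (W {F} ord n)
  private module S = Space scalars

  Λ : Idx → Vector → V (r * n)
  Λ i = lincomb-Vec (basis i)

  Ψ : Config → V (r * n)
  Ψ c p = S.∑ {r} (λ j → Λ (e j) (c j) p)

  Ψ-cong : ∀ c c′ → c ≗ c′ → Ψ c ≈ Ψ c′
  Ψ-cong c c′ eq p = S.∑-cong {r} (λ j → cong (λ x → Λ (e j) x p) (eq j))

  Ψ-⊞ : ∀ c c′ → Ψ (c ⊞ᶜ c′) ≈ (Ψ c ⊕ Ψ c′)
  Ψ-⊞ c c′ p = trans (S.∑-cong {r} (λ j → lincomb-⊞ (basis (e j)) (c j) (c′ j) p)) (S.∑-⊞ {r} _ _)

  Ψ-• : ∀ a c → Ψ (a •ᶜ c) ≈ (a · Ψ c)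
  Ψ-• a c p = trans (S.∑-cong {r} (λ j → lincomb-• (basis (e j)) a (c j) p))
    (sym (map-∑ (scale-linear scalars a) {r} (λ j → Λ (e j) (c j) p)))

  Ψ-surjective : ∀ v → ∃ λ c → Ψ c ≈ v
  Ψ-surjective v = (λ j → tabulate (block j)) , λ p → sym (trans (proj₂ (spans v) p)
    (trans (lincomb-concat {r = r} (proj₁ (spans v)) (λ j → basis (e j)) p)
    (S.∑-cong {r} (λ j → lincomb-cong (block j) (lookup (tabulate (block j))) (basis (e j)) (λ k → sym (Vec.lookup∘tabulate (block j) k)) p))))

    where
    block : Fin r → Fin n → 𝔽
    block j k = proj₁ (spans v) (combine j k)

  private
    A : Set
    A = Vec 𝔽 (r * n)

    I-A : Fin (q ^ (r * n)) ↔ A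
    I-A = vec-finite ord (r * n)

    I-C : Fin (q ^ (r * n)) ↔ Vec Vector r
    I-C = subst (λ s → Fin s ↔ Vec Vector r) (trans (^-*-assoc q n r) (cong (q ^_) (*-comm n r)))
      (vec-finite (vec-finite ord n) r)

    -- `surjective⇒injective` concerns self-maps, while `Ψ` runs between different types;
    -- configurations are therefore identified with vectors of length r n through their equal
    -- numbers of elements.
    recode : A → Vec Vector r
    recode a = Inverse.to I-C (Inverse.from I-A a)

    encode : Vec Vector r → A
    encode c = Inverse.to I-A (Inverse.from I-C c)

    recode-encode : ∀ c → recode (encode c) ≡ c
    recode-encode c = trans (cong (Inverse.to I-C) (Inverse.strictlyInverseʳ I-A _)) (Inverse.strictlyInverseˡ I-C c)

    f : A → A
    f a = tabulate (Ψ (lookup (recode a)))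

    f-encode : ∀ c → f (encode (tabulate c)) ≡ tabulate (Ψ c)
    f-encode c = trans (cong (λ x → tabulate (Ψ (lookup x))) (recode-encode (tabulate c)))
      (Vec.tabulate-cong (Ψ-cong (lookup (tabulate c)) c (Vec.lookup∘tabulate c)))

    f-surjective : ∀ y → ∃ λ x → f x ≡ y
    f-surjective y = encode (tabulate c) , trans (f-encode c) (trans (Vec.tabulate-cong (proj₂ (Ψ-surjective (lookup y))))
      (Vec.tabulate∘lookup y))
      where
      c : Config
      c = proj₁ (Ψ-surjective (lookup y))

  -- Spanning gives surjectivity; as both sides have q ^ (r n) elements, injectivity follows by
  -- counting.
  Ψ-injective : ∀ c c′ → Ψ c ≈ Ψ c′ → c ≗ c′
  Ψ-injective c c′ eq j = trans (sym (Vec.lookup∘tabulate c j)) (trans (cong (λ x → lookup x j) tab≡) (Vec.lookup∘tabulate c′ j))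
    where
    enc≡ : encode (tabulate c) ≡ encode (tabulate c′)
    enc≡ = surjective⇒injective I-A f f-surjective
      (trans (f-encode c) (trans (Vec.tabulate-cong eq) (sym (f-encode c′))))
    tab≡ : tabulate c ≡ tabulate c′
    tab≡ = trans (sym (recode-encode _)) (trans (cong recode enc≡) (recode-encode _))

  Ψ-axis : ∀ j c → (∀ k → k ≢ j → c k ≡ 𝟎) → Ψ c ≈ Λ (e j) (c j)
  Ψ-axis j c z p = S.∑-single {r} (λ k → Λ (e k) (c k) p) j
    (λ k k≢j → trans (cong (λ x → Λ (e k) x p) (trans (z k k≢j) (sym (0-• 𝟎)))) (trans (lincomb-• (basis (e k)) 0ᶠ 𝟎 p) (𝔽.zeroˡ _)))

  Mem : Idx → Config → Set
  Mem i c = Ψ c ∈span basis i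

  Mem-≈ : ∀ i c x → Ψ c ≈ Λ i x → Mem i c
  Mem-≈ i c x = lincomb-Vec⇒span (basis i) x

  coordinates : ∀ i c → Mem i c → ∃ λ x → Ψ c ≈ Λ i x
  coordinates i c = span⇒lincomb-Vec (basis i)

  point : Idx → Vector → Config
  point i x = proj₁ (Ψ-surjective (Λ i x))

  Ψ-point : ∀ i x → Ψ (point i x) ≈ Λ i x
  Ψ-point i x = proj₂ (Ψ-surjective (Λ i x))

  Ψ-𝟎 : ∀ c → Zero c → Ψ c ≈ 0v
  Ψ-𝟎 c z p = trans (Ψ-cong c (0ᶠ •ᶜ c) (λ j → trans (z j) (sym (0-• (c j)))) p) (trans (Ψ-• 0ᶠ c p) (𝔽.zeroˡ _))

  Nonzero⇒NonZeroV : ∀ c → Nonzero c → NonZeroV (Ψ c)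
  Nonzero⇒NonZeroV c (j , ne) z = ne (Ψ-injective c (λ _ → 𝟎) (λ p → trans (z p) (sym (Ψ-𝟎 (λ _ → 𝟎) (λ _ → refl) p))) j)

  onAxis : Fin r → Vector → Config
  onAxis j x k with k Fin.≟ j
  ... | yes _ = x
  ... | no _ = 𝟎

  onAxis-same : ∀ j x → onAxis j x j ≡ x
  onAxis-same j x with j Fin.≟ j
  ... | yes _ = refl
  ... | no ne = contradiction refl ne

  onAxis-other : ∀ j x k → k ≢ j → onAxis j x k ≡ 𝟎
  onAxis-other j x k ne with k Fin.≟ j
  ... | yes eq = contradiction eq ne
  ... | no _ = refl

  -- `disjoint` identifies `g` with the element through the sum of `u` and `v` that the partition
  -- provides, so `w` lies in the span of the two bases; the two halves of its coefficients give
  -- `u′` and `v′`.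
  spread-normal : ∀ j {f g u v w} → f ≢ e j → Mem (e j) u → Mem f v → Nonzero (u ⊞ᶜ v) →
    Mem g (u ⊞ᶜ v) → Mem g w → ∃ λ u′ → ∃ λ v′ → Mem (e j) u′ × Mem f v′ × w ≗ u′ ⊞ᶜ v′
  spread-normal j {f} {g} {u} {v} {w} f≢ mu mv nz mg mw =
    point (e j) x , point f y , Mem-≈ (e j) (point (e j) x) x (Ψ-point (e j) x) , Mem-≈ f (point f y) y (Ψ-point f y) ,
    Ψ-injective w (point (e j) x ⊞ᶜ point f y) (λ p → trans (proj₂ w∈ p) (trans (lincomb-++ (proj₁ w∈) (basis (e j)) (basis f) p)
      (trans (cong₂ _+ᶠ_ (half (basis (e j)) (λ k → proj₁ w∈ (k ↑ˡ n)) p) (half (basis f) (λ k → proj₁ w∈ (n ↑ʳ k)) p))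
        (sym (trans (Ψ-⊞ (point (e j) x) (point f y) p) (cong₂ _+ᶠ_ (Ψ-point (e j) x p) (Ψ-point f y p)))))))
    where
    half : ∀ (b : Fin n → V (r * n)) c → lincomb c b ≈ lincomb-Vec b (tabulate c)
    half b c = lincomb-cong c (lookup (tabulate c)) b (λ k → sym (Vec.lookup∘tabulate c k))
    both : Ψ (u ⊞ᶜ v) ∈span (basis (e j) VF.++ basis f)
    both = c , λ p → trans (Ψ-⊞ u v p) (trans (cong₂ _+ᶠ_ (left p) (right p)) (sym (lincomb-++ c (basis (e j)) (basis f) p)))
      where
      c : Fin (n + n) → 𝔽
      c = proj₁ mu VF.++ proj₁ mv
      left : Ψ u ≈ lincomb (λ k → c (k ↑ˡ n)) (basis (e j))
      left p = trans (proj₂ mu p) (lincomb-cong (proj₁ mu) (λ k → c (k ↑ˡ n)) (basis (e j)) left′ p)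
        where
        left′ : ∀ k → proj₁ mu k ≡ c (k ↑ˡ n)
        left′ k rewrite Fin.splitAt-↑ˡ n k n = refl
      right : Ψ v ≈ lincomb (λ k → c (n ↑ʳ k)) (basis f)
      right p = trans (proj₂ mv p) (lincomb-cong (proj₁ mv) (λ k → c (n ↑ʳ k)) (basis f) right′ p)
        where
        right′ : ∀ k → proj₁ mv k ≡ c (n ↑ʳ k)
        right′ k rewrite Fin.splitAt-↑ʳ n n k = refl
    partitioned : ∃ λ i → Ψ (u ⊞ᶜ v) ∈span basis i × LinAlg._⊆span_ F (basis i) (basis (e j) VF.++ basis f)
    partitioned = normal j f f≢ (Ψ (u ⊞ᶜ v)) (Nonzero⇒NonZeroV (u ⊞ᶜ v) nz) both
    w∈ : Ψ w ∈span (basis (e j) VF.++ basis f)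
    w∈ = proj₂ (proj₂ partitioned) (Ψ w) (subst (λ i → Mem i w)
      (disjoint (Ψ (u ⊞ᶜ v)) (Nonzero⇒NonZeroV (u ⊞ᶜ v) nz) g (proj₁ partitioned) mg (proj₁ (proj₂ partitioned))) mw)
    x y : Vector
    x = tabulate (λ k → proj₁ w∈ (k ↑ˡ n))
    y = tabulate (λ k → proj₁ w∈ (n ↑ʳ k))

  normalSpread : NormalSpread
  normalSpread = record
    { Idx = Idx
    ; Mem = Mem
    ; Mem-cong = λ {i} {c} {c′} eq (a , m) → a , λ p → trans (sym (Ψ-cong c c′ eq p)) (m p)
    ; Mem-⊞ = λ {i} {c} {c′} m m′ → let x , ex = coordinates i c m ; y , ey = coordinates i c′ m′ in
        Mem-≈ i (c ⊞ᶜ c′) (x ⊞ y) (λ p → trans (Ψ-⊞ c c′ p) (trans (cong₂ _+ᶠ_ (ex p) (ey p)) (sym (lincomb-⊞ (basis i) x y p))))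
    ; Mem-• = λ {i} a {c} m → let x , ex = coordinates i c m in
        Mem-≈ i (a •ᶜ c) (a • x) (λ p → trans (Ψ-• a c p) (trans (cong (a *ᶠ_) (ex p)) (sym (lincomb-• (basis i) a x p))))
    ; cover = λ c nz → cover (Ψ c) (Nonzero⇒NonZeroV c nz)
    ; disjoint = λ {c} {i} {j} nz → disjoint (Ψ c) (Nonzero⇒NonZeroV c nz) i j
    ; point = point
    ; point-⊞ = λ i x y → Ψ-injective (point i (x ⊞ y)) (point i x ⊞ᶜ point i y) (λ p → trans (Ψ-point i (x ⊞ y) p)
        (trans (lincomb-⊞ (basis i) x y p)
        (sym (trans (Ψ-⊞ (point i x) (point i y) p) (cong₂ _+ᶠ_ (Ψ-point i x p) (Ψ-point i y p))))))
    ; point-• = λ i a x → Ψ-injective (point i (a • x)) (a •ᶜ point i x) (λ p → trans (Ψ-point i (a • x) p)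
        (trans (lincomb-• (basis i) a x p)
        (sym (trans (Ψ-• a (point i x) p) (cong (a *ᶠ_) (Ψ-point i x p))))))
    ; point-0 = λ i x z → lincomb-injective (basis i) (indep i) x (λ p → trans (sym (Ψ-point i x p)) (Ψ-𝟎 (point i x) z p))
    ; point-in = λ i x → Mem-≈ i (point i x) x (Ψ-point i x)
    ; axis = e
    ; axis-mem = λ j {c} z → Mem-≈ (e j) c (c j) (Ψ-axis j c z)
    ; mem-axis = λ j {c} m k k≢j → let x , ex = coordinates (e j) c m in
        trans (Ψ-injective c (onAxis j x) (λ p → trans (ex p) (sym (trans (Ψ-axis j (onAxis j x) (onAxis-other j x) p)
          (cong (λ y → Λ (e j) y p) (onAxis-same j x))))) k) (onAxis-other j x k k≢j)
    ; normal = spread-normal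
    }

-- The field and the identification with field reduction

module CoordinateField {F : Field} {q : ℕ} (ord : HasOrder F q) (n : ℕ) (0<n : 0 < n) {m : ℕ} (m-eq : suc m ≡ q ^ n)
  (coprime : ∀ ℓ → Prime ℓ → ℓ ∣ n → ¬ ℓ ∣ m) (s : ℕ) where
  private
    r : ℕ
    r = suc (suc (suc s))
  module _ (S : LinAlg.Spread F (r * n) n) (e : Fin r → LinAlg.Spread.Idx S)
    (normal : ∀ j → LinAlg.IsNormal F S (e j)) (spans : LinAlg.SpanWhole F S e) where
    open LinearAlgebra F
    open IsLinear
    private module L = LinAlg F
    open L using (V; _≈_; _⊕_; _·_; _∈span_)
    open L.Spread S using (Idx; basis)
    open Coordinates {F} ord n r
    open Space (W {F} ord n)
    module N = NormalCoordinates {F} ord n r S e normal spans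
    open N using (Ψ; Ψ-cong; Ψ-⊞; Ψ-•; Ψ-injective; Ψ-surjective)

    one : Vector
    one = replicate n 1ᶠ

    one≢𝟎 : one ≢ 𝟎
    one≢𝟎 = ones≢𝟎 {F} ord n 0<n

    private
      -- The element that becomes the diagonal. Any point with all coordinates equal to one nonzero
      -- vector would serve.
      d : ∃ λ i → NormalSpread.Mem N.normalSpread i (λ _ → one)
      d = NormalSpread.cover N.normalSpread (λ _ → one) (Fin.zero , one≢𝟎)

    module R = Rescale N.normalSpread one≢𝟎 (proj₂ d)
    open R using (scale; scaleᶜ; unscaleᶜ)
    module D = DiagonalSpread R.diagonalSpread
    open Multiplication R.diagonalSpread {Fin.zero} {Fin.suc Fin.zero} {Fin.suc (Fin.suc Fin.zero)}
      (λ ()) (λ ()) (λ ()) one≢𝟎 hiding (module Lines)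

    ∙-comm : ∀ x y → x ∙ y ≡ y ∙ x
    ∙-comm = UnitGroup.nearfield-commutative ord n 0<n m-eq coprime nearfield

    open Multiplication.Lines R.diagonalSpread {Fin.zero} {Fin.suc Fin.zero} {Fin.suc (Fin.suc Fin.zero)}
      (λ ()) (λ ()) (λ ()) one≢𝟎 ∙-comm
    open Nearfield nearfield using (one-∙; ∙-one)

    K : Field
    K = record
      { Carrier = Vector ; _+_ = _⊞_ ; _*_ = _∙_ ; -_ = ⊟_ ; 0# = 𝟎 ; 1# = one
      ; isCommutativeRing = record
        { isRing = record
          { +-isAbelianGroup = isAbelianGroup
          ; *-cong = cong₂ _∙_
          ; *-assoc = ∙-assoc
          ; *-identity = one-∙ , ∙-one
          ; distrib = (λ x y z → additive (∙-linear x) y z)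
                    , (λ x y z → trans (∙-comm (y ⊞ z) x) (trans (additive (∙-linear x) y z) (cong₂ _⊞_ (∙-comm x y) (∙-comm x z)))) }
        ; *-comm = ∙-comm }
      ; 0≢1 = λ eq → one≢𝟎 (sym eq)
      ; inverse = right-inv }

    -- Scalars are embedded as multiples of `one`; commutativity moves them to the side on which the
    -- product is linear.
    scalar-∙ : ∀ a x → (a • one) ∙ x ≡ a • x
    scalar-∙ a x = trans (∙-comm (a • one) x) (trans (homogeneous (∙-linear x) a one) (cong (a •_) (∙-one x)))

    scalarHom : FieldHom F K
    scalarHom = record
      { ι = _• one
      ; ι-+ = λ a b → +-• a b one
      ; ι-* = λ a b → trans (*-• a b one) (sym (scalar-∙ a (b • one)))
      ; ι-1 = 1-• one }

    φ : Config → V (r * n)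
    φ w = Ψ (scaleᶜ w)

    φ-cong : ∀ u w → u ≗ w → φ u ≈ φ w
    φ-cong u w eq = Ψ-cong (scaleᶜ u) (scaleᶜ w) (λ j → cong (scale j) (eq j))

    φ-⊞ : ∀ u w → φ (u ⊞ᶜ w) ≈ (φ u ⊕ φ w)
    φ-⊞ u w p = trans (Ψ-cong (scaleᶜ (u ⊞ᶜ w)) (scaleᶜ u ⊞ᶜ scaleᶜ w) (R.scaleᶜ-⊞ u w) p) (Ψ-⊞ (scaleᶜ u) (scaleᶜ w) p)

    φ-scalar : ∀ a u → φ ((a • one) ⊙ u) ≈ (a · φ u)
    φ-scalar a u p = trans (Ψ-cong (scaleᶜ ((a • one) ⊙ u)) (a •ᶜ scaleᶜ u)
      (λ j → trans (cong (scale j) (scalar-∙ a (u j))) (homogeneous (R.scale-linear′ j) a (u j))) p) (Ψ-• a (scaleᶜ u) p)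

    φ-injective : ∀ u w → φ u ≈ φ w → u ≗ w
    φ-injective u w eq j = R.scale-injective j (Ψ-injective (scaleᶜ u) (scaleᶜ w) eq j)

    φ-surjective : ∀ v → ∃ λ u → φ u ≈ v
    φ-surjective v = unscaleᶜ c , λ p → trans (Ψ-cong (scaleᶜ (unscaleᶜ c)) c (λ j → R.scale-unscale j (c j)) p) (proj₂ (Ψ-surjective v) p)
      where
      c : Config
      c = proj₁ (Ψ-surjective v)

    element-is-line : ∀ i w → Nonzero w → D.Mem i w → ∀ v → (v ∈span basis i) ⇔ (∃ λ λ′ → v ≈ φ (λ′ ⊙ w))
    element-is-line i w nz mw v = mk⇔ to from
      where
      to : v ∈span basis i → ∃ λ λ′ → v ≈ φ (λ′ ⊙ w)
      to (a , eq) = proj₁ λ′ , λ p → trans (sym (proj₂ (φ-surjective v) p)) (φ-cong c (proj₁ λ′ ⊙ w) (proj₂ λ′) p)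
        where
        c : Config
        c = proj₁ (φ-surjective v)
        λ′ : ∃ λ λ′ → c ≗ λ′ ⊙ w
        λ′ = mem-multiple nz mw (a , λ p → trans (proj₂ (φ-surjective v) p) (eq p))
      from : (∃ λ λ′ → v ≈ φ (λ′ ⊙ w)) → v ∈span basis i
      from (λ′ , eq) = proj₁ m′ , λ p → trans (eq p) (proj₂ m′ p)
        where
        m′ : D.Mem i (λ′ ⊙ w)
        m′ = multiple-mem nz mw λ′

    desarguesian : LinAlg.Desarguesian F q n r S
    desarguesian = K , vec-finite ord n , scalarHom , φ , φ-cong , φ-⊞ , φ-scalar , φ-injective , φ-surjective ,
      (λ i → D.point i one , Nonzero⇒¬Zero (nonzero i) , element-is-line i (D.point i one) (nonzero i) (D.point-in i one)) ,
      (λ w nz → let i , mw = D.cover w (¬Zero⇒Nonzero nz) in i , element-is-line i w (¬Zero⇒Nonzero nz) mw)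
      where
      nonzero : ∀ i → Nonzero (D.point i one)
      nonzero i = ¬Zero⇒Nonzero (λ z → one≢𝟎 (D.point-0 i one z))

theorem4p2 : (q n r : ℕ) → IsPrimePower q → 1 ≤ n → 2 < r →
    (∀ k m → k * m ≡ n → k < n →
    ¬ DicksonPair (q ^ k) m × ¬ ExceptionalPair (q ^ k) m) →
    (F : Field) → HasOrder F q →
    (S : LinAlg.Spread F (r * n) n) →
    (e : Fin r → LinAlg.Spread.Idx S) →
    (∀ i j → e i ≡ e j → i ≡ j) →
    (∀ j → LinAlg.IsNormal F S (e j)) →
    LinAlg.SpanWhole F S e →
    LinAlg.Desarguesian F q n r S
theorem4p2 q n (suc (suc (suc s))) primePower 1≤n (s≤s (s≤s (s≤s _))) noPairs F ord S e _ normal spans =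
  CoordinateField.desarguesian ord n 1≤n
    (suc-pred (q ^ n) {{>-nonZero (m^n>0 q {{>-nonZero (<-trans (s≤s z≤n) (1<q {F} ord))}} n)}})
    (λ ℓ pr ℓ∣n ℓ∣m → noDickson⇒coprime q n primePower 1≤n (λ k m eq k<n → proj₁ (noPairs k m eq k<n)) ℓ pr ℓ∣n ℓ∣m)
    s S e normal spans
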